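{- Let $K$ be a field of characteristic different from $2$ and $3$, with algebraic closure $\overline{K}$. Let $f\in K[z]$ be a cubic polynomial whose two finite critical points $\gamma_1,\gamma_2\in\overline{K}$ collide at the $\ell$-th iterate for some integer $\ell\geq 2$, i.e. $f^{\ell}(\gamma_1)=f^{\ell}(\gamma_2)$ but $f^{\ell-1}(\gamma_1)\neq f^{\ell-1}(\gamma_2)$. Then $f^{\ell}(\gamma_1)=f^{\ell}(\gamma_2)$ lies in $K$. Furthermore, fix any $x_0\in K$ such that $x_0$ is not periodic under $f$ and no critical point of $f$ lies in the backward orbit of $x_0$. Let $K_n=K(f^{ -n}(x_0))$, $K_\infty=\bigcup_{n\geq 0}K_n$, and let $G_{K,\infty}=\operatorname{Gal}(K_\infty/K)$ be the arboreal Galois group for $f$ over $K$ rooted at $x_0$. Then: (1) $G_{K,\infty}$ is isomorphic to a subgroup of $\widetilde{Q}_{\ell,\infty}$, via an appropriate labeling of the tree. (2) $G_{K,\infty}$ is isomorphic to a subgroup of $Q_{\ell,\infty}$ (via an appropriate labeling of the tree) if and only if $-3$ is a square in $K$.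
   Context: Notation: $f^n=f\circ\cdots\circ f$ ($n$ times), $f^0(z)=z$, and $f^{ -n}(x_0)$ is the set of solutions of $f^n(z)=x_0$ in $\overline{K}$. The backward orbit of $x_0$ is $\operatorname{Orb}_f^-(x_0)=\coprod_{n\geq 0} f^{ -n}(x_0)$. When no critical point of $f$ lies in it, it is identified with the infinite ternary rooted tree $T_{3,\infty}$: the root is $x_0$, the $3^n$ nodes at level $n$ are the elements of $f^{ -n}(x_0)$, and each $y\in f^{ -n}(x_0)$ with $n\geq1$ is joined by an edge to $f(y)\in f^{ -(n-1)}(x_0)$. The group $G_{K,\infty}$ acts faithfully on this tree, so it embeds in the automorphism group $\operatorname{Aut}(T_{3,\infty})$ of the rooted tree. "Isomorphic" for groups acting on a tree means isomorphic equivariantly with respect to the action on the tree; thus $G_{K,\infty}$ is isomorphic to a subgroup of $\widetilde{Q}_{\ell,\infty}$ (resp. $Q_{\ell,\infty}$) if, for some labeling of the tree $\operatorname{Orb}_f^-(x_0)$, the action of every element of $G_{K,\infty}$ lies in the group $\widetilde{Q}_{\ell,\infty}$ (resp. $Q_{\ell,\infty}$) defined using that labeling. A labeling of $T_{3,\infty}$ assigns to each node at level $m$ a unique word $s_1\cdots s_m$ with $s_i\in\{0,1,2\}$, such that the node immediately below (its parent) has label $s_1\cdots s_{m-1}$; the root has the empty label. Given a labeling, for $\sigma\in\operatorname{Aut}(T_{3,\infty})$, a node $y$ and $m\geq 1$, write $\sigma(ys_1\cdots s_m)=\sigma(y)t_1\cdots t_m$; then $(s_1,\dots,s_m)\mapsto(t_1,\dots,t_m)$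 is a permutation of $\{0,1,2\}^m$, and $\operatorname{sgn}_m(\sigma,y)\in\{\pm1\}$ is the sign of this permutation. For $\ell\geq 2$, $\widetilde{Q}_{\ell,\infty}$ is the set of all $\sigma\in\operatorname{Aut}(T_{3,\infty})$ such that $\operatorname{sgn}_\ell(\sigma,y)\operatorname{sgn}_{\ell-1}(\sigma,y)=\operatorname{sgn}_\ell(\sigma,x_0)\operatorname{sgn}_{\ell-1}(\sigma,x_0)$ for every node $y$, where $x_0$ is the root; $Q_{\ell,\infty}$ is the set of all $\sigma\in\widetilde{Q}_{\ell,\infty}$ for which this common product is $+1$. Both are subgroups of $\operatorname{Aut}(T_{3,\infty})$. -}

module Defs where

open import Level using (Level; _⊔_; 0ℓ) renaming (suc to lsuc)
open import Algebra.Bundles using (CommutativeRing)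
open import Algebra.Bundles.Raw using (RawRing)
open import Algebra.Apartness.Bundles using (HeytingField; HeytingCommutativeRing)
open import Algebra.Morphism.Structures using (module RingMorphisms)
import Algebra.Definitions.RawMonoid as RawMonoidDefs
open import Data.Bool.Base using (if_then_else_)
open import Data.Fin.Base using (Fin; toℕ; funToFin; finToFun)
import Data.Fin.Properties as Fin
open import Data.Nat.Base using (ℕ; zero; suc; _∸_; _^_; _≤_) renaming (_+_ to _+ℕ_)
import Data.Nat.Properties as ℕ
open import Data.Nat.Divisibility using (_∣_)
open import Data.Nat.GeneralisedArithmetic using (iterate)
open import Data.Product.Base using (Σ; ∃; ∃-syntax; _×_; _,_; proj₁; proj₂)
open import Data.Sign.Base as Sign using (Sign)
open import Data.Vec.Base using (Vec; []; _∷_; _++_; map; init; last; lookup; tabulate; drop)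
open import Function.Base using (_∘_)
open import Function.Bundles using (Inverse; _↔_; _⇔_)
import Function.Construct.Composition as Composition
import Function.Construct.Symmetry as Symmetry
open import Relation.Binary.Bundles using (Setoid)
import Relation.Binary.Construct.On as On
open import Relation.Binary.PropositionalEquality.Core as ≡ using (_≡_)
import Relation.Binary.PropositionalEquality.Properties as ≡
import Relation.Binary.Reasoning.Setoid as SetoidReasoning
open import Relation.Nullary.Decidable using (does; _×-dec_)
open import Relation.Nullary.Negation using (¬_)
open import Relation.Unary using (Pred; _∈_; _⊆_)

private
  variable
    c ℓ₁ ℓ₂ c′ ℓ₁′ ℓ₂′ : Level

-- Under excluded middle a Heyting field is the same thing as a field in
-- the classical sense, its apartness being the negation of _≈_.
fieldRing : HeytingField c ℓ₁ ℓ₂ → CommutativeRing c ℓ₁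
fieldRing K = HeytingCommutativeRing.commutativeRing (HeytingField.heytingCommutativeRing K)

fieldRawRing : HeytingField c ℓ₁ ℓ₂ → RawRing c ℓ₁
fieldRawRing K = CommutativeRing.rawRing (fieldRing K)

module _ (K : HeytingField c ℓ₁ ℓ₂) where
  open CommutativeRing (fieldRing K)
  open RawMonoidDefs +-rawMonoid using () renaming (_×_ to _·_)

  HasCharacteristic : ℕ → Set ℓ₁
  HasCharacteristic p = ∀ n → (n · 1# ≈ 0#) ⇔ (p ∣ n)

  MinusThreeIsSquare : Set (c ⊔ ℓ₁)
  MinusThreeIsSquare = ∃[ a ] a * a ≈ - (3 · 1#)

-- Polynomials, as coefficient vectors with the constant term first:
-- Poly n consists of the polynomials of degree < n, and an element of
-- Poly (suc n) has degree exactly n when its last entry is nonzero.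

module Polynomial (R : RawRing c ℓ₁) where
  open RawRing R
  open RawMonoidDefs +-rawMonoid using () renaming (_×_ to _·_)

  Poly : ℕ → Set c
  Poly = Vec Carrier

  HasDegree : ∀ n → Poly (suc n) → Set ℓ₁
  HasDegree n p = ¬ (last p ≈ 0#)

  eval : ∀ {n} → Poly n → Carrier → Carrier
  eval []      x = 0#
  eval (a ∷ p) x = a + x * eval p x

  derivative : ∀ {n} → Poly (suc n) → Poly n
  derivative (_ ∷ p) = tabulate λ i → suc (toℕ i) · lookup p i

record AlgebraicClosure (K : HeytingField c ℓ₁ ℓ₂) c′ ℓ₁′ ℓ₂′
       : Set (c ⊔ ℓ₁ ⊔ ℓ₂ ⊔ lsuc (c′ ⊔ ℓ₁′ ⊔ ℓ₂′)) where
  field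
    extension : HeytingField c′ ℓ₁′ ℓ₂′

  private
    module K = CommutativeRing (fieldRing K)
    module L = CommutativeRing (fieldRing extension)
    module KPoly = Polynomial K.rawRing
    module LPoly = Polynomial L.rawRing

  Carrier : Set c′
  Carrier = L.Carrier

  field
    ι                    : K.Carrier → L.Carrier
    ι-isRingMonomorphism : RingMorphisms.IsRingMonomorphism K.rawRing L.rawRing ι
    algebraic            : ∀ x → ∃[ n ] Σ (KPoly.Poly (suc n)) λ p →
                             KPoly.HasDegree n p × LPoly.eval (map ι p) x L.≈ L.0#
    algebraicallyClosed  : ∀ n (p : LPoly.Poly (suc (suc n))) → LPoly.HasDegree (suc n) p →
                            ∃[ x ] LPoly.eval p x L.≈ L.0#

  LiesInBase : Pred L.Carrier (c ⊔ ℓ₁′)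
  LiesInBase x = ∃[ a ] ι a L.≈ x

open RawMonoidDefs Sign.*-1-rawMonoid using () renaming (sum to ∏)

-- The parity of the number of inversions, which for a bijection π is its
-- sign.
permSign : ∀ {n} → (Fin n → Fin n) → Sign
permSign π = ∏ λ i → ∏ λ j →
  if does ((i Fin.<? j) ×-dec (π j Fin.<? π i)) then Sign.- else Sign.+

-- The ternary tree T_{3,∞}: the nodes at level n are the words
-- s₁ ∷ ⋯ ∷ sₙ ∷ [], and the parent of a word is its init.

Word : ℕ → Set
Word = Vec (Fin 3)

-- The base-3 numbering of the words; any other identification of Word m
-- with Fin (3 ^ m) conjugates permutations and so gives the same signs.
encode : ∀ {m} → Word m → Fin (3 ^ m)
encode w = funToFin (lookup w)

decode : ∀ {m} → Fin (3 ^ m) → Word m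
decode i = tabulate (finToFun i)

wordSign : ∀ {m} → (Word m → Word m) → Sign
wordSign π = permSign (encode ∘ π ∘ decode)

record TreeAut : Set where
  field
    onLevel  : ∀ n → Word n ↔ Word n
    onParent : ∀ n (w : Word (suc n)) →
               init (Inverse.to (onLevel (suc n)) w) ≡ Inverse.to (onLevel n) (init w)

  ⟦_⟧ : ∀ {n} → Word n → Word n
  ⟦_⟧ {n} = Inverse.to (onLevel n)

-- ⟦ y ++ s ⟧ has the form ⟦ y ⟧ ++ t, so dropping its first k letters
-- leaves t.
sgn : ℕ → TreeAut → ∀ {k} → Word k → Sign
sgn m σ {k} y = wordSign {m} λ s → drop k (TreeAut.⟦_⟧ σ (y ++ s))

sgnProduct : ℕ → TreeAut → ∀ {k} → Word k → Sign
sgnProduct ℓ σ y = sgn ℓ σ y Sign.* sgn (ℓ ∸ 1) σ y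

Q̃ : ℕ → Pred TreeAut 0ℓ
Q̃ ℓ σ = ∀ {k} (y : Word k) → sgnProduct ℓ σ y ≡ sgnProduct ℓ σ []

Q : ℕ → Pred TreeAut 0ℓ
Q ℓ σ = σ ∈ Q̃ ℓ × sgnProduct ℓ σ [] ≡ Sign.+

record Cubic (K : HeytingField c ℓ₁ ℓ₂) : Set (c ⊔ ℓ₁) where
  open Polynomial (fieldRawRing K)
  field
    poly    : Poly 4
    isCubic : HasDegree 3 poly

module Dynamics {K : HeytingField c ℓ₁ ℓ₂} (K̄ : AlgebraicClosure K c′ ℓ₁′ ℓ₂′)
                (f : Cubic K) where
  open AlgebraicClosure K̄
  open RingMorphisms.IsRingMonomorphism ι-isRingMonomorphism
  private
    module K = CommutativeRing (fieldRing K)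
    module L = CommutativeRing (fieldRing extension)
    module KPoly = Polynomial K.rawRing
    module LPoly = Polynomial L.rawRing
  open Cubic f

  fK : K.Carrier → K.Carrier
  fK = KPoly.eval poly

  fL : L.Carrier → L.Carrier
  fL = LPoly.eval (map ι poly)

  IsCritical : Pred L.Carrier _
  IsCritical γ = LPoly.eval (map ι (KPoly.derivative poly)) γ L.≈ L.0#

  CollideAt : ℕ → L.Carrier → L.Carrier → Set _
  CollideAt ℓ γ₁ γ₂ = iterate fL γ₁ ℓ L.≈ iterate fL γ₂ ℓ
                    × ¬ (iterate fL γ₁ (ℓ ∸ 1) L.≈ iterate fL γ₂ (ℓ ∸ 1))

  IsPeriodic : Pred K.Carrier _
  IsPeriodic x₀ = ∃[ n ] 1 ≤ n × iterate fK x₀ n K.≈ x₀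

  InPreimage : K.Carrier → ℕ → Pred L.Carrier _
  InPreimage x₀ n z = iterate fL z n L.≈ ι x₀

  InBackwardOrbit : K.Carrier → Pred L.Carrier _
  InBackwardOrbit x₀ z = ∃[ n ] InPreimage x₀ n z

  -- K(S), the smallest subfield of K̄ containing K and S
  data Adjoin {s} (S : Pred L.Carrier s) : Pred L.Carrier (c ⊔ c′ ⊔ ℓ₁′ ⊔ s) where
    base  : ∀ a → Adjoin S (ι a)
    gen   : ∀ {x} → S x → Adjoin S x
    add   : ∀ {x y} → Adjoin S x → Adjoin S y → Adjoin S (x L.+ y)
    mul   : ∀ {x y} → Adjoin S x → Adjoin S y → Adjoin S (x L.* y)
    neg   : ∀ {x} → Adjoin S x → Adjoin S (L.- x)
    recip : ∀ {x y} → Adjoin S x → x L.* y L.≈ L.1# → Adjoin S y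
    resp  : ∀ {x y} → x L.≈ y → Adjoin S x → Adjoin S y

  Adjoin-mono : ∀ {s t} {S : Pred L.Carrier s} {T : Pred L.Carrier t} →
                S ⊆ Adjoin T → Adjoin S ⊆ Adjoin T
  Adjoin-mono h (base a)    = base a
  Adjoin-mono h (gen x)     = h x
  Adjoin-mono h (add p q)   = add (Adjoin-mono h p) (Adjoin-mono h q)
  Adjoin-mono h (mul p q)   = mul (Adjoin-mono h p) (Adjoin-mono h q)
  Adjoin-mono h (neg p)     = neg (Adjoin-mono h p)
  Adjoin-mono h (recip p e) = recip (Adjoin-mono h p) e
  Adjoin-mono h (resp e p)  = resp e (Adjoin-mono h p)

  Adjoin-eval : ∀ {s} {S : Pred L.Carrier s} {n} (p : KPoly.Poly n) {x} →
                x ∈ Adjoin S → LPoly.eval (map ι p) x ∈ Adjoin S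
  Adjoin-eval []      _ = resp 0#-homo (base K.0#)
  Adjoin-eval (a ∷ p) h = add (base a) (mul h (Adjoin-eval p h))

  K[_]_ : K.Carrier → ℕ → Pred L.Carrier _
  K[ x₀ ] n = Adjoin (InPreimage x₀ n)

  InK∞ : K.Carrier → Pred L.Carrier _
  InK∞ x₀ z = ∃[ n ] z ∈ K[ x₀ ] n

  eval-congʳ : ∀ {n} (p : LPoly.Poly n) {x y} → x L.≈ y → LPoly.eval p x L.≈ LPoly.eval p y
  eval-congʳ []      e = L.refl
  eval-congʳ (a ∷ p) e = L.+-congˡ (L.*-cong e (eval-congʳ p e))

  iterate-cong : ∀ n {x y} → x L.≈ y → iterate fL x n L.≈ iterate fL y n
  iterate-cong zero    e = e
  iterate-cong (suc n) e = iterate-cong n (eval-congʳ (map ι poly) e)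

  fL-cong : ∀ {x y} → x L.≈ y → fL x L.≈ fL y
  fL-cong = eval-congʳ (map ι poly)

  fL-surjective : ∀ y → ∃[ z ] fL z L.≈ y
  fL-surjective y = go poly isCubic
    where
    go : (p : KPoly.Poly 4) → KPoly.HasDegree 3 p → ∃[ z ] LPoly.eval (map ι p) z L.≈ y
    go (a₀ ∷ a₁ ∷ a₂ ∷ a₃ ∷ []) a₃≉0 = z , (begin
      ι a₀ L.+ z L.* q                     ≈⟨ L.+-congʳ shift ⟩
      (y L.+ (ι a₀ L.+ L.- y)) L.+ z L.* q ≈⟨ L.+-assoc _ _ _ ⟩
      y L.+ ((ι a₀ L.+ L.- y) L.+ z L.* q) ≈⟨ L.+-congˡ (root .proj₂) ⟩
      y L.+ L.0#                           ≈⟨ L.+-identityʳ y ⟩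
      y                                    ∎)
      where
      open SetoidReasoning L.setoid
      p′ : LPoly.Poly 3
      p′ = ι a₁ ∷ ι a₂ ∷ ι a₃ ∷ []
      root : ∃[ x ] LPoly.eval ((ι a₀ L.+ L.- y) ∷ p′) x L.≈ L.0#
      root = algebraicallyClosed 2 ((ι a₀ L.+ L.- y) ∷ p′)
               λ e → a₃≉0 (injective (L.trans e (L.sym 0#-homo)))
      z q : L.Carrier
      z = root .proj₁
      q = LPoly.eval p′ z
      shift : ι a₀ L.≈ y L.+ (ι a₀ L.+ L.- y)
      shift = begin
        ι a₀                    ≈⟨ L.+-identityʳ _ ⟨
        ι a₀ L.+ L.0#           ≈⟨ L.+-congˡ (L.-‿inverseˡ y) ⟨
        ι a₀ L.+ (L.- y L.+ y)  ≈⟨ L.+-assoc _ _ _ ⟨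
        (ι a₀ L.+ L.- y) L.+ y  ≈⟨ L.+-comm _ _ ⟩
        y L.+ (ι a₀ L.+ L.- y)  ∎

  iterate-suc : ∀ n z → iterate fL (fL z) n ≡ fL (iterate fL z n)
  iterate-suc zero    z = ≡.refl
  iterate-suc (suc n) z = iterate-suc n (fL z)

  module Arboreal (x₀ : K.Carrier) where

    K-suc : ∀ n → K[ x₀ ] n ⊆ K[ x₀ ] (suc n)
    K-suc n = Adjoin-mono λ {y} y∈ →
      let z , fz≈y = fL-surjective y
      in resp fz≈y (Adjoin-eval poly (gen (L.trans (iterate-cong n fz≈y) y∈)))

    K-+ : ∀ m n → K[ x₀ ] n ⊆ K[ x₀ ] (m +ℕ n)
    K-+ zero    n h = h
    K-+ (suc m) n h = K-suc (m +ℕ n) (K-+ m n h)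

    InK∞-lift₂ : ∀ {x y} → InK∞ x₀ x → InK∞ x₀ y →
                 ∃[ n ] x ∈ K[ x₀ ] n × y ∈ K[ x₀ ] n
    InK∞-lift₂ {x} (m , p) (n , q) =
      m +ℕ n , ≡.subst (λ k → x ∈ K[ x₀ ] k) (ℕ.+-comm n m) (K-+ n m p) , K-+ m n q

    K∞ : Set _
    K∞ = Σ L.Carrier (InK∞ x₀)

    ι∞ : K.Carrier → K∞
    ι∞ a = ι a , 0 , base a

    K∞-rawRing : RawRing _ _
    K∞-rawRing = record
      { Carrier = K∞
      ; _≈_     = λ x y → proj₁ x L.≈ proj₁ y
      ; _+_     = λ (x , p) (y , q) → let n , p′ , q′ = InK∞-lift₂ p q in x L.+ y , n , add p′ q′
      ; _*_     = λ (x , p) (y , q) → let n , p′ , q′ = InK∞-lift₂ p q in x L.* y , n , mul p′ q′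
      ; -_      = λ (x , n , p) → L.- x , n , neg p
      ; 0#      = L.0# , 0 , resp 0#-homo (base K.0#)
      ; 1#      = L.1# , 0 , resp 1#-homo (base K.1#)
      }

    private
      module K∞ = RawRing K∞-rawRing

    -- G_{K,∞} = Gal(K_∞/K), given by its elements.
    record Gal : Set (c ⊔ c′ ⊔ ℓ₁′) where
      field
        σ                   : K∞ → K∞
        σ-isRingIsomorphism : RingMorphisms.IsRingIsomorphism K∞-rawRing K∞-rawRing σ
        σ-fixesK            : ∀ a → σ (ι∞ a) K∞.≈ ι∞ a

    Level-setoid : ℕ → Setoid _ _
    Level-setoid n = On.setoid {B = Σ L.Carrier (InPreimage x₀ n)} L.setoid proj₁

    Node : ℕ → Set _
    Node n = Setoid.Carrier (Level-setoid n)

    parent : ∀ {n} → Node (suc n) → Node n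
    parent (z , z∈) = fL z , z∈

    record Labelling : Set (c′ ⊔ ℓ₁′) where
      field
        label       : ∀ n → Inverse (Level-setoid n) (≡.setoid (Word n))
        labelParent : ∀ n (y : Node (suc n)) →
                      init (Inverse.to (label (suc n)) y) ≡ Inverse.to (label n) (parent {n} y)

    nodeInK∞ : ∀ {n} → Node n → K∞
    nodeInK∞ {n} (z , z∈) = z , n , gen z∈

    module _ (g : Gal) where
      open Gal g
      open RingMorphisms.IsRingIsomorphism σ-isRingIsomorphism using ()
        renaming ( ⟦⟧-cong to σ-cong; +-homo to σ-+; *-homo to σ-*; 0#-homo to σ-0
                 ; injective to σ-injective; surjective to σ-surjective)

      eval∞ : ∀ {n} → KPoly.Poly n → K∞ → K∞
      eval∞ p x = LPoly.eval (map ι p) (x .proj₁) , x .proj₂ .proj₁ , Adjoin-eval p (x .proj₂ .proj₂)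

      σ-eval : ∀ {n} (p : KPoly.Poly n) x → σ (eval∞ p x) K∞.≈ eval∞ p (σ x)
      σ-eval []      x = L.trans (σ-cong L.refl) σ-0
      σ-eval (a ∷ p) x = begin
        proj₁ (σ (eval∞ (a ∷ p) x))                         ≈⟨ σ-cong L.refl ⟩
        proj₁ (σ (ι∞ a K∞.+ x K∞.* eval∞ p x))              ≈⟨ σ-+ _ _ ⟩
        proj₁ (σ (ι∞ a)) L.+ proj₁ (σ (x K∞.* eval∞ p x))   ≈⟨ L.+-cong (σ-fixesK a) (σ-* _ _) ⟩
        ι a L.+ proj₁ (σ x) L.* proj₁ (σ (eval∞ p x))       ≈⟨ L.+-congˡ (L.*-congˡ (σ-eval p x)) ⟩
        ι a L.+ proj₁ (σ x) L.* proj₁ (eval∞ p (σ x))       ∎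
        where open SetoidReasoning L.setoid

      σ-iterate : ∀ n x → proj₁ (σ (iterate (eval∞ poly) x n)) L.≈ iterate fL (proj₁ (σ x)) n
      σ-iterate zero    x = L.refl
      σ-iterate (suc n) x = L.trans (σ-iterate n (eval∞ poly x)) (iterate-cong n (σ-eval poly x))

      proj₁-iterate : ∀ n x → proj₁ (iterate (eval∞ poly) x n) ≡ iterate fL (proj₁ x) n
      proj₁-iterate zero    x = ≡.refl
      proj₁-iterate (suc n) x = proj₁-iterate n (eval∞ poly x)

      σ-preserves : ∀ n x → InPreimage x₀ n (proj₁ x) → InPreimage x₀ n (proj₁ (σ x))
      σ-preserves n x x∈ = begin
        iterate fL (proj₁ (σ x)) n              ≈⟨ σ-iterate n x ⟨
        proj₁ (σ (iterate (eval∞ poly) x n))    ≈⟨ σ-cong (L.trans (L.reflexive (proj₁-iterate n x)) x∈) ⟩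
        proj₁ (σ (ι∞ x₀))                       ≈⟨ σ-fixesK x₀ ⟩
        ι x₀                                    ∎
        where open SetoidReasoning L.setoid

      σ-reflects : ∀ n x → InPreimage x₀ n (proj₁ (σ x)) → InPreimage x₀ n (proj₁ x)
      σ-reflects n x σx∈ = begin
        iterate fL (proj₁ x) n              ≡⟨ proj₁-iterate n x ⟨
        proj₁ (iterate (eval∞ poly) x n)    ≈⟨ σ-injective (begin
          proj₁ (σ (iterate (eval∞ poly) x n))  ≈⟨ σ-iterate n x ⟩
          iterate fL (proj₁ (σ x)) n            ≈⟨ σx∈ ⟩
          ι x₀                                  ≈⟨ σ-fixesK x₀ ⟨
          proj₁ (σ (ι∞ x₀))                     ∎) ⟩
        ι x₀                                ∎
        where open SetoidReasoning L.setoid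

      private
        σ⁻¹ : K∞ → K∞
        σ⁻¹ y = σ-surjective y .proj₁

        σ-σ⁻¹ : ∀ y → σ (σ⁻¹ y) K∞.≈ y
        σ-σ⁻¹ y = σ-surjective y .proj₂ L.refl

      actOnLevel : ∀ n → Inverse (Level-setoid n) (Level-setoid n)
      actOnLevel n = record
        { to        = λ y → proj₁ (σ (nodeInK∞ {n} y)) , σ-preserves n (nodeInK∞ {n} y) (proj₂ y)
        ; from      = λ y → proj₁ (σ⁻¹ (nodeInK∞ {n} y)) ,
                        σ-reflects n (σ⁻¹ (nodeInK∞ {n} y))
                          (L.trans (iterate-cong n (σ-σ⁻¹ (nodeInK∞ {n} y))) (proj₂ y))
        ; to-cong   = σ-cong
        ; from-cong = λ {x} {y} e → σ-injective
                        (L.trans (σ-σ⁻¹ (nodeInK∞ {n} x)) (L.trans e (L.sym (σ-σ⁻¹ (nodeInK∞ {n} y)))))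
        ; inverse   = (λ {y} e → L.trans (σ-cong e) (σ-σ⁻¹ (nodeInK∞ {n} y)))
                    , (λ {y} e → σ-injective (L.trans (σ-σ⁻¹ _) e))
        }

      actOnLevel-parent : ∀ n y → Setoid._≈_ (Level-setoid n)
                            (parent {n} (Inverse.to (actOnLevel (suc n)) y))
                            (Inverse.to (actOnLevel n) (parent {n} y))
      actOnLevel-parent n y =
        L.trans (L.sym (σ-eval poly (nodeInK∞ {suc n} y)))
                (σ-cong {eval∞ poly (nodeInK∞ {suc n} y)} {nodeInK∞ {n} (parent {n} y)} L.refl)

    action : Labelling → Gal → TreeAut
    action lab g = record
      { onLevel  = λ n → Composition.inverse
                     (Composition.inverse (Symmetry.inverse (label n)) (actOnLevel g n)) (label n)
      ; onParent = λ n w → let y = Inverse.from (label (suc n)) w in begin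
          init (Inverse.to (label (suc n)) (Inverse.to (actOnLevel g (suc n)) y))
            ≡⟨ labelParent n (Inverse.to (actOnLevel g (suc n)) y) ⟩
          Inverse.to (label n) (parent {n} (Inverse.to (actOnLevel g (suc n)) y))
            ≡⟨ Inverse.to-cong (label n) {_} {_} (actOnLevel-parent g n y) ⟩
          Inverse.to (label n) (Inverse.to (actOnLevel g n) (parent {n} y))
            ≡⟨ Inverse.to-cong (label n) {_} {_} (Inverse.to-cong (actOnLevel g n) {_} {_} (parent-from n w)) ⟩
          Inverse.to (label n) (Inverse.to (actOnLevel g n) (Inverse.from (label n) (init w))) ∎
      }
      where
      open Labelling lab
      open ≡.≡-Reasoning
      parent-from : ∀ n w → Setoid._≈_ (Level-setoid n)
                      (parent {n} (Inverse.from (label (suc n)) w)) (Inverse.from (label n) (init w))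
      parent-from n w = L.sym (Inverse.inverseʳ (label n) (≡.trans
        (≡.cong init (≡.sym (Inverse.strictlyInverseˡ (label (suc n)) w)))
        (labelParent n (Inverse.from (label (suc n)) w))))

    -- Isomorphism here is equivariant for the action on the tree: for some
    -- labelling, every Galois element acts through H.
    GalIsomorphicToSubgroupOf : Pred TreeAut 0ℓ → Set _
    GalIsomorphicToSubgroupOf H = ∃[ lab ] ∀ (g : Gal) → action lab g ∈ H

open Dynamics public
  using (fL; IsCritical; CollideAt; IsPeriodic; InBackwardOrbit)
open Dynamics.Arboreal public
  using (GalIsomorphicToSubgroupOf)

{-# OPTIONS --safe #-}

-- Write ℓ = m + 1, V = f^ℓ(γ₁) = f^ℓ(γ₂) and let a be the leading coefficient
-- of f. Every polynomial over K is affine modulo the quadratic f′, so its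
-- values at γ₁ and γ₂ can only agree if they lie in K; hence V ∈ K.
--
-- For a tree automorphism σ, sgn_ℓ(σ,y) sgn_m(σ,y) is the product, over the
-- nodes w lying m levels above y, of the sign with which σ permutes the three
-- children of w. Let δ(w) be the product of the differences of the children
-- of w, and E(y) the product of the δ(w); then σ E(y) = ± E(σ y) with that
-- very sign. Since a² δ(w)² = - 27 (f γ₁ - w) (f γ₂ - w), and the product of
-- all x - w is f^m(x) - y up to a constant, the collision makes E(y)² the
-- square of √-3 (V - y) times a constant of K. Exchanging two children of a
-- single w changes the sign of E(y), so for some labelling E(y) is
-- √-3 (V - y) times one constant of K for every y, and then the product of
-- signs is the action of σ on √-3.
--
-- Conversely √-3 ∈ K(E(x₀)) for any labelling, so if all of the Galois group
-- acts through Q_ℓ then it fixes √-3. Were √-3 not in K, the conjugation of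
-- K(√-3) would extend to K_∞, one node of the tree at a time, by sending each
-- node to a root of the conjugate of its minimal polynomial. Excluded middle
-- for arbitrary types supplies the choices.

module Submission where

open import Defs
open import Level using (Level; _⊔_)
import Algebra.Properties.CommutativeMonoid.Sum as MonoidSum
import Algebra.Properties.Ring as RingProperties
import Algebra.Properties.Semiring.Exp as SemiringExp
import Algebra.Properties.Semiring.Mult as SemiringMult
import Algebra.Solver.CommutativeMonoid as CommutativeMonoidSolver
import Algebra.Solver.Ring as RingSolver
open import Algebra.Apartness.Bundles using (HeytingField)
open import Algebra.Bundles using (CommutativeMonoid; CommutativeRing)
open import Algebra.Bundles.Raw using (RawRing)
open import Algebra.Morphism.Structures using (module RingMorphisms)
open import Algebra.Solver.Ring.AlmostCommutativeRing using (fromCommutativeRing; _-Raw-AlmostCommutative⟶_)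
open import Axiom.ExcludedMiddle using (ExcludedMiddle)
open import Data.Bool.Base using (if_then_else_)
open import Data.Empty using (⊥-elim)
open import Data.Fin.Base as Fin using (Fin; zero; suc; toℕ; _↑ˡ_; _↑ʳ_; combine)
open import Data.Fin.Patterns using (0F; 1F; 2F)
import Data.Fin.Properties as Fin
open import Data.Integer.Base as ℤ using (ℤ; +_; -[1+_])
import Data.Integer.Properties as ℤ
open import Data.Maybe.Base using (Maybe; just; nothing)
open import Data.Nat.Base as ℕ using (ℕ; zero; suc; _≤_; _<_; s≤s) renaming (_+_ to _+ℕ_; _*_ to _*ℕ_; _^_ to _^ℕ_)
open import Data.Nat.Divisibility using (_∣_; divides; m%n≡0⇒n∣m)
open import Data.Nat.DivMod using (_%_; _/_; m≡m%n+[m/n]*n; m%n<n)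
open import Data.Nat.GeneralisedArithmetic using (iterate)
open import Data.Nat.Induction using (<-rec)
import Data.Nat.Properties as ℕ
open import Data.Product.Base using (Σ; ∃-syntax; _×_; _,_; proj₁; proj₂)
open import Data.Sign.Base as Sign using (Sign)
import Data.Sign.Properties as Sign
open import Data.Sum.Base using (_⊎_; inj₁; inj₂; [_,_]′)
open import Data.Vec.Base
  using (Vec; []; _∷_; _++_; _∷ʳ_; init; last; head; tail; map; zipWith; replicate; initLast; take; drop)
import Data.Vec.Properties as Vec
open import Data.Vec.Relation.Binary.Pointwise.Inductive using (Pointwise; []; _∷_)
open import Function.Base using (_∘_; case_of_)
open import Function.Bundles using (Inverse; Equivalence; _⇔_; mk⇔)
open import Function.Definitions using (Injective)
open import Relation.Binary.Definitions using (tri<; tri≈; tri>)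
open import Relation.Binary.PropositionalEquality as ≡ using (_≡_; _≢_; _≗_)
import Relation.Binary.Reasoning.Setoid as SetoidReasoning
open import Relation.Nullary.Decidable using (Dec; yes; no; does; _×-dec_; does-⇔; decidable-stable)
open import Relation.Nullary.Negation using (¬_; contradiction)

-- Signs of permutations of words

-- Automorphisms are handled through their graphs. A relation closed under the ring operations
-- covers an element of the Galois group, the conjugation of K(√-3) and every partial extension of
-- it alike. Its domain needs no description of its own, and reversing it gives the inverse.
--
-- The correcting labelling exists because a node w of level at least m lies m levels above exactly
-- one y: the sign of E(y) can be repaired at the moment when the children of level |y| + m are
-- labelled, without disturbing any other E. The signs are well determined because V is never a
-- node: V = y would put γ₁ into the backward orbit of x₀. That √-3 itself survives, and not only an
-- element of K, is a matter of parity: the square root of the product of the constants -27 over 3^m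
-- nodes is an odd power of √-3.

data Arrangement : Fin 3 → Fin 3 → Fin 3 → Set where
  012F : Arrangement 0F 1F 2F
  021F : Arrangement 0F 2F 1F
  102F : Arrangement 1F 0F 2F
  120F : Arrangement 1F 2F 0F
  201F : Arrangement 2F 0F 1F
  210F : Arrangement 2F 1F 0F

distinct⇒arrangement : ∀ {a b c} → a ≢ b → a ≢ c → b ≢ c → Arrangement a b c
distinct⇒arrangement {0F} {0F} {c}  a≢b a≢c b≢c = ⊥-elim (a≢b ≡.refl)
distinct⇒arrangement {0F} {1F} {0F} a≢b a≢c b≢c = ⊥-elim (a≢c ≡.refl)
distinct⇒arrangement {0F} {1F} {1F} a≢b a≢c b≢c = ⊥-elim (b≢c ≡.refl)
distinct⇒arrangement {0F} {1F} {2F} a≢b a≢c b≢c = 012F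
distinct⇒arrangement {0F} {2F} {0F} a≢b a≢c b≢c = ⊥-elim (a≢c ≡.refl)
distinct⇒arrangement {0F} {2F} {1F} a≢b a≢c b≢c = 021F
distinct⇒arrangement {0F} {2F} {2F} a≢b a≢c b≢c = ⊥-elim (b≢c ≡.refl)
distinct⇒arrangement {1F} {0F} {0F} a≢b a≢c b≢c = ⊥-elim (b≢c ≡.refl)
distinct⇒arrangement {1F} {0F} {1F} a≢b a≢c b≢c = ⊥-elim (a≢c ≡.refl)
distinct⇒arrangement {1F} {0F} {2F} a≢b a≢c b≢c = 102F
distinct⇒arrangement {1F} {1F} {c}  a≢b a≢c b≢c = ⊥-elim (a≢b ≡.refl)
distinct⇒arrangement {1F} {2F} {0F} a≢b a≢c b≢c = 120F
distinct⇒arrangement {1F} {2F} {1F} a≢b a≢c b≢c = ⊥-elim (a≢c ≡.refl)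
distinct⇒arrangement {1F} {2F} {2F} a≢b a≢c b≢c = ⊥-elim (b≢c ≡.refl)
distinct⇒arrangement {2F} {0F} {0F} a≢b a≢c b≢c = ⊥-elim (b≢c ≡.refl)
distinct⇒arrangement {2F} {0F} {1F} a≢b a≢c b≢c = 201F
distinct⇒arrangement {2F} {0F} {2F} a≢b a≢c b≢c = ⊥-elim (a≢c ≡.refl)
distinct⇒arrangement {2F} {1F} {0F} a≢b a≢c b≢c = 210F
distinct⇒arrangement {2F} {1F} {1F} a≢b a≢c b≢c = ⊥-elim (b≢c ≡.refl)
distinct⇒arrangement {2F} {1F} {2F} a≢b a≢c b≢c = ⊥-elim (a≢c ≡.refl)
distinct⇒arrangement {2F} {2F} {c}  a≢b a≢c b≢c = ⊥-elim (a≢b ≡.refl)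

injective⇒arrangement : ∀ {p : Fin 3 → Fin 3} → Injective _≡_ _≡_ p →
                        Arrangement (p 0F) (p 1F) (p 2F)
injective⇒arrangement p-inj = distinct⇒arrangement
  (λ e → case p-inj e of λ ()) (λ e → case p-inj e of λ ()) (λ e → case p-inj e of λ ())

module WordProduct {c ℓ} (M : CommutativeMonoid c ℓ) where
  open CommutativeMonoid M
  open MonoidSum M using (sum; sum-cong-≋; ∑-distrib-+)
  open CommutativeMonoidSolver M using (solve; _⊕_; _⊜_; id)

  wordProduct : ∀ m → (Word m → Carrier) → Carrier
  wordProduct zero    h = h []
  wordProduct (suc m) h = sum λ s → wordProduct m λ w → h (s ∷ w)

  wordProduct-cong : ∀ m {g h : Word m → Carrier} → (∀ w → g w ≈ h w) →
                     wordProduct m g ≈ wordProduct m h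
  wordProduct-cong zero    g≈h = g≈h []
  wordProduct-cong (suc m) g≈h = sum-cong-≋ λ s → wordProduct-cong m λ w → g≈h (s ∷ w)

  wordProduct-∙ : ∀ m (g h : Word m → Carrier) →
                  wordProduct m (λ w → g w ∙ h w) ≈ wordProduct m g ∙ wordProduct m h
  wordProduct-∙ zero    g h = refl
  wordProduct-∙ (suc m) g h = trans
    (sum-cong-≋ λ s → wordProduct-∙ m (λ w → g (s ∷ w)) (λ w → h (s ∷ w)))
    (∑-distrib-+ (λ s → wordProduct m λ w → g (s ∷ w)) (λ s → wordProduct m λ w → h (s ∷ w)))

  sum-rearrange : ∀ {p : Fin 3 → Fin 3} → Injective _≡_ _≡_ p → (h : Fin 3 → Carrier) →
                  sum (h ∘ p) ≈ sum h
  sum-rearrange {p} p-inj h with p 0F | p 1F | p 2F | injective⇒arrangement p-inj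
  ... | _ | _ | _ | 012F = refl
  ... | _ | _ | _ | 021F = solve 3 (λ x y z → x ⊕ (z ⊕ (y ⊕ id)) ⊜ x ⊕ (y ⊕ (z ⊕ id))) refl _ _ _
  ... | _ | _ | _ | 102F = solve 3 (λ x y z → y ⊕ (x ⊕ (z ⊕ id)) ⊜ x ⊕ (y ⊕ (z ⊕ id))) refl _ _ _
  ... | _ | _ | _ | 120F = solve 3 (λ x y z → y ⊕ (z ⊕ (x ⊕ id)) ⊜ x ⊕ (y ⊕ (z ⊕ id))) refl _ _ _
  ... | _ | _ | _ | 201F = solve 3 (λ x y z → z ⊕ (x ⊕ (y ⊕ id)) ⊜ x ⊕ (y ⊕ (z ⊕ id))) refl _ _ _
  ... | _ | _ | _ | 210F = solve 3 (λ x y z → z ⊕ (y ⊕ (x ⊕ id)) ⊜ x ⊕ (y ⊕ (z ⊕ id))) refl _ _ _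

open MonoidSum Sign.*-commutativeMonoid using () renaming
  (sum to ∏ˢ; sum-cong-≗ to ∏ˢ-cong; ∑-comm to ∏ˢ-comm; ∑-distrib-+ to ∏ˢ-distrib-*)
open WordProduct Sign.*-commutativeMonoid using () renaming
  (wordProduct to ∏ʷ; wordProduct-cong to ∏ʷ-cong; wordProduct-∙ to ∏ʷ-*)

inversion : ∀ {n} → (Fin n → Fin n) → Fin n → Fin n → Sign
inversion π i j = if does ((i Fin.<? j) ×-dec (π j Fin.<? π i)) then Sign.- else Sign.+

sign-if-cong : ∀ {p q} {P : Set p} {Q : Set q} (P? : Dec P) (Q? : Dec Q) → P ⇔ Q →
               (if does P? then Sign.- else Sign.+) ≡ (if does Q? then Sign.- else Sign.+)
sign-if-cong P? Q? P⇔Q = ≡.cong (if_then Sign.- else Sign.+) (does-⇔ P⇔Q P? Q?)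

permSign-cong : ∀ {n} {π ρ : Fin n → Fin n} → π ≗ ρ → permSign π ≡ permSign ρ
permSign-cong {n} {π} {ρ} π≗ρ = ∏ˢ-cong λ i → ∏ˢ-cong λ j →
  ≡.cong₂ (λ a b → if does ((i Fin.<? j) ×-dec (a Fin.<? b)) then Sign.- else Sign.+) (π≗ρ j) (π≗ρ i)

∏ˢ-↑ : ∀ m {n} (h : Fin (m +ℕ n) → Sign) →
      ∏ˢ h ≡ ∏ˢ (λ i → h (i ↑ˡ n)) Sign.* ∏ˢ (λ j → h (m ↑ʳ j))
∏ˢ-↑ zero    h = ≡.refl
∏ˢ-↑ (suc m) h = ≡.trans (≡.cong (h zero Sign.*_) (∏ˢ-↑ m (h ∘ suc))) (≡.sym (Sign.*-assoc (h zero) _ _))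

∏ˢ-combine : ∀ m {n} (h : Fin (m *ℕ n) → Sign) →
            ∏ˢ h ≡ ∏ˢ λ (i : Fin m) → ∏ˢ λ (j : Fin n) → h (combine i j)
∏ˢ-combine zero        h = ≡.refl
∏ˢ-combine (suc m) {n} h = ≡.trans (∏ˢ-↑ n h)
  (≡.cong (∏ˢ (λ i → h (i ↑ˡ (m *ℕ n))) Sign.*_) (∏ˢ-combine m {n} (λ j → h (n ↑ʳ j))))

-- The number of factors, `3 ^ℕ m`, is odd. This is the oddness that `permSign-combine` asks of its
-- blocks.
∏ˢ-const : ∀ m s → ∏ˢ {3 ^ℕ m} (λ _ → s) ≡ s
∏ˢ-const zero    s = Sign.*-identityʳ s
∏ˢ-const (suc m) s = begin
  ∏ˢ {3 ^ℕ suc m} (λ _ → s)               ≡⟨ ∏ˢ-combine 3 {3 ^ℕ m} (λ _ → s) ⟩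
  ∏ˢ {3} (λ _ → ∏ˢ {3 ^ℕ m} (λ _ → s))     ≡⟨ ∏ˢ-cong {3} (λ _ → ∏ˢ-const m s) ⟩
  ∏ˢ {3} (λ _ → s)                       ≡⟨ cube s ⟩
  s                                     ∎
  where
  open ≡.≡-Reasoning
  cube : ∀ s → ∏ˢ {3} (λ _ → s) ≡ s
  cube Sign.- = ≡.refl
  cube Sign.+ = ≡.refl

-- `combine s i` has value `3 ^ℕ m * s + i`, so the first letter of a word is its leading ternary
-- digit and the numbering is lexicographic.
decode-combine : ∀ m s (i : Fin (3 ^ℕ m)) → decode {suc m} (combine s i) ≡ s ∷ decode {m} i
decode-combine m s i = ≡.cong₂ (λ t j → t ∷ decode {m} j)
  (≡.cong proj₁ (Fin.remQuot-combine {3} {3 ^ℕ m} s i)) (≡.cong proj₂ (Fin.remQuot-combine {3} {3 ^ℕ m} s i))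

wordSign-cong : ∀ {m} {π ρ : Word m → Word m} → π ≗ ρ → wordSign π ≡ wordSign ρ
wordSign-cong {m} π≗ρ = permSign-cong λ i → ≡.cong encode (π≗ρ (decode {m} i))

combine-<-cancel : ∀ {m n} (s : Fin m) {i j : Fin n} →
                   (combine s i Fin.< combine s j) ⇔ (i Fin.< j)
combine-<-cancel {m} {n} s {i} {j} = mk⇔
  (λ lt → ℕ.+-cancelˡ-< (n *ℕ toℕ s) (toℕ i) (toℕ j)
            (≡.subst₂ ℕ._<_ (Fin.toℕ-combine s i) (Fin.toℕ-combine s j) lt))
  (λ lt → ≡.subst₂ ℕ._<_ (≡.sym (Fin.toℕ-combine s i)) (≡.sym (Fin.toℕ-combine s j))
            (ℕ.+-monoʳ-< (n *ℕ toℕ s) lt))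

combine-<-≢ : ∀ {m n} {s t : Fin m} (i j : Fin n) → s ≢ t →
              (combine s i Fin.< combine t j) ⇔ (s Fin.< t)
combine-<-≢ {s = s} {t} i j s≢t = mk⇔ to (Fin.combine-monoˡ-< i j)
  where
  to : combine s i Fin.< combine t j → s Fin.< t
  to lt with Fin.<-cmp s t
  ... | tri< s<t _ _ = s<t
  ... | tri≈ _ s≡t _ = contradiction s≡t s≢t
  ... | tri> _ _ t<s = contradiction lt (Fin.<-asym (Fin.combine-monoˡ-< j i t<s))

_×-⇔_ : ∀ {a b c d} {A : Set a} {B : Set b} {C : Set c} {D : Set d} →
      A ⇔ B → C ⇔ D → (A × C) ⇔ (B × D)
e ×-⇔ f = mk⇔ (λ (a , c) → Equivalence.to e a , Equivalence.to f c)
              (λ (b , d) → Equivalence.from e b , Equivalence.from f d)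

-- The numbering by combine is lexicographic, so pairs with distinct first
-- entries s and t are inverted according to s and t alone; there are n * n
-- such pairs for each (s , t), an odd number.
permSign-combine : ∀ {n} → (∀ s → ∏ˢ {n} (λ _ → s) ≡ s) →
  {π : Fin (3 *ℕ n) → Fin (3 *ℕ n)} {p : Fin 3 → Fin 3} {ρ : Fin 3 → Fin n → Fin n} →
  Injective _≡_ _≡_ p → (∀ s i → π (combine s i) ≡ combine (p s) (ρ s i)) →
  permSign π ≡ permSign p Sign.* ∏ˢ (λ s → permSign (ρ s))
permSign-combine {n} ∏ˢ-odd {π} {p} {ρ} p-inj π-combine = begin
  permSign π
    ≡⟨ ∏ˢ-combine 3 {n} (λ i → ∏ˢ λ j → inversion π i j) ⟩
  ∏ˢ (λ s → ∏ˢ λ a → ∏ˢ λ j → inversion π (⟨ s , a ⟩) j)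
    ≡⟨ ∏ˢ-cong {3} (λ s → ∏ˢ-cong {n} λ a → ∏ˢ-combine 3 {n} (λ j → inversion π ⟨ s , a ⟩ j)) ⟩
  ∏ˢ (λ s → ∏ˢ λ a → ∏ˢ λ t → ∏ˢ λ b → inversion π ⟨ s , a ⟩ ⟨ t , b ⟩)
    ≡⟨ ∏ˢ-cong {3} (λ s → ∏ˢ-comm {n} {3} (λ a t → ∏ˢ λ b → inversion π ⟨ s , a ⟩ ⟨ t , b ⟩)) ⟩
  ∏ˢ (λ s → ∏ˢ λ t → ∏ˢ λ a → ∏ˢ λ b → inversion π ⟨ s , a ⟩ ⟨ t , b ⟩)
    ≡⟨ ∏ˢ-cong {3} (λ s → ∏ˢ-cong {3} λ t → block s t) ⟩
  ∏ˢ (λ s → ∏ˢ λ t → inversion p s t Sign.* diagonal s t)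
    ≡⟨ ∏ˢ-cong {3} (λ s → ∏ˢ-distrib-* (inversion p s) (diagonal s)) ⟩
  ∏ˢ (λ s → ∏ˢ (inversion p s) Sign.* ∏ˢ (diagonal s))
    ≡⟨ ∏ˢ-distrib-* (λ s → ∏ˢ (inversion p s)) (λ s → ∏ˢ (diagonal s)) ⟩
  permSign p Sign.* ∏ˢ (λ s → ∏ˢ (diagonal s))
    ≡⟨ ≡.cong (permSign p Sign.*_) (∏ˢ-cong {3} ∏ˢ-diagonal) ⟩
  permSign p Sign.* ∏ˢ (λ s → permSign (ρ s)) ∎
  where
  open ≡.≡-Reasoning
  ⟨_,_⟩ : Fin 3 → Fin n → Fin (3 *ℕ n)
  ⟨_,_⟩ = combine
  diagonal : Fin 3 → Fin 3 → Sign
  diagonal s t = if does (s Fin.≟ t) then permSign (ρ s) else Sign.+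
  ∏ˢ-diagonal : ∀ s → ∏ˢ (diagonal s) ≡ permSign (ρ s)
  ∏ˢ-diagonal 0F = Sign.*-identityʳ _
  ∏ˢ-diagonal 1F = Sign.*-identityʳ _
  ∏ˢ-diagonal 2F = Sign.*-identityʳ _
  inversion-refl : ∀ s → inversion p s s ≡ Sign.+
  inversion-refl 0F = ≡.refl
  inversion-refl 1F = ≡.refl
  inversion-refl 2F = ≡.refl
  inversion-combine : ∀ s t a b {q} {Q : Set q} (Q? : Dec Q) →
    ((⟨ s , a ⟩ Fin.< ⟨ t , b ⟩) × (⟨ p t , ρ t b ⟩ Fin.< ⟨ p s , ρ s a ⟩)) ⇔ Q →
    inversion π ⟨ s , a ⟩ ⟨ t , b ⟩ ≡ (if does Q? then Sign.- else Sign.+)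
  inversion-combine s t a b Q? e = ≡.trans
    (≡.cong₂ (λ i j → if does ((⟨ s , a ⟩ Fin.<? ⟨ t , b ⟩) ×-dec (i Fin.<? j)) then Sign.- else Sign.+)
      (π-combine t b) (π-combine s a))
    (sign-if-cong ((⟨ s , a ⟩ Fin.<? ⟨ t , b ⟩) ×-dec (⟨ p t , ρ t b ⟩ Fin.<? ⟨ p s , ρ s a ⟩)) Q? e)
  block : ∀ s t → ∏ˢ (λ a → ∏ˢ λ b → inversion π ⟨ s , a ⟩ ⟨ t , b ⟩) ≡ inversion p s t Sign.* diagonal s t
  block s t with s Fin.≟ t
  ... | yes ≡.refl = ≡.trans
    (∏ˢ-cong {n} λ a → ∏ˢ-cong {n} λ b →
      inversion-combine s s a b ((a Fin.<? b) ×-dec (ρ s b Fin.<? ρ s a))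
        (combine-<-cancel s ×-⇔ combine-<-cancel (p s)))
    (≡.cong (Sign._* permSign (ρ s)) (≡.sym (inversion-refl s)))
  ... | no s≢t = begin
    ∏ˢ (λ a → ∏ˢ λ b → inversion π ⟨ s , a ⟩ ⟨ t , b ⟩)
      ≡⟨ ∏ˢ-cong {n} (λ a → ∏ˢ-cong {n} λ b →
           inversion-combine s t a b ((s Fin.<? t) ×-dec (p t Fin.<? p s))
             (combine-<-≢ a b s≢t ×-⇔ combine-<-≢ (ρ t b) (ρ s a) λ e → s≢t (≡.sym (p-inj e)))) ⟩
    ∏ˢ {n} (λ a → ∏ˢ {n} λ b → inversion p s t)
      ≡⟨ ∏ˢ-cong {n} (λ a → ∏ˢ-odd (inversion p s t)) ⟩
    ∏ˢ {n} (λ a → inversion p s t)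
      ≡⟨ ∏ˢ-odd (inversion p s t) ⟩
    inversion p s t
      ≡⟨ Sign.*-identityʳ _ ⟨
    inversion p s t Sign.* Sign.+ ∎

wordSign-∷ : ∀ {m} {π : Word (suc m) → Word (suc m)} {p : Fin 3 → Fin 3} {ρ : Fin 3 → Word m → Word m} →
             Injective _≡_ _≡_ p → (∀ s w → π (s ∷ w) ≡ p s ∷ ρ s w) →
             wordSign π ≡ permSign p Sign.* ∏ˢ (λ s → wordSign (ρ s))
wordSign-∷ {m} {π} {p} {ρ} p-inj π-∷ = permSign-combine (∏ˢ-const m)
  {π = λ i → encode (π (decode {suc m} i))} {p = p} {ρ = λ s i → encode (ρ s (decode {m} i))} p-inj λ s i →
  ≡.cong (encode {suc m}) (≡.trans (≡.cong π (decode-combine m s i)) (π-∷ s (decode {m} i)))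

-- Tree automorphisms and their sections at nodes

take-++ : ∀ {a} {A : Set a} {k m} (u : Vec A k) {v : Vec A m} → take k (u ++ v) ≡ u
take-++ []      = ≡.refl
take-++ (x ∷ u) = ≡.cong (x ∷_) (take-++ u)

drop-++ : ∀ {a} {A : Set a} {k m} (u : Vec A k) {v : Vec A m} → drop k (u ++ v) ≡ v
drop-++ []      = ≡.refl
drop-++ (x ∷ u) = drop-++ u

[]-unique : (u v : Word 0) → u ≡ v
[]-unique [] [] = ≡.refl

-- Weaker than `TreeAut`: injectivity on each level takes the place of an inverse, since it passes
-- directly to the sections `below τ y`.
record TreeMap : Set where
  field
    on           : ∀ {n} → Word n → Word n
    on-init      : ∀ {n} (w : Word (suc n)) → init (on w) ≡ on (init w)
    on-injective : ∀ {n} → Injective _≡_ _≡_ (on {n})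

  onLetter : Fin 3 → Fin 3
  onLetter s = head (on (s ∷ []))

  head-on : ∀ {n} s (w : Word n) → head (on (s ∷ w)) ≡ onLetter s
  head-on s []      = ≡.refl
  head-on s (t ∷ w) = begin
    head (on (s ∷ t ∷ w))         ≡⟨ head-init (on (s ∷ t ∷ w)) ⟨
    head (init (on (s ∷ t ∷ w)))  ≡⟨ ≡.cong head (on-init (s ∷ t ∷ w)) ⟩
    head (on (s ∷ init (t ∷ w)))  ≡⟨ head-on s (init (t ∷ w)) ⟩
    onLetter s                    ∎
    where
    open ≡.≡-Reasoning
    head-init : ∀ {n} (v : Word (suc (suc n))) → head (init v) ≡ head v
    head-init (x ∷ y ∷ v) = ≡.refl

  on-∷ : ∀ {n} s (w : Word n) → on (s ∷ w) ≡ onLetter s ∷ tail (on (s ∷ w))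
  on-∷ s w with on (s ∷ w) | head-on s w
  ... | _ ∷ _ | ≡.refl = ≡.refl

  onLetter-injective : Injective _≡_ _≡_ onLetter
  onLetter-injective {s} {t} e = Vec.∷-injectiveˡ (on-injective (begin
    on (s ∷ [])                         ≡⟨ on-∷ s [] ⟩
    onLetter s ∷ tail (on (s ∷ []))     ≡⟨ ≡.cong₂ _∷_ e ([]-unique _ _) ⟩
    onLetter t ∷ tail (on (t ∷ []))     ≡⟨ on-∷ t [] ⟨
    on (t ∷ [])                         ∎))
    where open ≡.≡-Reasoning

open TreeMap

-- The section of `τ` at the node `s`: the subtree above `s` is carried to the subtree above its
-- image, and both are identified with the whole tree.
belowLetter : TreeMap → Fin 3 → TreeMap
belowLetter τ s = record
  { on           = λ w → tail (on τ (s ∷ w))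
  ; on-init      = λ w → ≡.trans (init-tail (on τ (s ∷ w))) (≡.cong tail (on-init τ (s ∷ w)))
  ; on-injective = λ {_} {u} {v} e → Vec.∷-injectiveʳ (on-injective τ
      (≡.trans (on-∷ τ s u) (≡.trans (≡.cong (onLetter τ s ∷_) e) (≡.sym (on-∷ τ s v)))))
  }
  where
  init-tail : ∀ {n} (v : Word (suc (suc n))) → init (tail v) ≡ tail (init v)
  init-tail (x ∷ y ∷ v) = ≡.refl

below : ∀ {k} → TreeMap → Word k → TreeMap
below τ []      = τ
below τ (s ∷ y) = below (belowLetter τ s) y

on-++ : ∀ {k m} τ (y : Word k) (w : Word m) → on τ (y ++ w) ≡ on τ y ++ on (below τ y) w
on-++ τ []      w = ≡.cong (_++ on τ w) ([]-unique [] (on τ []))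
on-++ τ (s ∷ y) w = begin
  on τ (s ∷ y ++ w)
    ≡⟨ on-∷ τ s (y ++ w) ⟩
  onLetter τ s ∷ on (belowLetter τ s) (y ++ w)
    ≡⟨ ≡.cong (onLetter τ s ∷_) (on-++ (belowLetter τ s) y w) ⟩
  (onLetter τ s ∷ on (belowLetter τ s) y) ++ on (below τ (s ∷ y)) w
    ≡⟨ ≡.cong (_++ on (below τ (s ∷ y)) w) (on-∷ τ s y) ⟨
  on τ (s ∷ y) ++ on (below τ (s ∷ y)) w ∎
  where open ≡.≡-Reasoning

on-∷ʳ : ∀ {n} τ (w : Word n) s → on τ (w ∷ʳ s) ≡ on τ w ∷ʳ onLetter (below τ w) s
on-∷ʳ τ [] s with on τ [] | on τ (s ∷ [])
... | [] | t ∷ [] = ≡.refl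
on-∷ʳ τ (t ∷ w) s = begin
  on τ ((t ∷ w) ∷ʳ s)
    ≡⟨ on-∷ τ t (w ∷ʳ s) ⟩
  onLetter τ t ∷ on (belowLetter τ t) (w ∷ʳ s)
    ≡⟨ ≡.cong (onLetter τ t ∷_) (on-∷ʳ (belowLetter τ t) w s) ⟩
  (onLetter τ t ∷ on (belowLetter τ t) w) ∷ʳ onLetter (below τ (t ∷ w)) s
    ≡⟨ ≡.cong (_∷ʳ onLetter (below τ (t ∷ w)) s) (on-∷ τ t w) ⟨
  on τ (t ∷ w) ∷ʳ onLetter (below τ (t ∷ w)) s ∎
  where open ≡.≡-Reasoning

letterSign : TreeMap → ∀ {m} → Word m → Sign
letterSign τ w = permSign (onLetter (below τ w))

-- By `wordSign-∷` the signs on two consecutive levels share the factor by which the first letters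
-- are permuted. It cancels in the product and leaves the same statement for the three sections;
-- after `m` cancellations only the permutations of the children of the words of length `m` remain.
wordSign-on-* : ∀ τ m → wordSign (on τ {suc m}) Sign.* wordSign (on τ {m}) ≡ ∏ʷ m (letterSign τ)
wordSign-on-* τ m = go m τ
  where
  open ≡.≡-Reasoning
  wordSign-on : ∀ m τ → wordSign (on τ {suc m}) ≡
                        permSign (onLetter τ) Sign.* ∏ˢ (λ s → wordSign (on (belowLetter τ s) {m}))
  wordSign-on m τ = wordSign-∷ {m} {on τ} {onLetter τ} {λ s → on (belowLetter τ s)}
                               (onLetter-injective τ) (on-∷ τ)
  square-* : ∀ s t u → (s Sign.* t) Sign.* (s Sign.* u) ≡ t Sign.* u
  square-* Sign.+ t       u = ≡.refl
  square-* Sign.- Sign.+  u = Sign.opposite-involutive u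
  square-* Sign.- Sign.-  u = ≡.refl
  go : ∀ m τ → wordSign (on τ {suc m}) Sign.* wordSign (on τ {m}) ≡ ∏ʷ m (letterSign τ)
  go zero    τ = begin
    wordSign (on τ {1}) Sign.* Sign.+  ≡⟨ Sign.*-identityʳ (wordSign (on τ {1})) ⟩
    wordSign (on τ {1})                ≡⟨ wordSign-on 0 τ ⟩
    permSign (onLetter τ) Sign.* Sign.+ ≡⟨ Sign.*-identityʳ (permSign (onLetter τ)) ⟩
    permSign (onLetter τ)              ∎
  go (suc m) τ = begin
    wordSign (on τ {suc (suc m)}) Sign.* wordSign (on τ {suc m})
      ≡⟨ ≡.cong₂ Sign._*_ (wordSign-on (suc m) τ) (wordSign-on m τ) ⟩
    (permSign (onLetter τ) Sign.* ∏ˢ (λ s → wordSign (on (belowLetter τ s) {suc m}))) Sign.*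
      (permSign (onLetter τ) Sign.* ∏ˢ (λ s → wordSign (on (belowLetter τ s) {m})))
      ≡⟨ square-* (permSign (onLetter τ)) _ _ ⟩
    ∏ˢ (λ s → wordSign (on (belowLetter τ s) {suc m})) Sign.* ∏ˢ (λ s → wordSign (on (belowLetter τ s) {m}))
      ≡⟨ ∏ˢ-distrib-* (λ s → wordSign (on (belowLetter τ s) {suc m})) (λ s → wordSign (on (belowLetter τ s) {m})) ⟨
    ∏ˢ (λ s → wordSign (on (belowLetter τ s) {suc m}) Sign.* wordSign (on (belowLetter τ s) {m}))
      ≡⟨ ∏ˢ-cong {3} (λ s → go m (belowLetter τ s)) ⟩
    ∏ʷ (suc m) (letterSign τ) ∎

asTreeMap : TreeAut → TreeMap
asTreeMap σ = record
  { on           = TreeAut.⟦_⟧ σ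
  ; on-init      = λ {n} → TreeAut.onParent σ n
  ; on-injective = λ {n} {u} {v} e → ≡.trans (≡.sym (Inverse.strictlyInverseʳ (TreeAut.onLevel σ n) u))
      (≡.trans (≡.cong (Inverse.from (TreeAut.onLevel σ n)) e) (Inverse.strictlyInverseʳ (TreeAut.onLevel σ n) v))
  }

sgn-below : ∀ m σ {k} (y : Word k) → sgn m σ y ≡ wordSign (on (below (asTreeMap σ) y) {m})
sgn-below m σ {k} y = wordSign-cong {m} λ w → ≡.trans
  (≡.cong (drop k) (on-++ (asTreeMap σ) y w)) (drop-++ (on (asTreeMap σ) y))

sgnProduct-below : ∀ m σ {k} (y : Word k) →
                   sgnProduct (suc m) σ y ≡ ∏ʷ m (letterSign (below (asTreeMap σ) y))
sgnProduct-below m σ y = ≡.trans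
  (≡.cong₂ Sign._*_ (sgn-below (suc m) σ y) (sgn-below m σ y)) (wordSign-on-* (below (asTreeMap σ) y) m)

-- Commutative rings and fields

-- Integer coefficients have an equality that computes, so the solver normalises numerals such as 27
-- in any ring. `⟦ + n ⟧ℤ` unfolds to `n · 1#`, the form of the 3 in `MinusThreeIsSquare`.
module IntegerCoefficients {c ℓ} (R : CommutativeRing c ℓ) where
  open CommutativeRing R
  open RingProperties ring
  open SemiringMult semiring using (×1-homo-*; ×-homo-+) renaming (_×_ to _·_)
  open SetoidReasoning setoid

  ⟦_⟧ℤ : ℤ → Carrier
  ⟦ + n      ⟧ℤ = n · 1#
  ⟦ -[1+ n ] ⟧ℤ = - (suc n · 1#)

  private
    ⊖-homo : ∀ m n → ⟦ m ℤ.⊖ n ⟧ℤ ≈ m · 1# - n · 1#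
    ⊖-homo m       zero    = sym (trans (+-congˡ -0#≈0#) (+-identityʳ _))
    ⊖-homo zero    (suc n) = sym (+-identityˡ _)
    ⊖-homo (suc m) (suc n) = begin
      ⟦ suc m ℤ.⊖ suc n ⟧ℤ               ≡⟨ ≡.cong ⟦_⟧ℤ (ℤ.[1+m]⊖[1+n]≡m⊖n m n) ⟩
      ⟦ m ℤ.⊖ n ⟧ℤ                       ≈⟨ ⊖-homo m n ⟩
      m · 1# - n · 1#                    ≈⟨ +-congʳ (trans (+-congˡ (-‿inverseʳ 1#)) (+-identityʳ _)) ⟨
      (m · 1# + (1# - 1#)) - n · 1#      ≈⟨ +-congʳ (trans (sym (+-assoc _ _ _)) (+-congʳ (+-comm _ _))) ⟩
      ((1# + m · 1#) - 1#) - n · 1#      ≈⟨ +-assoc _ _ _ ⟩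
      (1# + m · 1#) + (- 1# - n · 1#)    ≈⟨ +-congˡ (-‿+-comm 1# (n · 1#)) ⟩
      (1# + m · 1#) - (1# + n · 1#)      ∎

    +-homo : ∀ i j → ⟦ i ℤ.+ j ⟧ℤ ≈ ⟦ i ⟧ℤ + ⟦ j ⟧ℤ
    +-homo (+ m)      (+ n)      = ×-homo-+ 1# m n
    +-homo (+ m)      (-[1+ n ]) = ⊖-homo m (suc n)
    +-homo (-[1+ m ]) (+ n)      = trans (⊖-homo n (suc m)) (+-comm _ _)
    +-homo (-[1+ m ]) (-[1+ n ]) = trans (-‿cong (begin
      suc (suc (m +ℕ n)) · 1#    ≡⟨ ≡.cong (_· 1#) (≡.cong suc (≡.sym (ℕ.+-suc m n))) ⟩
      (suc m +ℕ suc n) · 1#      ≈⟨ ×-homo-+ 1# (suc m) (suc n) ⟩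
      suc m · 1# + suc n · 1#    ∎)) (sym (-‿+-comm _ _))

    neg-homo : ∀ i → ⟦ ℤ.- i ⟧ℤ ≈ - ⟦ i ⟧ℤ
    neg-homo (+ zero)   = sym -0#≈0#
    neg-homo (+ suc n)  = refl
    neg-homo -[1+ n ]   = sym (-‿involutive _)

    *-homo-+ : ∀ m j → ⟦ + m ℤ.* j ⟧ℤ ≈ m · 1# * ⟦ j ⟧ℤ
    *-homo-+ m (+ n)    = trans (reflexive (≡.cong ⟦_⟧ℤ (≡.sym (ℤ.pos-* m n)))) (×1-homo-* m n)
    *-homo-+ m -[1+ n ] = begin
      ⟦ + m ℤ.* -[1+ n ] ⟧ℤ        ≡⟨ ≡.cong ⟦_⟧ℤ (ℤ.neg-distribʳ-* (+ m) (+ suc n)) ⟨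
      ⟦ ℤ.- (+ m ℤ.* + suc n) ⟧ℤ   ≈⟨ neg-homo (+ m ℤ.* + suc n) ⟩
      - ⟦ + m ℤ.* + suc n ⟧ℤ       ≈⟨ -‿cong (*-homo-+ m (+ suc n)) ⟩
      - (m · 1# * suc n · 1#)      ≈⟨ -‿distribʳ-* _ _ ⟩
      m · 1# * - (suc n · 1#)      ∎

    *-homo : ∀ i j → ⟦ i ℤ.* j ⟧ℤ ≈ ⟦ i ⟧ℤ * ⟦ j ⟧ℤ
    *-homo (+ m) j    = *-homo-+ m j
    *-homo -[1+ m ] j = begin
      ⟦ -[1+ m ] ℤ.* j ⟧ℤ          ≡⟨ ≡.cong ⟦_⟧ℤ (ℤ.neg-distribˡ-* (+ suc m) j) ⟨
      ⟦ ℤ.- (+ suc m ℤ.* j) ⟧ℤ     ≈⟨ neg-homo (+ suc m ℤ.* j) ⟩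
      - ⟦ + suc m ℤ.* j ⟧ℤ         ≈⟨ -‿cong (*-homo-+ (suc m) j) ⟩
      - (suc m · 1# * ⟦ j ⟧ℤ)      ≈⟨ -‿distribˡ-* _ _ ⟩
      - (suc m · 1#) * ⟦ j ⟧ℤ      ∎

  morphism : ℤ.+-*-rawRing -Raw-AlmostCommutative⟶ fromCommutativeRing R
  morphism = record
    { ⟦_⟧ = ⟦_⟧ℤ ; +-homo = +-homo ; *-homo = *-homo ; -‿homo = neg-homo
    ; 0-homo = refl ; 1-homo = +-identityʳ 1# }

  ⟦⟧ℤ-≟ : ∀ i j → Maybe (⟦ i ⟧ℤ ≈ ⟦ j ⟧ℤ)
  ⟦⟧ℤ-≟ i j with i ℤ.≟ j
  ... | yes i≡j = just (reflexive (≡.cong ⟦_⟧ℤ i≡j))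
  ... | no _    = nothing

  open RingSolver ℤ.+-*-rawRing (fromCommutativeRing R) morphism ⟦⟧ℤ-≟ public
    using (solve; _:=_; _:+_; _:*_; _:-_; :-_; con)

module SignAction {c ℓ} (R : CommutativeRing c ℓ) where
  open CommutativeRing R hiding (zero)
  open RingProperties ring
  open IntegerCoefficients R
  open MonoidSum *-commutativeMonoid using () renaming (sum to ∏)
  open WordProduct *-commutativeMonoid

  infixr 8 _•_
  _•_ : Sign → Carrier → Carrier
  Sign.+ • x = x
  Sign.- • x = - x

  •-congˡ : ∀ s {x y} → x ≈ y → s • x ≈ s • y
  •-congˡ Sign.+ e = e
  •-congˡ Sign.- e = -‿cong e

  •-assoc-* : ∀ s x y → s • (x * y) ≈ (s • x) * y
  •-assoc-* Sign.+ x y = refl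
  •-assoc-* Sign.- x y = -‿distribˡ-* x y

  *-•-• : ∀ s t x y → (s • x) * (t • y) ≈ (s Sign.* t) • (x * y)
  *-•-• Sign.+ Sign.+ x y = refl
  *-•-• Sign.+ Sign.- x y = sym (-‿distribʳ-* x y)
  *-•-• Sign.- Sign.+ x y = sym (-‿distribˡ-* x y)
  *-•-• Sign.- Sign.- x y = solve 2 (λ x y → :- x :* :- y := x :* y) refl x y

  ∏-• : ∀ {n} (s : Fin n → Sign) x → ∏ (λ i → s i • x i) ≈ (∏ˢ s) • ∏ x
  ∏-• {zero}  s x = refl
  ∏-• {suc n} s x = trans (*-congˡ (∏-• (s ∘ suc) (x ∘ suc))) (*-•-• (s zero) (∏ˢ (s ∘ suc)) _ _)

  ∏ʷ-• : ∀ m (s : Word m → Sign) x → wordProduct m (λ w → s w • x w) ≈ (∏ʷ m s) • wordProduct m x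
  ∏ʷ-• zero    s x = refl
  ∏ʷ-• (suc m) s x = trans (MonoidSum.sum-cong-≋ *-commutativeMonoid {3} λ t → ∏ʷ-• m (λ w → s (t ∷ w)) (λ w → x (t ∷ w)))
                           (∏-• (λ t → ∏ʷ m λ w → s (t ∷ w)) (λ t → wordProduct m λ w → x (t ∷ w)))

  -- δ² is the discriminant of the monic cubic with roots c.
  δ : (Fin 3 → Carrier) → Carrier
  δ c = ((c 0F - c 1F) * (c 0F - c 2F)) * (c 1F - c 2F)

  δ-cong : ∀ {c d} → (∀ s → c s ≈ d s) → δ c ≈ δ d
  δ-cong e = *-cong (*-cong (-cong 0F 1F) (-cong 0F 2F)) (-cong 1F 2F)
    where
    -cong : ∀ s t → _ - _ ≈ _ - _
    -cong s t = +-cong (e s) (-‿cong (e t))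

  -- `δ` is a Vandermonde product up to sign, hence alternating; the six arrangements are checked
  -- one by one.
  δ-rearrange : ∀ {p : Fin 3 → Fin 3} → Injective _≡_ _≡_ p → ∀ c → δ (c ∘ p) ≈ permSign p • δ c
  δ-rearrange {p} p-inj c with p 0F | p 1F | p 2F | injective⇒arrangement p-inj
  ... | _ | _ | _ | 012F = refl
  ... | _ | _ | _ | 021F = solve 3 (λ x y z → (x :- z) :* (x :- y) :* (z :- y) := :- ((x :- y) :* (x :- z) :* (y :- z))) refl _ _ _
  ... | _ | _ | _ | 102F = solve 3 (λ x y z → (y :- x) :* (y :- z) :* (x :- z) := :- ((x :- y) :* (x :- z) :* (y :- z))) refl _ _ _
  ... | _ | _ | _ | 120F = solve 3 (λ x y z → (y :- z) :* (y :- x) :* (z :- x) := (x :- y) :* (x :- z) :* (y :- z)) refl _ _ _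
  ... | _ | _ | _ | 201F = solve 3 (λ x y z → (z :- x) :* (z :- y) :* (x :- y) := (x :- y) :* (x :- z) :* (y :- z)) refl _ _ _
  ... | _ | _ | _ | 210F = solve 3 (λ x y z → (z :- y) :* (z :- x) :* (y :- x) := :- ((x :- y) :* (x :- z) :* (y :- z))) refl _ _ _

  Tree : Set c
  Tree = ∀ n → Word n → Carrier

  subtree : ∀ {k} → Tree → Word k → Tree
  subtree {k} T y n w = T (k +ℕ n) (y ++ w)

  -- The product E of the overview, taken at the root of `T`. For another node `y` it is applied to
  -- `subtree T y`.
  δʷ : ∀ m → Tree → Carrier
  δʷ m T = wordProduct m λ w → δ λ s → T (suc m) (w ∷ʳ s)

  wordProduct-on : ∀ m τ (h : Word m → Carrier) → wordProduct m (λ w → h (on τ w)) ≈ wordProduct m h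
  wordProduct-on zero    τ h with on τ []
  ... | [] = refl
  wordProduct-on (suc m) τ h = begin
    ∏ (λ s → wordProduct m λ w → h (on τ (s ∷ w)))
      ≈⟨ sum-cong-≋ {3} (λ s → wordProduct-cong m λ w → reflexive (≡.cong h (on-∷ τ s w))) ⟩
    ∏ (λ s → wordProduct m λ w → h (onLetter τ s ∷ on (belowLetter τ s) w))
      ≈⟨ sum-cong-≋ {3} (λ s → wordProduct-on m (belowLetter τ s) (λ w → h (onLetter τ s ∷ w))) ⟩
    ∏ (λ s → wordProduct m λ w → h (onLetter τ s ∷ w))
      ≈⟨ sum-rearrange (onLetter-injective τ) (λ s → wordProduct m λ w → h (s ∷ w)) ⟩
    ∏ (λ s → wordProduct m λ w → h (s ∷ w)) ∎
    where
    open MonoidSum *-commutativeMonoid using (sum-cong-≋)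
    open SetoidReasoning setoid

record IsField {c ℓ} (L : CommutativeRing c ℓ) : Set (c ⊔ ℓ) where
  open CommutativeRing L hiding (zero)
  infix 4 _≟_
  field
    _≟_    : ∀ x y → Dec (x ≈ y)
    invert : ∀ {x} → ¬ x ≈ 0# → ∃[ y ] x * y ≈ 1#
    1≉0    : ¬ 1# ≈ 0#

module Field {c ℓ} (L : CommutativeRing c ℓ) (isField : IsField L) where
  open CommutativeRing L hiding (zero)
  open IsField isField public
  open IntegerCoefficients L
  open WordProduct *-commutativeMonoid
  open MonoidSum *-commutativeMonoid using () renaming (sum to ∏)
  open SetoidReasoning setoid

  *-cancelˡ : ∀ {x y z} → ¬ x ≈ 0# → x * y ≈ x * z → y ≈ z
  *-cancelˡ {x} {y} {z} x≉0 e = let x⁻¹ , xx⁻¹≈1 = invert x≉0 in begin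
    y              ≈⟨ *-identityˡ y ⟨
    1# * y         ≈⟨ *-congʳ xx⁻¹≈1 ⟨
    x * x⁻¹ * y    ≈⟨ solve 3 (λ x x⁻¹ y → x :* x⁻¹ :* y := x⁻¹ :* (x :* y)) refl x x⁻¹ y ⟩
    x⁻¹ * (x * y)  ≈⟨ *-congˡ e ⟩
    x⁻¹ * (x * z)  ≈⟨ solve 3 (λ x x⁻¹ z → x⁻¹ :* (x :* z) := x :* x⁻¹ :* z) refl x x⁻¹ z ⟩
    x * x⁻¹ * z    ≈⟨ *-congʳ xx⁻¹≈1 ⟩
    1# * z         ≈⟨ *-identityˡ z ⟩
    z              ∎

  x*y≈0⇒y≈0 : ∀ {x y} → ¬ x ≈ 0# → x * y ≈ 0# → y ≈ 0#
  x*y≈0⇒y≈0 x≉0 e = *-cancelˡ x≉0 (trans e (sym (zeroʳ _)))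

  x*y≉0 : ∀ {x y} → ¬ x ≈ 0# → ¬ y ≈ 0# → ¬ x * y ≈ 0#
  x*y≉0 x≉0 y≉0 e = y≉0 (x*y≈0⇒y≈0 x≉0 e)

  x*y≈0⇒x≈0⊎y≈0 : ∀ {x y} → x * y ≈ 0# → x ≈ 0# ⊎ y ≈ 0#
  x*y≈0⇒x≈0⊎y≈0 {x} e with x ≟ 0#
  ... | yes x≈0 = inj₁ x≈0
  ... | no  x≉0 = inj₂ (x*y≈0⇒y≈0 x≉0 e)

  x-y≈0⇒x≈y : ∀ {x y} → x - y ≈ 0# → x ≈ y
  x-y≈0⇒x≈y {x} {y} e = begin
    x             ≈⟨ solve 2 (λ x y → x := (x :- y) :+ y) refl x y ⟩
    (x - y) + y   ≈⟨ +-congʳ e ⟩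
    0# + y        ≈⟨ +-identityˡ y ⟩
    y             ∎

  x≈y⇒x-y≈0 : ∀ {x y} → x ≈ y → x - y ≈ 0#
  x≈y⇒x-y≈0 {x} {y} e = trans (+-congʳ e) (-‿inverseʳ y)

  x²≈y²⇒x≈±y : ∀ {x y} → x * x ≈ y * y → x ≈ y ⊎ x ≈ - y
  x²≈y²⇒x≈±y {x} {y} e with x*y≈0⇒x≈0⊎y≈0 {x - y} {x + y}
    (trans (solve 2 (λ x y → (x :- y) :* (x :+ y) := x :* x :- y :* y) refl x y) (x≈y⇒x-y≈0 e))
  ... | inj₁ x-y≈0 = inj₁ (x-y≈0⇒x≈y x-y≈0)
  ... | inj₂ x+y≈0 = inj₂ (x-y≈0⇒x≈y (trans (solve 2 (λ x y → x :- :- y := x :+ y) refl x y) x+y≈0))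

  wordProduct≉0 : ∀ m {h : Word m → Carrier} → (∀ w → ¬ h w ≈ 0#) → ¬ wordProduct m h ≈ 0#
  wordProduct≉0 zero    h≉0 = h≉0 []
  wordProduct≉0 (suc m) h≉0 = ∏≉0 λ s → wordProduct≉0 m λ w → h≉0 (s ∷ w)
    where
    ∏≉0 : ∀ {n} {h : Fin n → Carrier} → (∀ i → ¬ h i ≈ 0#) → ¬ ∏ h ≈ 0#
    ∏≉0 {zero}  h≉0 = 1≉0
    ∏≉0 {suc n} h≉0 = x*y≉0 (h≉0 zero) (∏≉0 (h≉0 ∘ suc))

-- Cubic maps and their preimage trees

iterate-suc : ∀ {a} {A : Set a} (f : A → A) n x → iterate f x (suc n) ≡ f (iterate f x n)
iterate-suc f zero    x = ≡.refl
iterate-suc f (suc n) x = iterate-suc f n (f x)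

∷ʳ-elim : ∀ {a p} {A : Set a} {n} (P : Vec A (suc n) → Set p) → (∀ u x → P (u ∷ʳ x)) → ∀ v → P v
∷ʳ-elim P p v = let u , x , v≡ = initLast v in ≡.subst P (≡.sym v≡) (p u x)

module CubicMap {a ℓ} (L : CommutativeRing a ℓ) (isField : IsField L)
  (a₀ a₁ a₂ a₃ : CommutativeRing.Carrier L)
  (a₃≉0 : ¬ CommutativeRing._≈_ L a₃ (CommutativeRing.0# L)) where
  open CommutativeRing L hiding (zero)
  open Field L isField
  open SignAction L using (_•_; ∏ʷ-•; δ; δ-cong; Tree; subtree; δʷ)
  open IntegerCoefficients L
  open WordProduct *-commutativeMonoid
  open MonoidSum *-commutativeMonoid using (sum-cong-≋; ∑-distrib-+) renaming (sum to ∏)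
  open SetoidReasoning setoid

  -- The trailing `x * 0#` makes `f` unfold to the same term as `eval` of the coefficient vector, so
  -- its iterates are those of `fL` without any conversion.
  f f′ : Carrier → Carrier
  f  x = a₀ + x * (a₁ + x * (a₂ + x * (a₃ + x * 0#)))
  f′ x = a₁ + x * ((a₂ + a₂) + x * (a₃ + a₃ + a₃))

  f-cong : ∀ {x y} → x ≈ y → f x ≈ f y
  f-cong e = +-congˡ (*-cong e (+-congˡ (*-cong e (+-congˡ (*-cong e (+-congˡ (*-congʳ e)))))))

  iterate-cong : ∀ n {x y} → x ≈ y → iterate f x n ≈ iterate f y n
  iterate-cong zero    e = e
  iterate-cong (suc n) e = iterate-cong n (f-cong e)

  private
    -- The divided difference of `f` at `x` and `y`, arranged as a quadratic in `y` whose
    -- coefficients can be handed to `quadraticRoot`.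
    quotient : Carrier → Carrier → Carrier
    quotient x y = (a₁ + x * (a₂ + x * a₃)) + y * ((a₂ + x * a₃) + y * a₃)

    x+y≈0⇒x≈-y : ∀ {x y} → x + y ≈ 0# → x ≈ - y
    x+y≈0⇒x≈-y {x} {y} e = x-y≈0⇒x≈y (trans (+-congˡ (RingProperties.-‿involutive ring y)) e)

  -- The roots of `f - t` with multiplicity, expressed by comparing coefficients. Unlike a mere set
  -- of solutions this makes the factorisation and the discriminant polynomial identities in `c`.
  record Fibre (t : Carrier) (c : Fin 3 → Carrier) : Set ℓ where
    field
      vieta₂ : a₂ ≈ - (a₃ * (c 0F + c 1F + c 2F))
      vieta₁ : a₁ ≈ a₃ * (c 0F * c 1F + c 0F * c 2F + c 1F * c 2F)
      vieta₀ : a₀ - t ≈ - (a₃ * (c 0F * c 1F * c 2F))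

    factor : ∀ x → f x - t ≈ a₃ * ∏ (λ s → x - c s)
    factor x = begin
      f x - t
        ≈⟨ solve 3 (λ a u t → a :+ u :- t := (a :- t) :+ u) refl a₀ _ t ⟩
      (a₀ - t) + x * (a₁ + x * (a₂ + x * (a₃ + x * 0#)))
        ≈⟨ +-cong vieta₀ (*-congˡ (+-cong vieta₁ (*-congˡ (+-congʳ vieta₂)))) ⟩
      - (a₃ * (c 0F * c 1F * c 2F)) + x * (a₃ * (c 0F * c 1F + c 0F * c 2F + c 1F * c 2F) +
        x * (- (a₃ * (c 0F + c 1F + c 2F)) + x * (a₃ + x * 0#)))
        ≈⟨ solve 5 (λ a₃ x c₀ c₁ c₂ →
             :- (a₃ :* (c₀ :* c₁ :* c₂)) :+ x :* (a₃ :* (c₀ :* c₁ :+ c₀ :* c₂ :+ c₁ :* c₂) :+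
               x :* (:- (a₃ :* (c₀ :+ c₁ :+ c₂)) :+ x :* (a₃ :+ x :* con (+ 0))))
             := a₃ :* ((x :- c₀) :* ((x :- c₁) :* (x :- c₂)))) refl a₃ x (c 0F) (c 1F) (c 2F) ⟩
      a₃ * ((x - c 0F) * ((x - c 1F) * (x - c 2F)))
        ≈⟨ *-congˡ (*-congˡ (*-congˡ (*-identityʳ _))) ⟨
      a₃ * ∏ (λ s → x - c s) ∎

    child : ∀ s → f (c s) ≈ t
    child s = x-y≈0⇒x≈y (trans (factor (c s)) (trans (*-congˡ (vanish s)) (zeroʳ a₃)))
      where
      vanish : ∀ s → ∏ (λ t → c s - c t) ≈ 0#
      vanish 0F = trans (*-congʳ (-‿inverseʳ _)) (zeroˡ _)
      vanish 1F = trans (*-congˡ (trans (*-congʳ (-‿inverseʳ _)) (zeroˡ _))) (zeroʳ _)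
      vanish 2F = trans (*-congˡ (trans (*-congˡ (trans (*-congʳ (-‿inverseʳ _)) (zeroˡ _))) (zeroʳ _))) (zeroʳ _)

    covers : ∀ {z} → f z ≈ t → ∃[ s ] c s ≈ z
    covers {z} fz≈t =
      [ (λ e → 0F , sym (x-y≈0⇒x≈y e)) ,
      (λ e → [ (λ e → 1F , sym (x-y≈0⇒x≈y e)) ,
      (λ e → [ (λ e → 2F , sym (x-y≈0⇒x≈y e)) ,
      (λ e → contradiction e 1≉0) ]′ (x*y≈0⇒x≈0⊎y≈0 e)) ]′ (x*y≈0⇒x≈0⊎y≈0 e)) ]′
      (x*y≈0⇒x≈0⊎y≈0 (x*y≈0⇒y≈0 a₃≉0 (trans (sym (factor z)) (x≈y⇒x-y≈0 fz≈t))))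

    -- The derivative of a product of linear factors at one of its roots. The roots `c 0F` and
    -- `c 1F` already involve all three differences.
    f′-child : f′ (c 0F) ≈ a₃ * ((c 0F - c 1F) * (c 0F - c 2F)) ×
               f′ (c 1F) ≈ a₃ * ((c 1F - c 0F) * (c 1F - c 2F))
    f′-child =
      trans expand (solve 4 (λ a₃ x y z →
        a₃ :* (x :* y :+ x :* z :+ y :* z) :+ x :* ((:- (a₃ :* (x :+ y :+ z)) :+ :- (a₃ :* (x :+ y :+ z))) :+
          x :* (a₃ :+ a₃ :+ a₃)) := a₃ :* ((x :- y) :* (x :- z))) refl a₃ (c 0F) (c 1F) (c 2F)) ,
      trans expand (solve 4 (λ a₃ x y z →
        a₃ :* (x :* y :+ x :* z :+ y :* z) :+ y :* ((:- (a₃ :* (x :+ y :+ z)) :+ :- (a₃ :* (x :+ y :+ z))) :+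
          y :* (a₃ :+ a₃ :+ a₃)) := a₃ :* ((y :- x) :* (y :- z))) refl a₃ (c 0F) (c 1F) (c 2F))
      where
      expand : ∀ {x} → f′ x ≈ a₃ * (c 0F * c 1F + c 0F * c 2F + c 1F * c 2F) +
                 x * ((- (a₃ * (c 0F + c 1F + c 2F)) + - (a₃ * (c 0F + c 1F + c 2F))) + x * (a₃ + a₃ + a₃))
      expand = +-cong vieta₁ (*-congˡ (+-congʳ (+-cong vieta₂ vieta₂)))

    noncritical⇒injective : (∀ s → ¬ f′ (c s) ≈ 0#) → Injective _≡_ _≈_ c
    noncritical⇒injective f′≉0 = inj _ _
      where
      c₀≉c₁ : ¬ c 0F ≈ c 1F
      c₀≉c₁ e = f′≉0 0F (trans (f′-child .proj₁)
        (trans (*-congˡ (trans (*-congʳ (x≈y⇒x-y≈0 e)) (zeroˡ _))) (zeroʳ a₃)))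
      c₀≉c₂ : ¬ c 0F ≈ c 2F
      c₀≉c₂ e = f′≉0 0F (trans (f′-child .proj₁)
        (trans (*-congˡ (trans (*-congˡ (x≈y⇒x-y≈0 e)) (zeroʳ _))) (zeroʳ a₃)))
      c₁≉c₂ : ¬ c 1F ≈ c 2F
      c₁≉c₂ e = f′≉0 1F (trans (f′-child .proj₂)
        (trans (*-congˡ (trans (*-congˡ (x≈y⇒x-y≈0 e)) (zeroʳ _))) (zeroʳ a₃)))
      inj : ∀ s t → c s ≈ c t → s ≡ t
      inj 0F 0F e = ≡.refl
      inj 0F 1F e = contradiction e c₀≉c₁
      inj 0F 2F e = contradiction e c₀≉c₂
      inj 1F 0F e = contradiction (sym e) c₀≉c₁
      inj 1F 1F e = ≡.refl
      inj 1F 2F e = contradiction e c₁≉c₂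
      inj 2F 0F e = contradiction (sym e) c₀≉c₂
      inj 2F 1F e = contradiction (sym e) c₁≉c₂
      inj 2F 2F e = ≡.refl

  private
    -- One root, the divided difference at a second and the sum of the roots determine the rest:
    -- with `vieta₂` inserted, `quotient` being zero reads as `vieta₁`, and then `f (c 0F) ≈ t`
    -- reads as `vieta₀`.
    fibre : ∀ {t} {c : Fin 3 → Carrier} → f (c 0F) ≈ t → quotient (c 0F) (c 1F) ≈ 0# →
            a₂ ≈ - (a₃ * (c 0F + c 1F + c 2F)) → Fibre t c
    fibre {t} {c} fc₀≈t q≈0 v₂ = record { vieta₂ = v₂ ; vieta₁ = v₁ ; vieta₀ = v₀ }
      where
      c₀ = c 0F
      c₁ = c 1F
      c₂ = c 2F
      v₁ : a₁ ≈ a₃ * (c₀ * c₁ + c₀ * c₂ + c₁ * c₂)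
      v₁ = begin
        a₁
          ≈⟨ x+y≈0⇒x≈-y (trans (sym (+-assoc _ _ _)) q≈0) ⟩
        - (c₀ * (a₂ + c₀ * a₃) + c₁ * ((a₂ + c₀ * a₃) + c₁ * a₃))
          ≈⟨ -‿cong (+-cong (*-congˡ (+-congʳ v₂)) (*-congˡ (+-congʳ (+-congʳ v₂)))) ⟩
        - (c₀ * (- (a₃ * (c₀ + c₁ + c₂)) + c₀ * a₃) + c₁ * ((- (a₃ * (c₀ + c₁ + c₂)) + c₀ * a₃) + c₁ * a₃))
          ≈⟨ solve 4 (λ a₃ c₀ c₁ c₂ → :- (c₀ :* (:- (a₃ :* (c₀ :+ c₁ :+ c₂)) :+ c₀ :* a₃) :+
                 c₁ :* ((:- (a₃ :* (c₀ :+ c₁ :+ c₂)) :+ c₀ :* a₃) :+ c₁ :* a₃))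
               := a₃ :* (c₀ :* c₁ :+ c₀ :* c₂ :+ c₁ :* c₂)) refl a₃ c₀ c₁ c₂ ⟩
        a₃ * (c₀ * c₁ + c₀ * c₂ + c₁ * c₂) ∎
      v₀ : a₀ - t ≈ - (a₃ * (c₀ * c₁ * c₂))
      v₀ = begin
        a₀ - t
          ≈⟨ x+y≈0⇒x≈-y (trans (solve 3 (λ a t u → (a :- t) :+ u := (a :+ u) :- t) refl a₀ t _) (x≈y⇒x-y≈0 fc₀≈t)) ⟩
        - (c₀ * (a₁ + c₀ * (a₂ + c₀ * (a₃ + c₀ * 0#))))
          ≈⟨ -‿cong (*-congˡ (+-cong v₁ (*-congˡ (+-congʳ v₂)))) ⟩
        - (c₀ * (a₃ * (c₀ * c₁ + c₀ * c₂ + c₁ * c₂) + c₀ * (- (a₃ * (c₀ + c₁ + c₂)) + c₀ * (a₃ + c₀ * 0#))))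
          ≈⟨ solve 4 (λ a₃ c₀ c₁ c₂ → :- (c₀ :* (a₃ :* (c₀ :* c₁ :+ c₀ :* c₂ :+ c₁ :* c₂) :+
                 c₀ :* (:- (a₃ :* (c₀ :+ c₁ :+ c₂)) :+ c₀ :* (a₃ :+ c₀ :* con (+ 0)))))
               := :- (a₃ :* (c₀ :* c₁ :* c₂))) refl a₃ c₀ c₁ c₂ ⟩
        - (a₃ * (c₀ * c₁ * c₂)) ∎

    f-quotient : ∀ x y → f x - f y ≈ (x - y) * quotient x y
    f-quotient x y = trans
      (solve 3 (λ a u v → (a :+ u) :- (a :+ v) := u :- v) refl a₀ _ _)
      (solve 5 (λ a₁ a₂ a₃ x y →
        x :* (a₁ :+ x :* (a₂ :+ x :* (a₃ :+ x :* con (+ 0)))) :-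
        y :* (a₁ :+ y :* (a₂ :+ y :* (a₃ :+ y :* con (+ 0))))
        := (x :- y) :* ((a₁ :+ x :* (a₂ :+ x :* a₃)) :+ y :* ((a₂ :+ x :* a₃) :+ y :* a₃)))
        refl a₁ a₂ a₃ x y)

  -- Divided differences taken twice: `quotient (c 0F)` vanishes at the two other points, and its
  -- own divided difference there is `a₂ + a₃ * (c 0F + c 1F + c 2F)`, which is therefore zero.
  distinct⇒fibre : ∀ {t c} → Injective _≡_ _≈_ c → (∀ s → f (c s) ≈ t) → Fibre t c
  distinct⇒fibre {t} {c} c-inj fc≈t = fibre (fc≈t 0F) (q≈0 1F λ e → case c-inj e of λ ())
    (x+y≈0⇒x≈-y (x*y≈0⇒y≈0 (λ e → case c-inj (x-y≈0⇒x≈y e) of λ ()) (begin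
      (c 1F - c 2F) * (a₂ + a₃ * (c 0F + c 1F + c 2F))
        ≈⟨ *-congˡ (solve 5 (λ a₂ a₃ c₀ c₁ c₂ → a₂ :+ a₃ :* (c₀ :+ c₁ :+ c₂)
             := (a₂ :+ c₀ :* a₃) :+ (c₁ :+ c₂) :* a₃) refl a₂ a₃ (c 0F) (c 1F) (c 2F)) ⟩
      (c 1F - c 2F) * ((a₂ + c 0F * a₃) + (c 1F + c 2F) * a₃)
        ≈⟨ solve 5 (λ u v a₃ c₁ c₂ → (c₁ :- c₂) :* (v :+ (c₁ :+ c₂) :* a₃)
             := (u :+ c₁ :* (v :+ c₁ :* a₃)) :- (u :+ c₂ :* (v :+ c₂ :* a₃)))
             refl (a₁ + c 0F * (a₂ + c 0F * a₃)) (a₂ + c 0F * a₃) a₃ (c 1F) (c 2F) ⟩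
      quotient (c 0F) (c 1F) - quotient (c 0F) (c 2F)
        ≈⟨ x≈y⇒x-y≈0 (trans (q≈0 1F λ e → case c-inj e of λ ()) (sym (q≈0 2F λ e → case c-inj e of λ ()))) ⟩
      0# ∎)))
    where
    q≈0 : ∀ s → ¬ c 0F ≈ c s → quotient (c 0F) (c s) ≈ 0#
    q≈0 s c₀≉cₛ = x*y≈0⇒y≈0 (λ e → c₀≉cₛ (x-y≈0⇒x≈y e))
      (trans (sym (f-quotient (c 0F) (c s))) (x≈y⇒x-y≈0 (trans (fc≈t 0F) (sym (fc≈t s)))))

  exists-fibre : (∀ t → ∃[ z ] f z ≈ t) →
                 (∀ b₀ b₁ b₂ → ¬ b₂ ≈ 0# → ∃[ z ] b₀ + z * (b₁ + z * (b₂ + z * 0#)) ≈ 0#) →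
                 ∀ t → ∃[ c ] Fibre t c
  exists-fibre cubicRoot quadraticRoot t = c , fibre fc₀≈t q≈0 v₂
    where
    c₀ = cubicRoot t .proj₁
    fc₀≈t = cubicRoot t .proj₂
    quad = quadraticRoot (a₁ + c₀ * (a₂ + c₀ * a₃)) (a₂ + c₀ * a₃) a₃ a₃≉0
    c₁ = quad .proj₁
    a₃⁻¹ = invert a₃≉0 .proj₁
    w = a₂ + a₃ * (c₀ + c₁)
    -- The third root is read off from `vieta₂` after a root of `f - t` and a root of the quadratic
    -- `quotient c₀`; this covers multiple roots as well.
    c₂ = - (a₃⁻¹ * w)
    c : Fin 3 → Carrier
    c 0F = c₀
    c 1F = c₁
    c 2F = c₂
    q≈0 : quotient c₀ c₁ ≈ 0#
    q≈0 = trans (+-congˡ (*-congˡ (+-congˡ (*-congˡ (sym (trans (+-congˡ (zeroʳ _)) (+-identityʳ _))))))) (quad .proj₂)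
    v₂ : a₂ ≈ - (a₃ * (c₀ + c₁ + c₂))
    v₂ = x+y≈0⇒x≈-y (begin
      a₂ + a₃ * (c₀ + c₁ + c₂)
        ≈⟨ solve 5 (λ a₂ a₃ c₀ c₁ c₂ → a₂ :+ a₃ :* (c₀ :+ c₁ :+ c₂)
             := (a₂ :+ a₃ :* (c₀ :+ c₁)) :+ a₃ :* c₂) refl a₂ a₃ c₀ c₁ c₂ ⟩
      w + a₃ * - (a₃⁻¹ * w)
        ≈⟨ solve 3 (λ a₃ a₃⁻¹ w → w :+ a₃ :* :- (a₃⁻¹ :* w) := w :- (a₃ :* a₃⁻¹) :* w) refl a₃ a₃⁻¹ w ⟩
      w - (a₃ * a₃⁻¹) * w
        ≈⟨ x≈y⇒x-y≈0 (sym (trans (*-congʳ (invert a₃≉0 .proj₂)) (*-identityˡ w))) ⟩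
      0# ∎)

  -- Up to sign `δ c` squared is the product over the roots of `f′ (c s) / a₃`, and `f′ x` is
  -- `3 a₃ (x - γ₁) (x - γ₂)`. Collecting the six factors by critical point instead of by root gives
  -- `f γ₁ - t` and `f γ₂ - t`.
  fibreDiscriminant : ∀ {γ₁ γ₂} → ¬ γ₁ ≈ γ₂ → f′ γ₁ ≈ 0# → f′ γ₂ ≈ 0# → ∀ {t c} → Fibre t c →
    (a₃ * δ c) * (a₃ * δ c) ≈ - ⟦ + 27 ⟧ℤ * ((f γ₁ - t) * (f γ₂ - t))
  fibreDiscriminant {γ₁} {γ₂} γ₁≉γ₂ f′γ₁≈0 f′γ₂≈0 {t} {c} t-fibre = begin
    (a₃ * δ c) * (a₃ * δ c)
      ≈⟨ solve 4 (λ a₃ c₀ c₁ c₂ →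
           (a₃ :* (((c₀ :- c₁) :* (c₀ :- c₂)) :* (c₁ :- c₂))) :* (a₃ :* (((c₀ :- c₁) :* (c₀ :- c₂)) :* (c₁ :- c₂)))
           := :- (a₃ :* a₃) :* (((c₀ :- c₁) :* (c₀ :- c₂)) :* (((c₁ :- c₀) :* (c₁ :- c₂)) :* ((c₂ :- c₀) :* (c₂ :- c₁)))))
           refl a₃ c₀ c₁ c₂ ⟩
    - (a₃ * a₃) * (((c₀ - c₁) * (c₀ - c₂)) * (((c₁ - c₀) * (c₁ - c₂)) * ((c₂ - c₀) * (c₂ - c₁))))
      ≈⟨ *-congˡ (*-cong (pair c₀ c₁ c₂ refl refl)
           (*-cong (pair c₁ c₀ c₂
                      (solve 3 (λ x y z → y :+ x :+ z := x :+ y :+ z) refl c₀ c₁ c₂)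
                      (solve 3 (λ x y z → y :* x :+ y :* z :+ x :* z := x :* y :+ x :* z :+ y :* z) refl c₀ c₁ c₂))
                   (pair c₂ c₀ c₁
                      (solve 3 (λ x y z → z :+ x :+ y := x :+ y :+ z) refl c₀ c₁ c₂)
                      (solve 3 (λ x y z → z :* x :+ z :* y :+ x :* y := x :* y :+ x :* z :+ y :* z) refl c₀ c₁ c₂)))) ⟩
    - (a₃ * a₃) * (3# * ((c₀ - γ₁) * (c₀ - γ₂)) * (3# * ((c₁ - γ₁) * (c₁ - γ₂)) * (3# * ((c₂ - γ₁) * (c₂ - γ₂)))))
      ≈⟨ solve 6 (λ a₃ c₀ c₁ c₂ γ₁ γ₂ →
           :- (a₃ :* a₃) :* (con (+ 3) :* ((c₀ :- γ₁) :* (c₀ :- γ₂)) :*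
             (con (+ 3) :* ((c₁ :- γ₁) :* (c₁ :- γ₂)) :* (con (+ 3) :* ((c₂ :- γ₁) :* (c₂ :- γ₂)))))
           := :- con (+ 27) :* ((a₃ :* ((γ₁ :- c₀) :* ((γ₁ :- c₁) :* (γ₁ :- c₂)))) :*
                                (a₃ :* ((γ₂ :- c₀) :* ((γ₂ :- c₁) :* (γ₂ :- c₂))))))
           refl a₃ c₀ c₁ c₂ γ₁ γ₂ ⟩
    - ⟦ + 27 ⟧ℤ * ((a₃ * ((γ₁ - c₀) * ((γ₁ - c₁) * (γ₁ - c₂)))) * (a₃ * ((γ₂ - c₀) * ((γ₂ - c₁) * (γ₂ - c₂)))))
      ≈⟨ *-congˡ (*-cong (factor′ γ₁) (factor′ γ₂)) ⟨
    - ⟦ + 27 ⟧ℤ * ((f γ₁ - t) * (f γ₂ - t)) ∎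
    where
    open Fibre t-fibre
    3# = ⟦ + 3 ⟧ℤ
    c₀ = c 0F
    c₁ = c 1F
    c₂ = c 2F
    e₁ = c₀ + c₁ + c₂
    e₂ = c₀ * c₁ + c₀ * c₂ + c₁ * c₂
    factor′ : ∀ x → f x - t ≈ a₃ * ((x - c₀) * ((x - c₁) * (x - c₂)))
    factor′ x = trans (factor x) (*-congˡ (*-congˡ (*-congˡ (*-identityʳ _))))
    sum≈ : (a₂ + a₂) + a₃ * (3# * (γ₁ + γ₂)) ≈ 0#
    sum≈ = x*y≈0⇒y≈0 (λ e → γ₁≉γ₂ (x-y≈0⇒x≈y e)) (begin
      (γ₁ - γ₂) * ((a₂ + a₂) + a₃ * (3# * (γ₁ + γ₂)))
        ≈⟨ solve 5 (λ a₁ a₂ a₃ x y → (x :- y) :* ((a₂ :+ a₂) :+ a₃ :* (con (+ 3) :* (x :+ y)))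
             := (a₁ :+ x :* ((a₂ :+ a₂) :+ x :* (a₃ :+ a₃ :+ a₃))) :- (a₁ :+ y :* ((a₂ :+ a₂) :+ y :* (a₃ :+ a₃ :+ a₃))))
             refl a₁ a₂ a₃ γ₁ γ₂ ⟩
      f′ γ₁ - f′ γ₂
        ≈⟨ x≈y⇒x-y≈0 (trans f′γ₁≈0 (sym f′γ₂≈0)) ⟩
      0# ∎)
    -- The coefficient `a₂` computed once from the roots of `f - t` and once from those of `f′`. The
    -- sum stays doubled, which is how it occurs in `pair`.
    e₁≈ : e₁ + e₁ ≈ 3# * (γ₁ + γ₂)
    e₁≈ = sym (*-cancelˡ a₃≉0 (x-y≈0⇒x≈y (begin
      a₃ * (3# * (γ₁ + γ₂)) - a₃ * (e₁ + e₁)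
        ≈⟨ solve 3 (λ a₃ u e → u :- a₃ :* (e :+ e) := (:- (a₃ :* e) :+ :- (a₃ :* e)) :+ u) refl a₃ _ e₁ ⟩
      (- (a₃ * e₁) + - (a₃ * e₁)) + a₃ * (3# * (γ₁ + γ₂))
        ≈⟨ +-congʳ (+-cong vieta₂ vieta₂) ⟨
      (a₂ + a₂) + a₃ * (3# * (γ₁ + γ₂))
        ≈⟨ sum≈ ⟩
      0# ∎)))
    e₂≈ : e₂ ≈ 3# * (γ₁ * γ₂)
    e₂≈ = *-cancelˡ a₃≉0 (x-y≈0⇒x≈y (begin
      a₃ * e₂ - a₃ * (3# * (γ₁ * γ₂))
        ≈⟨ +-congʳ vieta₁ ⟨
      a₁ - a₃ * (3# * (γ₁ * γ₂))
        ≈⟨ solve 5 (λ a₁ a₂ a₃ x y → a₁ :- a₃ :* (con (+ 3) :* (x :* y))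
             := (a₁ :+ x :* ((a₂ :+ a₂) :+ x :* (a₃ :+ a₃ :+ a₃))) :- x :* ((a₂ :+ a₂) :+ a₃ :* (con (+ 3) :* (x :+ y))))
             refl a₁ a₂ a₃ γ₁ γ₂ ⟩
      f′ γ₁ - γ₁ * ((a₂ + a₂) + a₃ * (3# * (γ₁ + γ₂)))
        ≈⟨ x≈y⇒x-y≈0 (trans f′γ₁≈0 (sym (trans (*-congˡ sum≈) (zeroʳ γ₁)))) ⟩
      0# ∎))
    -- Both sides are `f′ x / a₃`, when `x`, `y`, `z` are the three roots in any order.
    pair : ∀ x y z → x + y + z ≈ e₁ → x * y + x * z + y * z ≈ e₂ →
           (x - y) * (x - z) ≈ 3# * ((x - γ₁) * (x - γ₂))
    pair x y z s₁ s₂ = begin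
      (x - y) * (x - z)
        ≈⟨ solve 3 (λ x y z → (x :- y) :* (x :- z) :=
             con (+ 3) :* (x :* x) :- ((x :+ y :+ z) :+ (x :+ y :+ z)) :* x :+ (x :* y :+ x :* z :+ y :* z)) refl x y z ⟩
      3# * (x * x) - ((x + y + z) + (x + y + z)) * x + (x * y + x * z + y * z)
        ≈⟨ +-cong (+-congˡ (-‿cong (*-congʳ (trans (+-cong s₁ s₁) e₁≈)))) (trans s₂ e₂≈) ⟩
      3# * (x * x) - (3# * (γ₁ + γ₂)) * x + 3# * (γ₁ * γ₂)
        ≈⟨ solve 3 (λ x γ₁ γ₂ → con (+ 3) :* (x :* x) :- (con (+ 3) :* (γ₁ :+ γ₂)) :* x :+ con (+ 3) :* (γ₁ :* γ₂)
             := con (+ 3) :* ((x :- γ₁) :* (x :- γ₂))) refl x γ₁ γ₂ ⟩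
      3# * ((x - γ₁) * (x - γ₂)) ∎

  -- Trees of iterated preimages

  IsTree : Tree → Set ℓ
  IsTree T = ∀ n (w : Word n) → Fibre (T n w) (λ s → T (suc n) (w ∷ʳ s))

  subtree-isTree : ∀ {k T} → IsTree T → (y : Word k) → IsTree (subtree T y)
  subtree-isTree {T = T} tree []      n w = tree n w
  subtree-isTree {T = T} tree (s ∷ y) n w =
    subtree-isTree {T = λ n w → T (suc n) (s ∷ w)} (λ n w → tree (suc n) (s ∷ w)) y n w

  -- The leading coefficient of the `m`-th iterate of `f`.
  leading : ℕ → Carrier
  leading zero    = 1#
  leading (suc m) = a₃ * ∏ {3} (λ _ → leading m)

  -- Splitting off the outermost `f` factors over the three children of the root, and the inner
  -- iterate is then treated in their subtrees.
  iterate-factor : ∀ m {T} → IsTree T → ∀ x →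
                   iterate f x m - T 0 [] ≈ leading m * wordProduct m (λ w → x - T m w)
  iterate-factor zero    {T} tree x = sym (*-identityˡ _)
  iterate-factor (suc m) {T} tree x = begin
    iterate f x (suc m) - T 0 []
      ≡⟨ ≡.cong (_- T 0 []) (iterate-suc f m x) ⟩
    f (iterate f x m) - T 0 []
      ≈⟨ Fibre.factor (tree 0 []) (iterate f x m) ⟩
    a₃ * ∏ (λ s → iterate f x m - T 1 (s ∷ []))
      ≈⟨ *-congˡ (sum-cong-≋ {3} λ s → iterate-factor m (subtree-isTree tree (s ∷ [])) x) ⟩
    a₃ * ∏ (λ s → leading m * wordProduct m (λ w → x - T (suc m) (s ∷ w)))
      ≈⟨ *-congˡ (∑-distrib-+ {3} (λ _ → leading m) (λ s → wordProduct m (λ w → x - T (suc m) (s ∷ w)))) ⟩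
    a₃ * (∏ {3} (λ _ → leading m) * wordProduct (suc m) (λ w → x - T (suc m) w))
      ≈⟨ *-assoc _ _ _ ⟨
    leading (suc m) * wordProduct (suc m) (λ w → x - T (suc m) w) ∎

  -- One `a₃` for each use of `fibreDiscriminant`, and the leading coefficient produced by
  -- `iterate-factor`; multiplying `δʷ` by it replaces divisions.
  scale : ℕ → Carrier
  scale m = leading m * wordProduct m (λ _ → a₃)

  -- The square of δʷ m T is the product of the discriminants of the cubics
  -- f z - T m w; by fibreDiscriminant this telescopes through iterate-factor.
  scaled-δʷ : ∀ {√-3} → √-3 * √-3 ≈ - ⟦ + 3 ⟧ℤ →
    ∀ {γ₁ γ₂} → ¬ γ₁ ≈ γ₂ → f′ γ₁ ≈ 0# → f′ γ₂ ≈ 0# →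
    ∀ m → iterate f γ₁ (suc m) ≈ iterate f γ₂ (suc m) → ∀ {T} → IsTree T →
    let z = wordProduct m (λ _ → √-3 * √-3 * √-3) * (iterate f γ₁ (suc m) - T 0 []) in
    scale m * δʷ m T ≈ z ⊎ scale m * δʷ m T ≈ - z
  scaled-δʷ {√-3} √-3² {γ₁} {γ₂} γ₁≉γ₂ f′γ₁≈0 f′γ₂≈0 m collide {T} tree = x²≈y²⇒x≈±y (begin
    (scale m * δʷ m T) * (scale m * δʷ m T)
      ≈⟨ solve 3 (λ l a e → (l :* a :* e) :* (l :* a :* e) := (l :* l) :* ((a :* e) :* (a :* e))) refl
           (leading m) (wordProduct m λ _ → a₃) (δʷ m T) ⟩
    (leading m * leading m) * ((wordProduct m (λ _ → a₃) * δʷ m T) * (wordProduct m (λ _ → a₃) * δʷ m T))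
      ≈⟨ *-congˡ (*-cong a₃δ a₃δ) ⟨
    (leading m * leading m) * (wordProduct m (λ w → a₃ * δ (children w)) * wordProduct m (λ w → a₃ * δ (children w)))
      ≈⟨ *-congˡ (wordProduct-∙ m _ _) ⟨
    (leading m * leading m) * wordProduct m (λ w → (a₃ * δ (children w)) * (a₃ * δ (children w)))
      ≈⟨ *-congˡ (wordProduct-cong m λ w →
           trans (fibreDiscriminant γ₁≉γ₂ f′γ₁≈0 f′γ₂≈0 (tree m w)) (*-congʳ (sym cube²))) ⟩
    (leading m * leading m) * wordProduct m (λ w → (cube * cube) * ((f γ₁ - T m w) * (f γ₂ - T m w)))
      ≈⟨ *-congˡ (trans (wordProduct-∙ m _ _) (*-cong (wordProduct-∙ m _ _) (wordProduct-∙ m _ _))) ⟩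
    (leading m * leading m) * ((X * X) * (wordProduct m (λ w → f γ₁ - T m w) * wordProduct m (λ w → f γ₂ - T m w)))
      ≈⟨ solve 4 (λ l x u v → (l :* l) :* ((x :* x) :* (u :* v)) := (x :* (l :* u)) :* (x :* (l :* v))) refl
           (leading m) X _ _ ⟩
    (X * (leading m * wordProduct m (λ w → f γ₁ - T m w))) * (X * (leading m * wordProduct m (λ w → f γ₂ - T m w)))
      ≈⟨ *-cong (*-congˡ (iterate-factor m tree (f γ₁))) (*-congˡ (iterate-factor m tree (f γ₂))) ⟨
    (X * (iterate f γ₁ (suc m) - T 0 [])) * (X * (iterate f γ₂ (suc m) - T 0 []))
      -- The collision enters here: the factors belonging to `γ₁` and `γ₂` become equal, so their
      -- product is a square.
      ≈⟨ *-congˡ (*-congˡ (+-congʳ collide)) ⟨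
    (X * (iterate f γ₁ (suc m) - T 0 [])) * (X * (iterate f γ₁ (suc m) - T 0 [])) ∎)
    where
    -- A square root of the constant `-27` in `fibreDiscriminant`.
    cube = √-3 * √-3 * √-3
    X = wordProduct m (λ _ → cube)
    children : Word m → Fin 3 → Carrier
    children w s = T (suc m) (w ∷ʳ s)
    a₃δ : wordProduct m (λ w → a₃ * δ (children w)) ≈ wordProduct m (λ _ → a₃) * δʷ m T
    a₃δ = wordProduct-∙ m (λ _ → a₃) (λ w → δ (children w))
    cube² : cube * cube ≈ - ⟦ + 27 ⟧ℤ
    cube² = begin
      cube * cube
        ≈⟨ solve 1 (λ x → (x :* x :* x) :* (x :* x :* x) := (x :* x) :* (x :* x) :* (x :* x)) refl √-3 ⟩
      (√-3 * √-3) * (√-3 * √-3) * (√-3 * √-3)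
        ≈⟨ *-cong (*-cong √-3² √-3²) √-3² ⟩
      - ⟦ + 3 ⟧ℤ * - ⟦ + 3 ⟧ℤ * - ⟦ + 3 ⟧ℤ
        ≈⟨ solve 0 (:- con (+ 3) :* :- con (+ 3) :* :- con (+ 3) := :- con (+ 27)) refl ⟩
      - ⟦ + 27 ⟧ℤ ∎

  -- The two words have lengths that are not equal by computation. Comparing their values under `T`
  -- avoids transporting either of them.
  ++-∷ʳ-level : ∀ {t} {A : Set t} (T : ∀ n → Word n → A) {k m} (y : Word k) (w : Word m) s →
                T (k +ℕ suc m) (y ++ (w ∷ʳ s)) ≡ T (suc (k +ℕ m)) ((y ++ w) ∷ʳ s)
  ++-∷ʳ-level T []      w s = ≡.refl
  ++-∷ʳ-level T (t ∷ y) w s = ++-∷ʳ-level (λ n w → T (suc n) (t ∷ w)) y w s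

  ++-[]-level : ∀ {t} {A : Set t} (T : ∀ n → Word n → A) {k} (y : Word k) → T (k +ℕ 0) (y ++ []) ≡ T k y
  ++-[]-level T []      = ≡.refl
  ++-[]-level T (t ∷ y) = ++-[]-level (λ n w → T (suc n) (t ∷ w)) y

  Fibre-cong : ∀ {t t′ c d} → t ≈ t′ → (∀ s → c s ≈ d s) → Fibre t c → Fibre t′ d
  Fibre-cong {t} {t′} {c} {d} t≈t′ c≈d fib = record
    { vieta₂ = trans vieta₂ (-‿cong (*-congˡ (+-cong (+-cong (c≈d 0F) (c≈d 1F)) (c≈d 2F))))
    ; vieta₁ = trans vieta₁ (*-congˡ (+-cong (+-cong (*-cong (c≈d 0F) (c≈d 1F)) (*-cong (c≈d 0F) (c≈d 2F)))
                                             (*-cong (c≈d 1F) (c≈d 2F))))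
    ; vieta₀ = trans (+-congˡ (-‿cong (sym t≈t′))) (trans vieta₀
                 (-‿cong (*-congˡ (*-cong (*-cong (c≈d 0F) (c≈d 1F)) (c≈d 2F))))) }
    where open Fibre fib

  swap : Fin 3 → Fin 3
  swap 0F = 1F
  swap 1F = 0F
  swap 2F = 2F

  Fibre-swap : ∀ {t c} → Fibre t c → Fibre t (c ∘ swap)
  Fibre-swap {t} {c} fib = record
    { vieta₂ = trans vieta₂ (-‿cong (*-congˡ (+-congʳ (+-comm _ _))))
    ; vieta₁ = trans vieta₁ (*-congˡ (solve 3 (λ x y z → x :* y :+ x :* z :+ y :* z := y :* x :+ y :* z :+ x :* z)
                                        refl (c 0F) (c 1F) (c 2F)))
    ; vieta₀ = trans vieta₀ (-‿cong (*-congˡ (*-congʳ (*-comm _ _)))) }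
    where open Fibre fib

  tree-iterate : ∀ {T} → IsTree T → ∀ n w → iterate f (T n w) n ≈ T 0 []
  tree-iterate {T} tree zero    [] = refl
  tree-iterate {T} tree (suc n) = ∷ʳ-elim (λ w → iterate f (T (suc n) w) (suc n) ≈ T 0 []) λ u s →
    trans (iterate-cong n (Fibre.child (tree n u) s)) (tree-iterate tree n u)

  tree-covers : ∀ {T} → IsTree T → ∀ n {z} → iterate f z n ≈ T 0 [] → ∃[ w ] T n w ≈ z
  tree-covers     tree zero    e = [] , sym e
  tree-covers {T} tree (suc n) {z} e = below-covers (tree-covers tree n {f z} e)
    where
    below-covers : ∃[ u ] T n u ≈ f z → ∃[ w ] T (suc n) w ≈ z
    below-covers (u , Tu≈fz) = let s , e′ = Fibre.covers (tree n u) (sym Tu≈fz) in u ∷ʳ s , e′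

  tree-injective : ∀ {T} → IsTree T → (∀ n w → ¬ f′ (T (suc n) w) ≈ 0#) → ∀ n u v → T n u ≈ T n v → u ≡ v
  tree-injective {T} tree f′≉0 zero    [] [] e = ≡.refl
  tree-injective {T} tree f′≉0 (suc n) =
    ∷ʳ-elim (λ u → ∀ v → T (suc n) u ≈ T (suc n) v → u ≡ v) λ u s →
    ∷ʳ-elim (λ v → T (suc n) (u ∷ʳ s) ≈ T (suc n) v → u ∷ʳ s ≡ v) λ v t e →
    sameParent u v s t e (tree-injective tree f′≉0 n u v
      (trans (sym (Fibre.child (tree n u) s)) (trans (f-cong e) (Fibre.child (tree n v) t))))
    where
    sameParent : ∀ u v s t → T (suc n) (u ∷ʳ s) ≈ T (suc n) (v ∷ʳ t) → u ≡ v → u ∷ʳ s ≡ v ∷ʳ t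
    sameParent u u s t e ≡.refl =
      ≡.cong (u ∷ʳ_) (Fibre.noncritical⇒injective (tree n u) (λ s → f′≉0 n (u ∷ʳ s)) e)

  -- Every tree satisfies Normal up to the sign of δʷ m; reordering, for each
  -- y, the children of the single node y 0 ⋯ 0 corrects that sign.
  module NormalisedTree {p} (em : ∀ {p} → ExcludedMiddle p)
    (fibres : ∀ t → ∃[ c ] Fibre t c) (m : ℕ)
    (Normal : Carrier → Carrier → Set p)
    (Normal-resp : ∀ {t t′ e e′} → t ≈ t′ → e ≈ e′ → Normal t e → Normal t′ e′)
    (Normal-± : ∀ {T} → IsTree T → Normal (T 0 []) (δʷ m T) ⊎ Normal (T 0 []) (- δʷ m T))
    (root : Carrier) where

    children : Carrier → Fin 3 → Carrier
    children t = fibres t .proj₁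

    reorder : Sign → (Fin 3 → Carrier) → Fin 3 → Carrier
    reorder Sign.+ c = c
    reorder Sign.- c = c ∘ swap

    reorder-fibre : ∀ s {t c} → Fibre t c → Fibre t (reorder s c)
    reorder-fibre Sign.+ fib = fib
    reorder-fibre Sign.- fib = Fibre-swap fib

    δ-reorder : ∀ s c → δ (reorder s c) ≈ s • δ c
    δ-reorder Sign.+ c = refl
    δ-reorder Sign.- c = solve 3 (λ x y z → (y :- x) :* (y :- z) :* (x :- z) := :- ((x :- y) :* (x :- z) :* (y :- z)))
                           refl (c 0F) (c 1F) (c 2F)

    atZeros : Sign → ∀ {m} → Word m → Sign
    atZeros s []          = s
    atZeros s (0F    ∷ w) = atZeros s w
    atZeros s (suc _ ∷ w) = Sign.+

    ∏ʷ-atZeros : ∀ s m → ∏ʷ m (atZeros s) ≡ s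
    ∏ʷ-atZeros s zero    = ≡.refl
    ∏ʷ-atZeros s (suc m) = ≡.trans
      (≡.cong₂ Sign._*_ (∏ʷ-atZeros s m) (≡.cong₂ Sign._*_ (∏ʷ-+ m) (≡.cong (Sign._* Sign.+) (∏ʷ-+ m))))
      (Sign.*-identityʳ s)
      where
      ∏ʷ-+ : ∀ m → ∏ʷ m (λ _ → Sign.+) ≡ Sign.+
      ∏ʷ-+ zero    = ≡.refl
      ∏ʷ-+ (suc m) = ≡.cong₂ Sign._*_ (∏ʷ-+ m) (≡.cong₂ Sign._*_ (∏ʷ-+ m) (≡.cong (Sign._* Sign.+) (∏ʷ-+ m)))

    unsigned : ∀ {k} → (Word (k +ℕ m) → Carrier) → Word k → Carrier
    unsigned level y = wordProduct m λ w → δ (children (level (y ++ w)))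

    -- When the children of level `k + m` are chosen only that level is at hand, so the value at `y`
    -- is recovered by applying `f` `m` times to the descendant `y 0 ⋯ 0`.
    correction : ∀ {k} → (Word (k +ℕ m) → Carrier) → Word k → Sign
    correction level y with em {P = Normal (iterate f (level (y ++ replicate m 0F)) m) (unsigned level y)}
    ... | yes _ = Sign.+
    ... | no  _ = Sign.-

    -- A node `u` of level `k + m` serves to correct its ancestor `take k u` and no other. Nodes of
    -- level less than `m` have no such ancestor; their children keep the given order.
    signAt : ∀ {n} → Dec (∃[ k ] k +ℕ m ≡ n) → (Word n → Carrier) → Word n → Sign
    signAt (no _)             level u = Sign.+
    signAt (yes (k , ≡.refl)) level u = atZeros (correction level (take k u)) (drop k u)

    tree : Tree
    tree zero    _ = root
    tree (suc n) w = reorder (signAt em (tree n) (init w)) (children (tree n (init w))) (last w)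

    tree-∷ʳ : ∀ n (w : Word n) s → tree (suc n) (w ∷ʳ s) ≡ reorder (signAt em (tree n) w) (children (tree n w)) s
    tree-∷ʳ n w s = ≡.cong₂ (λ u t → reorder (signAt em (tree n) u) (children (tree n u)) t)
                            (Vec.init-∷ʳ s w) (Vec.last-∷ʳ s w)

    tree-isTree : IsTree tree
    tree-isTree n w = Fibre-cong refl (λ s → reflexive (≡.sym (tree-∷ʳ n w s)))
      (reorder-fibre (signAt em (tree n) w) (fibres (tree n w) .proj₂))

    signAt-++ : ∀ {k} (d : Dec (∃[ j ] j +ℕ m ≡ k +ℕ m)) (level : Word (k +ℕ m) → Carrier) (y : Word k) w →
                signAt d level (y ++ w) ≡ atZeros (correction level y) w
    signAt-++ {k} (no none)    level y w = contradiction (k , ≡.refl) none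
    signAt-++ {k} (yes (j , e)) level y w with ≡.refl ← ℕ.+-cancelʳ-≡ m j k e with ≡.refl ← e =
      ≡.cong₂ (λ y w → atZeros (correction level y) w) (take-++ y) (drop-++ y)

    δʷ-subtree : ∀ {k} (y : Word k) → δʷ m (subtree tree y) ≈ correction (tree (k +ℕ m)) y • unsigned (tree (k +ℕ m)) y
    δʷ-subtree {k} y = begin
      δʷ m (subtree tree y)
        ≈⟨ wordProduct-cong m (λ w → trans
             (δ-cong (λ s → reflexive (≡.trans (++-∷ʳ-level tree y w s) (tree-∷ʳ (k +ℕ m) (y ++ w) s))))
             (trans (δ-reorder (signAt em (tree (k +ℕ m)) (y ++ w)) (children (tree (k +ℕ m) (y ++ w))))
                    (reflexive (≡.cong (_• δ (children (tree (k +ℕ m) (y ++ w)))) (signAt-++ em (tree (k +ℕ m)) y w))))) ⟩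
      wordProduct m (λ w → atZeros (correction (tree (k +ℕ m)) y) w • δ (children (tree (k +ℕ m) (y ++ w))))
        ≈⟨ ∏ʷ-• m (atZeros (correction (tree (k +ℕ m)) y)) (λ w → δ (children (tree (k +ℕ m) (y ++ w)))) ⟩
      ∏ʷ m (atZeros (correction (tree (k +ℕ m)) y)) • unsigned (tree (k +ℕ m)) y
        ≡⟨ ≡.cong (_• unsigned (tree (k +ℕ m)) y) (∏ʷ-atZeros (correction (tree (k +ℕ m)) y) m) ⟩
      correction (tree (k +ℕ m)) y • unsigned (tree (k +ℕ m)) y ∎

    correction-spec : ∀ {k} (level : Word (k +ℕ m) → Carrier) (y : Word k) →
      let t = iterate f (level (y ++ replicate m 0F)) m in
      Normal t (unsigned level y) × correction level y ≡ Sign.+ ⊎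
      ¬ Normal t (unsigned level y) × correction level y ≡ Sign.-
    correction-spec level y with em {P = Normal (iterate f (level (y ++ replicate m 0F)) m) (unsigned level y)}
    ... | yes normal  = inj₁ (normal , ≡.refl)
    ... | no  ¬normal = inj₂ (¬normal , ≡.refl)

    tree-normal : ∀ {k} (y : Word k) → Normal (tree k y) (δʷ m (subtree tree y))
    tree-normal {k} y = [ alreadyNormal , corrected ]′ (correction-spec (tree (k +ℕ m)) y)
      where
      root≈ : subtree tree y 0 [] ≈ tree k y
      root≈ = reflexive (++-[]-level tree y)
      isSubtree : IsTree (subtree tree y)
      isSubtree = subtree-isTree tree-isTree y
      base≈ : iterate f (tree (k +ℕ m) (y ++ replicate m 0F)) m ≈ subtree tree y 0 []
      base≈ = tree-iterate isSubtree m (replicate m 0F)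
      alreadyNormal : _ → Normal (tree k y) (δʷ m (subtree tree y))
      alreadyNormal (normal , s≡+) = Normal-resp (trans base≈ root≈)
        (sym (trans (δʷ-subtree y) (reflexive (≡.cong (_• unsigned (tree (k +ℕ m)) y) s≡+)))) normal
      corrected : _ → Normal (tree k y) (δʷ m (subtree tree y))
      -- Here `- δʷ` of the corrected subtree is the uncorrected product, so the second alternative
      -- of `Normal-±` is excluded by `¬normal`.
      corrected (¬normal , s≡-) = [ Normal-resp root≈ refl ,
        (λ normal → contradiction (Normal-resp (sym base≈)
          (trans (-‿cong (trans (δʷ-subtree y) (reflexive (≡.cong (_• unsigned (tree (k +ℕ m)) y) s≡-))))
                 (RingProperties.-‿involutive ring _)) normal) ¬normal) ]′ (Normal-± isSubtree)

-- Extension of conjugations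

least : ∀ {p} → ExcludedMiddle p → (P : ℕ → Set p) → ∀ {n} → P n → ∃[ d ] P d × (∀ {e} → e < d → ¬ P e)
least em P {n} = <-rec (λ n → P n → ∃[ d ] P d × (∀ {e} → e < d → ¬ P e)) step n
  where
  step : ∀ n → (∀ {m} → m < n → P m → _) → P n → ∃[ d ] P d × (∀ {e} → e < d → ¬ P e)
  step n rec Pn with em {P = ∃[ m ] m < n × P m}
  ... | yes (m , m<n , Pm) = rec m<n Pm
  ... | no none            = n , Pn , λ {e} e<n Pe → none (e , e<n , Pe)

Pointwise-∷ʳ⁻ : ∀ {a r} {A : Set a} {R : A → A → Set r} {n} (u v : Vec A n) {a b} →
                Pointwise R (u ∷ʳ a) (v ∷ʳ b) → Pointwise R u v × R a b
Pointwise-∷ʳ⁻ []      []      (r ∷ [])  = [] , r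
Pointwise-∷ʳ⁻ (_ ∷ u) (_ ∷ v) (r ∷ rs) = let us , t = Pointwise-∷ʳ⁻ u v rs in r ∷ us , t

module Conjugations {a ℓ₁ b ℓ₂} (K : CommutativeRing a ℓ₁) (L : CommutativeRing b ℓ₂)
  (isFieldK : IsField K) (isFieldL : IsField L)
  (ι : CommutativeRing.Carrier K → CommutativeRing.Carrier L)
  (ι-mono : RingMorphisms.IsRingMonomorphism (CommutativeRing.rawRing K) (CommutativeRing.rawRing L) ι)
  where

  private
    module K = CommutativeRing K
    module KF = Field K isFieldK
    module KPoly = Polynomial K.rawRing
    module LPoly = Polynomial (CommutativeRing.rawRing L)
    module ι = RingMorphisms.IsRingMonomorphism ι-mono
  open CommutativeRing L hiding (zero)
  open Field L isFieldL
  open SignAction L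
  open IntegerCoefficients L
  open WordProduct *-commutativeMonoid
  open MonoidSum *-commutativeMonoid using () renaming (sum to ∏)
  open SetoidReasoning setoid
  open LPoly using (eval)

  -- The graph of a K-isomorphism between two subrings of L containing K.
  record IsConjugation {r} (_∼_ : Carrier → Carrier → Set r) : Set (a ⊔ b ⊔ ℓ₂ ⊔ r) where
    field
      ∼-base : ∀ k → ι k ∼ ι k
      ∼-+    : ∀ {x x′ y y′} → x ∼ x′ → y ∼ y′ → (x + y) ∼ (x′ + y′)
      ∼-*    : ∀ {x x′ y y′} → x ∼ x′ → y ∼ y′ → (x * y) ∼ (x′ * y′)
      ∼-neg  : ∀ {x x′} → x ∼ x′ → (- x) ∼ (- x′)
      ∼-resp : ∀ {x x′ y y′} → x ≈ y → x′ ≈ y′ → x ∼ x′ → y ∼ y′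
      ∼-zero : ∀ {x x′} → x ∼ x′ → x ≈ 0# → x′ ≈ 0#

    ∼-- : ∀ {x x′ y y′} → x ∼ x′ → y ∼ y′ → (x - y) ∼ (x′ - y′)
    ∼-- x∼x′ y∼y′ = ∼-+ x∼x′ (∼-neg y∼y′)

    ∼-0 : 0# ∼ 0#
    ∼-0 = ∼-resp ι.0#-homo ι.0#-homo (∼-base K.0#)

    ∼-1 : 1# ∼ 1#
    ∼-1 = ∼-resp ι.1#-homo ι.1#-homo (∼-base K.1#)

    -- Subtraction reduces single-valuedness to `∼-zero`. Injectivity is no part of the record: it
    -- follows from algebraicity by `∼-zero⁻¹`.
    ∼-unique : ∀ {x x′ y y′} → x ∼ x′ → y ∼ y′ → x ≈ y → x′ ≈ y′
    ∼-unique x∼x′ y∼y′ x≈y = x-y≈0⇒x≈y (∼-zero (∼-- x∼x′ y∼y′) (x≈y⇒x-y≈0 x≈y))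

    ∼-• : ∀ s {x x′} → x ∼ x′ → (s • x) ∼ (s • x′)
    ∼-• Sign.+ x∼x′ = x∼x′
    ∼-• Sign.- x∼x′ = ∼-neg x∼x′

    ∼-∏ : ∀ {n} {g h : Fin n → Carrier} → (∀ i → g i ∼ h i) → ∏ g ∼ ∏ h
    ∼-∏ {zero}  g∼h = ∼-1
    ∼-∏ {suc n} g∼h = ∼-* (g∼h zero) (∼-∏ (λ i → g∼h (suc i)))

    ∼-wordProduct : ∀ m {g h : Word m → Carrier} → (∀ w → g w ∼ h w) → wordProduct m g ∼ wordProduct m h
    ∼-wordProduct zero    g∼h = g∼h []
    ∼-wordProduct (suc m) g∼h = ∼-∏ λ s → ∼-wordProduct m λ w → g∼h (s ∷ w)

    ∼-δ : ∀ {g h : Fin 3 → Carrier} → (∀ s → g s ∼ h s) → δ g ∼ δ h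
    ∼-δ g∼h = ∼-* (∼-* (∼-- (g∼h 0F) (g∼h 1F)) (∼-- (g∼h 0F) (g∼h 2F))) (∼-- (g∼h 1F) (g∼h 2F))

    -- Two effects of `τ` are separated: its action on the children of one node contributes a sign
    -- through `δ-rearrange`, while its action on the nodes themselves only reorders the factors.
    ∼-δʷ : ∀ m τ {T U : Tree} → (∀ n w → T n w ∼ U n (TreeMap.on τ w)) →
           δʷ m T ∼ (∏ʷ m (letterSign τ) • δʷ m U)
    ∼-δʷ m τ {T} {U} T∼U = ∼-resp refl (begin
      wordProduct m (λ w → letterSign τ w • δ (children (TreeMap.on τ w)))
        ≈⟨ ∏ʷ-• m (letterSign τ) (λ w → δ (children (TreeMap.on τ w))) ⟩
      ∏ʷ m (letterSign τ) • wordProduct m (λ w → δ (children (TreeMap.on τ w)))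
        ≈⟨ •-congˡ (∏ʷ m (letterSign τ)) (wordProduct-on m τ (λ w → δ (children w))) ⟩
      ∏ʷ m (letterSign τ) • δʷ m U ∎)
      (∼-wordProduct m λ w → ∼-resp refl (δ-rearrange (TreeMap.onLetter-injective (below τ w)) (children (TreeMap.on τ w)))
        (∼-δ λ s → ∼-resp refl (reflexive (≡.cong (U (suc m)) (on-∷ʳ τ w s))) (T∼U (suc m) (w ∷ʳ s))))
      where
      children : Word m → Fin 3 → Carrier
      children w s = U (suc m) (w ∷ʳ s)

    ∼-eval : ∀ {n} (p : KPoly.Poly n) {x x′} → x ∼ x′ → eval (map ι p) x ∼ eval (map ι p) x′
    ∼-eval []      x∼x′ = ∼-0
    ∼-eval (k ∷ p) x∼x′ = ∼-+ (∼-base k) (∼-* x∼x′ (∼-eval p x∼x′))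

  record Conjugation r : Set (a ⊔ b ⊔ ℓ₂ ⊔ Level.suc r) where
    infix 4 _∼_
    field
      _∼_           : Carrier → Carrier → Set r
      isConjugation : IsConjugation _∼_
    open IsConjugation isConjugation public

  eval-cong : ∀ {n} (p : Vec Carrier n) {x y} → x ≈ y → eval p x ≈ eval p y
  eval-cong []      x≈y = refl
  eval-cong (_ ∷ p) x≈y = +-congˡ (*-cong x≈y (eval-cong p x≈y))

  module _ (algebraic : ∀ x → ∃[ n ] Σ (KPoly.Poly (suc n)) λ p →
                        KPoly.HasDegree n p × eval (map ι p) x ≈ 0#) where

    ι≈0 : ∀ {k} → ι k ≈ 0# → k K.≈ K.0#
    ι≈0 e = ι.injective (trans e (sym ι.0#-homo))

    -- As `x` is nonzero it can be divided out while the constant term vanishes; the nonzero leading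
    -- coefficient stops this at the latest.
    nonzeroConstantTerm : ∀ {x} → ¬ x ≈ 0# →
      ∃[ k ] ∃[ n ] Σ (KPoly.Poly n) λ q → ¬ k K.≈ K.0# × ι k + x * eval (map ι q) x ≈ 0#
    nonzeroConstantTerm {x} x≉0 = let n , p , degree , root = algebraic x in go n p degree root
      where
      go : ∀ n (p : KPoly.Poly (suc n)) → KPoly.HasDegree n p → eval (map ι p) x ≈ 0# → _
      go zero    (k ∷ []) k≉0    root = k , 0 , [] , k≉0 , root
      go (suc n) (k ∷ p)  degree root with k KF.≟ K.0#
      ... | no k≉0  = k , suc n , p , k≉0 , root
      ... | yes k≈0 = go n p degree (x*y≈0⇒y≈0 x≉0 (begin
        x * eval (map ι p) x        ≈⟨ +-identityˡ _ ⟨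
        0# + x * eval (map ι p) x   ≈⟨ +-congʳ (trans (ι.⟦⟧-cong k≈0) ι.0#-homo) ⟨
        ι k + x * eval (map ι p) x  ≈⟨ root ⟩
        0#                          ∎))

    module _ {r} (C : Conjugation r) where
      open Conjugation C

      -- If x ≉ 0, then x is a root of a polynomial over K whose constant term is
      -- not 0, and x′ would be another.
      ∼-zero⁻¹ : ∀ {x x′} → x ∼ x′ → x′ ≈ 0# → x ≈ 0#
      ∼-zero⁻¹ {x} {x′} x∼x′ x′≈0 with x ≟ 0#
      ... | yes x≈0 = x≈0
      ... | no  x≉0 = let k , n , q , k≉0 , root = nonzeroConstantTerm x≉0 in
        contradiction (ι≈0 (begin
          ι k                             ≈⟨ +-identityʳ _ ⟨
          ι k + 0#                        ≈⟨ +-congˡ (trans (*-congʳ x′≈0) (zeroˡ _)) ⟨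
          ι k + x′ * eval (map ι q) x′    ≈⟨ ∼-zero (∼-eval (k ∷ q) x∼x′) root ⟩
          0#                              ∎)) k≉0

      -- From `k + x q(x) = 0` the inverse of `x` is `- k⁻¹ q(x)`, a polynomial in `x` over K. Hence
      -- the domain of a conjugation is closed under inverses without forming fractions.
      ∼-recip : ∀ {x x′ z} → x ∼ x′ → x * z ≈ 1# → ∃[ z′ ] z ∼ z′
      ∼-recip {x} {x′} {z} x∼x′ xz≈1 =
        let k , n , q , k≉0 , root = nonzeroConstantTerm x≉0
            k⁻¹ , kk⁻¹≈1 = KF.invert k≉0
        in - (ι k⁻¹ * eval (map ι q) x′) ,
           ∼-resp (sym (z≈ k k⁻¹ (eval (map ι q) x) kk⁻¹≈1 root)) refl
             (∼-neg (∼-* (∼-base k⁻¹) (∼-eval q x∼x′)))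
        where
        x≉0 : ¬ x ≈ 0#
        x≉0 x≈0 = 1≉0 (trans (sym xz≈1) (trans (*-congʳ x≈0) (zeroˡ z)))
        z≈ : ∀ k k⁻¹ y → k K.* k⁻¹ K.≈ K.1# → ι k + x * y ≈ 0# → z ≈ - (ι k⁻¹ * y)
        z≈ k k⁻¹ y kk⁻¹≈1 root = x-y≈0⇒x≈y (begin
          z - - (ι k⁻¹ * y)
            ≈⟨ solve 3 (λ z k⁻¹ y → z :- :- (k⁻¹ :* y) := z :+ k⁻¹ :* y) refl z (ι k⁻¹) y ⟩
          z + ι k⁻¹ * y
            ≈⟨ +-cong (trans (*-congʳ ιkk⁻¹≈1) (*-identityˡ z)) (*-congˡ (trans (*-congʳ xz≈1) (*-identityˡ y))) ⟨
          (ι k * ι k⁻¹) * z + ι k⁻¹ * ((x * z) * y)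
            ≈⟨ solve 5 (λ k k⁻¹ x y z → (k :* k⁻¹) :* z :+ k⁻¹ :* ((x :* z) :* y) := (k⁻¹ :* z) :* (k :+ x :* y))
                 refl (ι k) (ι k⁻¹) x y z ⟩
          (ι k⁻¹ * z) * (ι k + x * y)
            ≈⟨ trans (*-congˡ root) (zeroʳ _) ⟩
          0# ∎)
          where
          ιkk⁻¹≈1 : ι k * ι k⁻¹ ≈ 1#
          ιkk⁻¹≈1 = trans (sym (ι.*-homo k k⁻¹)) (trans (ι.⟦⟧-cong kk⁻¹≈1) ι.1#-homo)

      converse : Conjugation r
      converse = record
        { _∼_ = λ x y → y ∼ x
        ; isConjugation = record
          { ∼-base = ∼-base ; ∼-+ = ∼-+ ; ∼-* = ∼-* ; ∼-neg = ∼-neg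
          ; ∼-resp = λ e e′ → ∼-resp e′ e ; ∼-zero = ∼-zero⁻¹ } }

    -- Adjoining an algebraic element to a conjugation

    open SemiringExp semiring using (_^_)

    eval-∷ʳ : ∀ {n} (u : Vec Carrier n) t x → eval (u ∷ʳ t) x ≈ eval u x + t * x ^ n
    eval-∷ʳ []      t x = trans
      (solve 2 (λ t x → t :+ x :* con (+ 0) := con (+ 0) :+ t :* con (+ 1)) refl t x)
      (+-congˡ (*-congˡ (+-identityʳ 1#)))
    eval-∷ʳ {suc n} (s ∷ u) t x = begin
      s + x * eval (u ∷ʳ t) x
        ≈⟨ +-congˡ (*-congˡ (eval-∷ʳ u t x)) ⟩
      s + x * (eval u x + t * x ^ n)
        ≈⟨ solve 5 (λ s x e t y → s :+ x :* (e :+ t :* y) := (s :+ x :* e) :+ t :* (x :* y)) refl s x _ t _ ⟩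
      (s + x * eval u x) + t * (x * x ^ n) ∎

    eval-combine : ∀ {n} p q (u v : Vec Carrier n) x →
                   eval (zipWith (λ s t → p * s - q * t) u v) x ≈ p * eval u x - q * eval v x
    eval-combine p q []      []      x = solve 2 (λ p q → con (+ 0) := p :* con (+ 0) :- q :* con (+ 0)) refl p q
    eval-combine p q (s ∷ u) (t ∷ v) x = begin
      (p * s - q * t) + x * eval (zipWith (λ s t → p * s - q * t) u v) x
        ≈⟨ +-congˡ (*-congˡ (eval-combine p q u v x)) ⟩
      (p * s - q * t) + x * (p * eval u x - q * eval v x)
        ≈⟨ solve 7 (λ p q s t x y z → (p :* s :- q :* t) :+ x :* (p :* y :- q :* z)
             := p :* (s :+ x :* y) :- q :* (t :+ x :* z)) refl p q s t x _ _ ⟩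
      p * (s + x * eval u x) - q * (t + x * eval v x) ∎

    eval-zero : ∀ n x → eval (replicate n 0#) x ≈ 0#
    eval-zero zero    x = refl
    eval-zero (suc n) x = trans (+-identityˡ _) (trans (*-congˡ (eval-zero n x)) (zeroʳ x))

    module _ (algebraicallyClosed : ∀ n (p : LPoly.Poly (suc (suc n))) → LPoly.HasDegree (suc n) p →
                                    ∃[ x ] eval p x ≈ 0#) where

      record _⊑_ {r} (C D : Conjugation r) : Set (b ⊔ r) where
        constructor mk⊑
        field
          include : ∀ {x y} → Conjugation._∼_ C x y → Conjugation._∼_ D x y
      open _⊑_ public

      -- The leading coefficient `s` is kept apart and not normalised to 1; division by it is
      -- replaced by the pseudo-division in `reduce`.
      Annihilated : ∀ {r} → Conjugation r → Carrier → ℕ → Set _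
      Annihilated C α d = Σ (Vec Carrier d) λ u → Σ (Vec Carrier d) λ v → ∃[ s ] ∃[ t ]
        Pointwise _∼_ u v × s ∼ t × ¬ s ≈ 0# × eval u α + s * α ^ d ≈ 0#
        where open Conjugation C

      -- A polynomial (u₀ , s₀) of least degree d over the domain of C that
      -- vanishes at α, and a root β of its conjugate (v₀ , t₀).
      record MinimalPolynomial {r} (C : Conjugation r) (α : Carrier) : Set (b ⊔ ℓ₂ ⊔ r) where
        open Conjugation C
        field
          d       : ℕ
          u₀ v₀   : Vec Carrier d
          s₀ t₀   : Carrier
          u₀∼v₀   : Pointwise _∼_ u₀ v₀
          s₀∼t₀   : s₀ ∼ t₀
          s₀≉0    : ¬ s₀ ≈ 0#
          root₀   : eval u₀ α + s₀ * α ^ d ≈ 0#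
          d-least : ∀ {e} → e < d → ¬ Annihilated C α e
          β       : Carrier
          root₀′  : eval v₀ β + t₀ * β ^ d ≈ 0#

      minimalPolynomial : ∀ {r} → ExcludedMiddle (b ⊔ ℓ₂ ⊔ r) → (C : Conjugation r) → ∀ α → MinimalPolynomial C α
      minimalPolynomial em C α = conjugate (least em (Annihilated C α) (annihilated .proj₂))
        where
        open Conjugation C
        annihilated : ∃[ d ] Annihilated C α d
        annihilated with n , p , degree , root ← algebraic α with q , k , ≡.refl ← initLast p =
          n , map ι q , map ι q , ι k , ι k , ∼-map q , ∼-base k , (λ e → degree (ι≈0 e)) ,
          trans (sym (eval-∷ʳ (map ι q) (ι k) α))
            (trans (reflexive (≡.cong (λ v → eval v α) (≡.sym (Vec.map-∷ʳ ι k q)))) root)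
          where
          ∼-map : ∀ {n} (q : KPoly.Poly n) → Pointwise _∼_ (map ι q) (map ι q)
          ∼-map []      = []
          ∼-map (k ∷ q) = ∼-base k ∷ ∼-map q
        conjugateRoot : ∀ n (u v : Vec Carrier n) s t → ¬ s ≈ 0# → ¬ t ≈ 0# →
                        eval u α + s * α ^ n ≈ 0# → ∃[ β ] eval v β + t * β ^ n ≈ 0#
        conjugateRoot zero    [] v s t s≉0 t≉0 e = contradiction
          (trans (sym (trans (+-identityˡ _) (*-identityʳ s))) e) s≉0
        conjugateRoot (suc n) u  v s t s≉0 t≉0 e =
          let β , root = algebraicallyClosed n (v ∷ʳ t)
                           (λ e → t≉0 (trans (reflexive (≡.sym (Vec.last-∷ʳ t v))) e))
          in β , trans (sym (eval-∷ʳ v t β)) root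
        conjugate : ∃[ d ] Annihilated C α d × (∀ {e} → e < d → ¬ Annihilated C α e) → MinimalPolynomial C α
        conjugate (d , (u₀ , v₀ , s₀ , t₀ , u₀∼v₀ , s₀∼t₀ , s₀≉0 , root₀) , d-least) =
          let β , root₀′ = conjugateRoot d u₀ v₀ s₀ t₀ s₀≉0 (λ e → s₀≉0 (∼-zero⁻¹ C s₀∼t₀ e)) root₀ in record
          { d = d ; u₀ = u₀ ; v₀ = v₀ ; s₀ = s₀ ; t₀ = t₀ ; u₀∼v₀ = u₀∼v₀ ; s₀∼t₀ = s₀∼t₀
          ; s₀≉0 = s₀≉0 ; root₀ = root₀ ; d-least = d-least ; β = β ; root₀′ = root₀′ }

      module Extend {r} (C : Conjugation (b ⊔ ℓ₂ ⊔ r)) (α : Carrier) (minimal : MinimalPolynomial C α) where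
        open Conjugation C
        open MinimalPolynomial minimal

        -- At most `d` coefficients mean degree less than `d`, so minimality makes the top
        -- coefficient zero. Its conjugate is then zero too, and the shorter polynomial is treated
        -- in the same way.
        vanish : ∀ n → n ≤ d → (u v : Vec Carrier n) → Pointwise _∼_ u v → eval u α ≈ 0# → eval v β ≈ 0#
        vanish zero    _   []  []  _   _ = refl
        vanish (suc n) n<d u′ v′ u∼v e
          with u , s , ≡.refl ← initLast u′ | v , t , ≡.refl ← initLast v′ = result
          where
          us = Pointwise-∷ʳ⁻ u v u∼v
          result : eval (v ∷ʳ t) β ≈ 0#
          result with s ≟ 0#
          ... | no s≉0 = contradiction
            (u , v , s , t , us .proj₁ , us .proj₂ , s≉0 , trans (sym (eval-∷ʳ u s α)) e) (d-least n<d)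
          ... | yes s≈0 = begin
            eval (v ∷ʳ t) β            ≈⟨ eval-∷ʳ v t β ⟩
            eval v β + t * β ^ n       ≈⟨ +-cong (vanish n (ℕ.<⇒≤ n<d) u v (us .proj₁) u≈0)
                                            (trans (*-congʳ (∼-zero (us .proj₂) s≈0)) (zeroˡ _)) ⟩
            0# + 0#                    ≈⟨ +-identityˡ 0# ⟩
            0#                         ∎
            where
            u≈0 : eval u α ≈ 0#
            u≈0 = begin
              eval u α                 ≈⟨ trans (+-congˡ (trans (*-congʳ s≈0) (zeroˡ _))) (+-identityʳ _) ⟨
              eval u α + s * α ^ n     ≈⟨ eval-∷ʳ u s α ⟨
              eval (u ∷ʳ s) α          ≈⟨ e ⟩
              0#                       ∎

        reduceTop : ∀ {n} {c u : Vec Carrier n} {s t x} → eval u x + s * x ^ n ≈ 0# →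
                    s * eval (c ∷ʳ t) x ≈ eval (zipWith (λ y z → s * y - t * z) c u) x
        reduceTop {n} {c} {u} {s} {t} {x} e = begin
          s * eval (c ∷ʳ t) x
            ≈⟨ *-congˡ (eval-∷ʳ c t x) ⟩
          s * (eval c x + t * x ^ n)
            ≈⟨ solve 5 (λ s c t p u → s :* (c :+ t :* p) := (s :* c :- t :* u) :+ t :* (u :+ s :* p)) refl s _ t _ (eval u x) ⟩
          (s * eval c x - t * eval u x) + t * (eval u x + s * x ^ n)
            ≈⟨ trans (+-congˡ (trans (*-congˡ e) (zeroʳ t))) (+-identityʳ _) ⟩
          s * eval c x - t * eval u x
            ≈⟨ eval-combine s t c u x ⟨
          eval (zipWith (λ y z → s * y - t * z) c u) x ∎

        -- Pseudo-division by the minimal polynomial, performed in parallel on `u` at `α` and on its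
        -- conjugate `v` at `β`. The multipliers `k` and `l` are products of copies of `s₀` and
        -- `t₀`. Following Horner, the remainder of the tail is multiplied by the point, which
        -- yields `d + 1` coefficients, and the top one is eliminated.
        reduce : ∀ {n} (u v : Vec Carrier n) → Pointwise _∼_ u v →
          ∃[ k ] ∃[ l ] k ∼ l × ¬ k ≈ 0# ×
          Σ (Vec Carrier d) λ u′ → Σ (Vec Carrier d) λ v′ → Pointwise _∼_ u′ v′ ×
          k * eval u α ≈ eval u′ α × l * eval v β ≈ eval v′ β
        reduce [] [] [] = 1# , 1# , ∼-1 , 1≉0 , replicate d 0# , replicate d 0# , zeros d ,
          trans (zeroʳ 1#) (sym (eval-zero d α)) , trans (zeroʳ 1#) (sym (eval-zero d β))
          where
          zeros : ∀ n → Pointwise _∼_ (replicate n 0#) (replicate n 0#)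
          zeros zero    = []
          zeros (suc n) = ∼-0 ∷ zeros n
        reduce (s ∷ u) (t ∷ v) (s∼t ∷ u∼v)
          with k , l , k∼l , k≉0 , u′ , v′ , u′∼v′ , eᵤ , eᵥ ← reduce u v u∼v =
          s₀ * k , t₀ * l , ∼-* s₀∼t₀ k∼l , x*y≉0 s₀≉0 k≉0 , _ , _ ,
          combine-∼ (Pointwise-∷ʳ⁻ _ _ tops .proj₁) u₀∼v₀ (Pointwise-∷ʳ⁻ _ _ tops .proj₂) ,
          side u (k * s ∷ u′) eᵤ root₀ ≡.refl , side v (l * t ∷ v′) eᵥ root₀′ ≡.refl
          where
          tops : Pointwise _∼_ (init (k * s ∷ u′) ∷ʳ last (k * s ∷ u′)) (init (l * t ∷ v′) ∷ʳ last (l * t ∷ v′))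
          tops = ≡.subst₂ (Pointwise _∼_) (proj₂ (proj₂ (initLast (k * s ∷ u′)))) (proj₂ (proj₂ (initLast (l * t ∷ v′))))
                   (∼-* k∼l s∼t ∷ u′∼v′)
          combine-∼ : ∀ {n} {c c′ w w′ : Vec Carrier n} {y y′} → Pointwise _∼_ c c′ → Pointwise _∼_ w w′ → y ∼ y′ →
                    Pointwise _∼_ (zipWith (λ p q → s₀ * p - y * q) c w) (zipWith (λ p q → t₀ * p - y′ * q) c′ w′)
          combine-∼ []       []       y∼y′ = []
          combine-∼ (p ∷ ps) (q ∷ qs) y∼y′ = ∼-- (∼-* s₀∼t₀ p) (∼-* y∼y′ q) ∷ combine-∼ ps qs y∼y′
          side : ∀ {n} (w : Vec Carrier n) {s₀ k s x} {v w₀ : Vec Carrier d} (c : Vec Carrier (suc d)) →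
                 k * eval w x ≈ eval v x → eval w₀ x + s₀ * x ^ d ≈ 0# →
                 c ≡ k * s ∷ v →
                 (s₀ * k) * (s + x * eval w x) ≈ eval (zipWith (λ p q → s₀ * p - last c * q) (init c) w₀) x
          side w {s₀} {k} {s} {x} {v} {w₀} c e root c≡ = begin
            (s₀ * k) * (s + x * eval w x)
              ≈⟨ solve 5 (λ s₀ k s x e → (s₀ :* k) :* (s :+ x :* e) := s₀ :* (k :* s :+ x :* (k :* e))) refl s₀ k s x _ ⟩
            s₀ * (k * s + x * (k * eval w x))
              ≈⟨ *-congˡ (+-congˡ (*-congˡ e)) ⟩
            s₀ * eval (k * s ∷ v) x
              ≡⟨ ≡.cong (λ c → s₀ * eval c x) (≡.trans (≡.sym c≡) (proj₂ (proj₂ (initLast c)))) ⟩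
            s₀ * eval (init c ∷ʳ last c) x
              ≈⟨ reduceTop {c = init c} root ⟩
            eval (zipWith (λ p q → s₀ * p - last c * q) (init c) w₀) x ∎

        infix 4 _≃_
        _≃_ : Carrier → Carrier → Set (b ⊔ ℓ₂ ⊔ r)
        x ≃ y = ∃[ n ] Σ (Vec Carrier n) λ u → Σ (Vec Carrier n) λ v →
                Pointwise _∼_ u v × eval u α ≈ x × eval v β ≈ y

        ≃-resp : ∀ {x x′ y y′} → x ≈ y → x′ ≈ y′ → x ≃ x′ → y ≃ y′
        ≃-resp e e′ (n , u , v , u∼v , eᵤ , eᵥ) = n , u , v , u∼v , trans eᵤ e , trans eᵥ e′

        ≃-zero : ∀ {x y} → x ≃ y → x ≈ 0# → y ≈ 0#
        ≃-zero {x} {y} (n , u , v , u∼v , eᵤ , eᵥ) x≈0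
          with k , l , k∼l , k≉0 , u′ , v′ , u′∼v′ , eᵤ′ , eᵥ′ ← reduce u v u∼v =
          trans (sym eᵥ) (x*y≈0⇒y≈0 (λ l≈0 → k≉0 (∼-zero⁻¹ C k∼l l≈0))
            (trans eᵥ′ (vanish d ℕ.≤-refl u′ v′ u′∼v′
              (trans (sym eᵤ′) (trans (*-congˡ (trans eᵤ x≈0)) (zeroʳ k))))))

        ≃-0 : 0# ≃ 0#
        ≃-0 = 0 , [] , [] , [] , refl , refl

        ≃-∷ : ∀ {s t x y} → s ∼ t → x ≃ y → (s + α * x) ≃ (t + β * y)
        ≃-∷ {s} {t} s∼t (n , u , v , u∼v , eᵤ , eᵥ) =
          suc n , s ∷ u , t ∷ v , s∼t ∷ u∼v , +-congˡ (*-congˡ eᵤ) , +-congˡ (*-congˡ eᵥ)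

        ∼⇒≃ : ∀ {x y} → x ∼ y → x ≃ y
        ∼⇒≃ x∼y = ≃-resp x+y*0≈x x+y*0≈x (≃-∷ x∼y ≃-0)
          where
          x+y*0≈x : ∀ {x y} → x + y * 0# ≈ x
          x+y*0≈x = trans (+-congˡ (zeroʳ _)) (+-identityʳ _)

        α≃β : α ≃ β
        α≃β = ≃-resp 0+x*1≈x 0+x*1≈x (≃-∷ ∼-0 (∼⇒≃ ∼-1))
          where
          0+x*1≈x : ∀ {x} → 0# + x * 1# ≈ x
          0+x*1≈x = trans (+-identityˡ _) (*-identityʳ _)

        ≃-scale : ∀ {s t x y} → s ∼ t → x ≃ y → (s * x) ≃ (t * y)
        ≃-scale s∼t (_ , u , v , u∼v , eᵤ , eᵥ) = ≃-resp (*-congˡ eᵤ) (*-congˡ eᵥ) (go s∼t u v u∼v)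
          where
          go : ∀ {n s t} → s ∼ t → (u v : Vec Carrier n) → Pointwise _∼_ u v → (s * eval u α) ≃ (t * eval v β)
          go {s = s} {t} s∼t []      []      []          = ≃-resp (sym (zeroʳ s)) (sym (zeroʳ t)) ≃-0
          go {s = s} {t} s∼t (x ∷ u) (y ∷ v) (x∼y ∷ u∼v) = ≃-resp (expand s x α (eval u α)) (expand t y β (eval v β))
            (≃-∷ (∼-* s∼t x∼y) (go s∼t u v u∼v))
            where
            expand : ∀ s x α z → s * x + α * (s * z) ≈ s * (x + α * z)
            expand = solve 4 (λ s x α z → s :* x :+ α :* (s :* z) := s :* (x :+ α :* z)) refl

        ≃-+ : ∀ {x x′ y y′} → x ≃ x′ → y ≃ y′ → (x + y) ≃ (x′ + y′)
        ≃-+ (_ , u , u′ , us , e , e′) (_ , v , v′ , vs , g , g′) = ≃-resp (+-cong e g) (+-cong e′ g′) (go us vs)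
          where
          expand : ∀ s t α x y → (s + t) + α * (x + y) ≈ (s + α * x) + (t + α * y)
          expand = solve 5 (λ s t α x y → (s :+ t) :+ α :* (x :+ y) := (s :+ α :* x) :+ (t :+ α :* y)) refl
          go : ∀ {m n} {u u′ : Vec Carrier m} {v v′ : Vec Carrier n} → Pointwise _∼_ u u′ → Pointwise _∼_ v v′ →
               (eval u α + eval v α) ≃ (eval u′ β + eval v′ β)
          go []       vs       = ≃-resp (sym (+-identityˡ _)) (sym (+-identityˡ _)) (_ , _ , _ , vs , refl , refl)
          go (s ∷ us) []       = ≃-resp (sym (+-identityʳ _)) (sym (+-identityʳ _)) (_ , _ , _ , s ∷ us , refl , refl)
          go (s ∷ us) (t ∷ vs) = ≃-resp (expand _ _ _ _ _) (expand _ _ _ _ _) (≃-∷ (∼-+ s t) (go us vs))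

        ≃-* : ∀ {x x′ y y′} → x ≃ x′ → y ≃ y′ → (x * y) ≃ (x′ * y′)
        ≃-* {y = y} {y′} (_ , u , u′ , us , e , e′) y≃y′ = ≃-resp (*-congʳ e) (*-congʳ e′) (go us)
          where
          expand : ∀ s α x y → s * y + (0# + α * (x * y)) ≈ (s + α * x) * y
          expand = solve 4 (λ s α x y → s :* y :+ (con (+ 0) :+ α :* (x :* y)) := (s :+ α :* x) :* y) refl
          go : ∀ {n} {u u′ : Vec Carrier n} → Pointwise _∼_ u u′ → (eval u α * y) ≃ (eval u′ β * y′)
          go []       = ≃-resp (sym (zeroˡ y)) (sym (zeroˡ y′)) ≃-0
          go (s ∷ us) = ≃-resp (expand _ _ _ _) (expand _ _ _ _) (≃-+ (≃-scale s y≃y′) (≃-∷ ∼-0 (go us)))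

        ≃-neg : ∀ {x x′} → x ≃ x′ → (- x) ≃ (- x′)
        ≃-neg x≃x′ = ≃-resp (RingProperties.-1*x≈-x ring _) (RingProperties.-1*x≈-x ring _) (≃-scale (∼-neg ∼-1) x≃x′)

        extension : Conjugation (b ⊔ ℓ₂ ⊔ r)
        extension = record
          { _∼_ = _≃_
          ; isConjugation = record
            { ∼-base = λ k → ∼⇒≃ (∼-base k) ; ∼-+ = ≃-+ ; ∼-* = ≃-* ; ∼-neg = ≃-neg
            ; ∼-resp = ≃-resp ; ∼-zero = ≃-zero } }

      module _ {r} (em : ExcludedMiddle (b ⊔ ℓ₂ ⊔ r)) where

        Conj : Set _
        Conj = Conjugation (b ⊔ ℓ₂ ⊔ r)

        InDomainAndRange : Conj → Carrier → Set (b ⊔ ℓ₂ ⊔ r)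
        InDomainAndRange C x = ∃[ y ] ∃[ z ] Conjugation._∼_ C x y × Conjugation._∼_ C z x

        -- `Extend` brings `α` into the domain only. A second extension, of the converse, brings it
        -- into the range, which surjectivity of the resulting automorphism will need.
        extend : ∀ (C : Conj) α → ∃[ D ] C ⊑ D × InDomainAndRange D α
        extend C α = converse F.extension ,
          mk⊑ (λ x∼y → F.∼⇒≃ (E.∼⇒≃ x∼y)) , _ , _ , F.∼⇒≃ E.α≃β , F.α≃β
          where
          module E = Extend {r} C α (minimalPolynomial em C α)
          module F = Extend {r} (converse E.extension) α (minimalPolynomial em (converse E.extension) α)

        extendWords : ∀ n (h : Word n → Carrier) (C : Conj) → ∃[ D ] C ⊑ D × (∀ w → InDomainAndRange D (h w))
        extendWords zero h C =
          let D , C⊑D , h[] = extend C (h []) in D , C⊑D , λ { [] → h[] }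
        extendWords (suc n) h C =
          let D₀ , C⊑D₀  , h₀ = extendWords n (λ w → h (0F ∷ w)) C
              D₁ , D₀⊑D₁ , h₁ = extendWords n (λ w → h (1F ∷ w)) D₀
              D₂ , D₁⊑D₂ , h₂ = extendWords n (λ w → h (2F ∷ w)) D₁
          in D₂ , mk⊑ (λ x∼y → include D₁⊑D₂ (include D₀⊑D₁ (include C⊑D₀ x∼y))) ,
             λ { (0F ∷ w) → let y , z , x∼y , z∼x = h₀ w in
                            y , z , include D₁⊑D₂ (include D₀⊑D₁ x∼y) , include D₁⊑D₂ (include D₀⊑D₁ z∼x)
               ; (1F ∷ w) → let y , z , x∼y , z∼x = h₁ w in y , z , include D₁⊑D₂ x∼y , include D₁⊑D₂ z∼x
               ; (2F ∷ w) → h₂ w }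

        -- Each stage adjoins one finite level of the tree, so recursion on the level and the union
        -- of the chain take the place of Zorn's lemma.
        module Closure (C : Conj) (T : Tree) where

          stage : ℕ → Conj
          stage zero    = C
          stage (suc n) = extendWords n (T n) (stage n) .proj₁

          stage-suc : ∀ n → stage n ⊑ stage (suc n)
          stage-suc n = extendWords n (T n) (stage n) .proj₂ .proj₁

          infix 4 _∼∞_
          _∼∞_ : Carrier → Carrier → Set (b ⊔ ℓ₂ ⊔ r)
          x ∼∞ y = ∃[ n ] Conjugation._∼_ (stage n) x y

          stage-+ : ∀ m n {x y} → Conjugation._∼_ (stage n) x y → Conjugation._∼_ (stage (m +ℕ n)) x y
          stage-+ zero    n x∼y = x∼y
          stage-+ (suc m) n x∼y = include (stage-suc (m +ℕ n)) (stage-+ m n x∼y)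

          commonStage : ∀ {x x′ y y′} → x ∼∞ x′ → y ∼∞ y′ →
                        ∃[ n ] Conjugation._∼_ (stage n) x x′ × Conjugation._∼_ (stage n) y y′
          commonStage {y = y} {y′} (m , x∼x′) (n , y∼y′) = n +ℕ m , stage-+ n m x∼x′ ,
            ≡.subst (λ k → Conjugation._∼_ (stage k) y y′) (ℕ.+-comm m n) (stage-+ m n y∼y′)

          closure : Conj
          closure = record
            { _∼_ = _∼∞_
            ; isConjugation = record
              { ∼-base = λ k → 0 , Conjugation.∼-base C k
              ; ∼-+    = λ p q → let n , p′ , q′ = commonStage p q in n , Conjugation.∼-+ (stage n) p′ q′
              ; ∼-*    = λ p q → let n , p′ , q′ = commonStage p q in n , Conjugation.∼-* (stage n) p′ q′
              ; ∼-neg  = λ (n , p) → n , Conjugation.∼-neg (stage n) p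
              ; ∼-resp = λ e e′ (n , p) → n , Conjugation.∼-resp (stage n) e e′ p
              ; ∼-zero = λ (n , p) → Conjugation.∼-zero (stage n) p } }

          closure-⊒ : C ⊑ closure
          closure-⊒ = mk⊑ (0 ,_)

          closure-tree : ∀ n w → InDomainAndRange closure (T n w)
          closure-tree n w = let y , z , x∼y , z∼x = extendWords n (T n) (stage n) .proj₂ .proj₂ w in
            y , z , (suc n , x∼y) , (suc n , z∼x)

        closure-exists : ∀ (C : Conj) (T : Tree) → ∃[ D ] C ⊑ D × (∀ n w → InDomainAndRange D (T n w))
        closure-exists C T = closure , closure-⊒ , closure-tree
          where open Closure C T

-- Colliding critical points

heytingIsField : (∀ {p} → ExcludedMiddle p) → ∀ {c ℓ₁ ℓ₂} (K : HeytingField c ℓ₁ ℓ₂) → IsField (fieldRing K)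
heytingIsField em K = record { _≟_ = λ x y → em ; invert = invert ; 1≉0 = 1≉0 }
  where
  open HeytingField K
  open CommutativeRing (fieldRing K) using (ring)
  x-0≈x : ∀ {x} → x - 0# ≈ x
  x-0≈x {x} = trans (+-congˡ (RingProperties.-0#≈0# ring)) (+-identityʳ x)
  invert : ∀ {x} → ¬ x ≈ 0# → ∃[ y ] x * y ≈ 1#
  invert {x} x≉0 with em {P = x # 0#}
  ... | no ¬x#0 = contradiction (tight x 0# .proj₁ ¬x#0) x≉0
  ... | yes x#0 = let y , _ , xy≈1 = #⇒invertible x#0 in y , trans (*-congʳ (sym x-0≈x)) xy≈1
  1≉0 : ¬ 1# ≈ 0#
  1≉0 1≈0 = tight 1# 0# .proj₂ 1≈0
    (invertible⇒# (1# , trans (*-congˡ x-0≈x) (*-identityʳ 1#) , trans (*-congʳ x-0≈x) (*-identityʳ 1#)))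

module Characteristic (em : ∀ {p} → ExcludedMiddle p) {c ℓ₁ ℓ₂} (K : HeytingField c ℓ₁ ℓ₂) where
  open CommutativeRing (fieldRing K) hiding (zero)
  open Field (fieldRing K) (heytingIsField em K)
  open SemiringMult semiring using (×1-homo-*; ×-homo-+) renaming (_×_ to _·_)
  open SetoidReasoning setoid

  -- Division with remainder by `suc p`. It is used contrapositively: a characteristic different
  -- from 2 or 3 makes the number 2 or 3 nonzero in K.
  hasCharacteristic : ∀ p → suc p · 1# ≈ 0# → (∀ {r} → suc r < suc p → ¬ suc r · 1# ≈ 0#) →
                      HasCharacteristic K (suc p)
  hasCharacteristic p p≈0 small≉0 n = mk⇔ to from
    where
    multiple≈0 : ∀ q → (q *ℕ suc p) · 1# ≈ 0#
    multiple≈0 q = trans (×1-homo-* q (suc p)) (trans (*-congˡ p≈0) (zeroʳ _))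
    from : suc p ∣ n → n · 1# ≈ 0#
    from (divides q ≡.refl) = multiple≈0 q
    to : n · 1# ≈ 0# → suc p ∣ n
    to n≈0 = small (n % suc p) ≡.refl (m%n<n n (suc p)) (begin
      (n % suc p) · 1#                                    ≈⟨ +-identityʳ _ ⟨
      (n % suc p) · 1# + 0#                               ≈⟨ +-congˡ (multiple≈0 (n / suc p)) ⟨
      (n % suc p) · 1# + (n / suc p *ℕ suc p) · 1#        ≈⟨ ×-homo-+ 1# (n % suc p) _ ⟨
      (n % suc p +ℕ n / suc p *ℕ suc p) · 1#              ≡⟨ ≡.cong (_· 1#) (m≡m%n+[m/n]*n n (suc p)) ⟨
      n · 1#                                              ≈⟨ n≈0 ⟩
      0#                                                  ∎)
      where
      small : ∀ r → n % suc p ≡ r → n % suc p < suc p → (n % suc p) · 1# ≈ 0# → suc p ∣ n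
      small zero    e _   _   = m%n≡0⇒n∣m n (suc p) e
      small (suc r) e r<p r≈0 = contradiction (≡.subst (λ k → k · 1# ≈ 0#) e r≈0)
                                              (small≉0 (≡.subst (_< suc p) e r<p))

  2≉0 : ¬ HasCharacteristic K 2 → ¬ 2 · 1# ≈ 0#
  2≉0 char≢2 2≈0 = char≢2 (hasCharacteristic 1 2≈0 λ
    { {zero} _ e → 1≉0 (trans (sym (+-identityʳ 1#)) e) ; {suc r} (s≤s (s≤s ())) })

  3≉0 : ¬ HasCharacteristic K 3 → ¬ 3 · 1# ≈ 0#
  3≉0 char≢3 3≈0 = char≢3 (hasCharacteristic 2 3≈0 λ
    { {zero} _ e → 1≉0 (trans (sym (+-identityʳ 1#)) e)
    ; {suc zero} _ e → 1≉0 (trans (sym (trans (+-congˡ e) (+-identityʳ 1#))) 3≈0)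
    ; {suc (suc r)} (s≤s (s≤s (s≤s ()))) })

  x+x+x≉0 : ¬ HasCharacteristic K 3 → ∀ {x} → ¬ x ≈ 0# → ¬ x + x + x ≈ 0#
  x+x+x≉0 char≢3 {x} x≉0 e = 3≉0 char≢3 (x*y≈0⇒y≈0 x≉0 (trans
    (solve 1 (λ x → x :* con (+ 3) := x :+ x :+ x) refl x) e))
    where open IntegerCoefficients (fieldRing K)

-- A pattern synonym and not a definition: the Galois groups of two cubics
-- that are not syntactically equal are too large to be compared by unfolding.
pattern cubic k₀ k₁ k₂ k₃ k₃≉0 = record { poly = k₀ ∷ k₁ ∷ k₂ ∷ k₃ ∷ [] ; isCubic = k₃≉0 }

module Collision {c ℓ₁ ℓ₂ c′ ℓ₁′ ℓ₂′ : Level} (em : ∀ {p} → ExcludedMiddle p)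
  (K : HeytingField c ℓ₁ ℓ₂) (K̄ : AlgebraicClosure K c′ ℓ₁′ ℓ₂′)
  (char≢2 : ¬ HasCharacteristic K 2) (char≢3 : ¬ HasCharacteristic K 3)
  (k₀ k₁ k₂ k₃ : HeytingField.Carrier K) (k₃≉0 : ¬ HeytingField._≈_ K k₃ (HeytingField.0# K)) where

  open AlgebraicClosure K̄ using (extension; ι; ι-isRingMonomorphism; algebraic; algebraicallyClosed; LiesInBase)

  private
    KR = fieldRing K
    LR = fieldRing extension
    isFieldK = heytingIsField em K
    isFieldL = heytingIsField em extension
    module K = CommutativeRing KR
    module KF = Field KR isFieldK
    module ι = RingMorphisms.IsRingMonomorphism ι-isRingMonomorphism
    module KPoly = Polynomial K.rawRing
    module LPoly = Polynomial (CommutativeRing.rawRing LR)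
    module KMult = SemiringMult K.semiring
    module KChar = Characteristic em K
  open CommutativeRing LR hiding (zero)
  open Field LR isFieldL
  open SignAction LR
  open IntegerCoefficients LR
  open WordProduct *-commutativeMonoid
  open MonoidSum *-commutativeMonoid using () renaming (sum to ∏)
  open SemiringMult semiring using () renaming (_×_ to _·_)
  open SetoidReasoning setoid
  open Conjugations KR LR isFieldK isFieldL ι ι-isRingMonomorphism

  ι≉0 : ∀ {k} → ¬ k K.≈ K.0# → ¬ ι k ≈ 0#
  ι≉0 k≉0 e = k≉0 (ι≈0 algebraic e)

  open CubicMap LR isFieldL (ι k₀) (ι k₁) (ι k₂) (ι k₃) (ι≉0 k₃≉0)

  ι-· : ∀ n {k} → ι (n KMult.× k) ≈ n · ι k
  ι-· zero    = ι.0#-homo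
  ι-· (suc n) = trans (ι.+-homo _ _) (+-congˡ (ι-· n))

  ι-1 : ∀ n → ι (n KMult.× K.1#) ≈ n · 1#
  ι-1 n = trans (ι-· n) (SemiringMult.×-congʳ semiring n ι.1#-homo)

  ι-inverse : ∀ {k} → ¬ k K.≈ K.0# → ∃[ k⁻¹ ] ι k * ι k⁻¹ ≈ 1#
  ι-inverse k≉0 = let k⁻¹ , e = KF.invert k≉0 in k⁻¹ , trans (sym (ι.*-homo _ _)) (trans (ι.⟦⟧-cong e) ι.1#-homo)

  derivative≈f′ : ∀ γ → LPoly.eval (map ι (KPoly.derivative (k₀ ∷ k₁ ∷ k₂ ∷ k₃ ∷ []))) γ ≈ f′ γ
  derivative≈f′ γ = begin
    ι (1 KMult.× k₁) + γ * (ι (2 KMult.× k₂) + γ * (ι (3 KMult.× k₃) + γ * 0#))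
      ≈⟨ +-cong (ι-· 1) (*-congˡ (+-cong (ι-· 2) (*-congˡ (+-congʳ (ι-· 3))))) ⟩
    1 · ι k₁ + γ * (2 · ι k₂ + γ * (3 · ι k₃ + γ * 0#))
      ≈⟨ solve 4 (λ x y z γ →
           (x :+ con (+ 0)) :+ γ :* ((y :+ (y :+ con (+ 0))) :+
             γ :* ((z :+ (z :+ (z :+ con (+ 0)))) :+ γ :* con (+ 0)))
           := x :+ γ :* ((y :+ y) :+ γ :* (z :+ z :+ z))) refl (ι k₁) (ι k₂) (ι k₃) γ ⟩
    f′ γ ∎

  critical⇒f′≈0 : ∀ {γ} → IsCritical K̄ (cubic k₀ k₁ k₂ k₃ k₃≉0) γ → f′ γ ≈ 0#
  critical⇒f′≈0 {γ} = trans (sym (derivative≈f′ γ))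

  f′≈0⇒critical : ∀ {γ} → f′ γ ≈ 0# → IsCritical K̄ (cubic k₀ k₁ k₂ k₃ k₃≉0) γ
  f′≈0⇒critical {γ} = trans (derivative≈f′ γ)

  3k₃≉0 : ¬ k₃ K.+ k₃ K.+ k₃ K.≈ K.0#
  3k₃≉0 = KChar.x+x+x≉0 char≢3 k₃≉0

  √-3-exists : ∃[ s ] s * s ≈ - ⟦ + 3 ⟧ℤ
  √-3-exists = let s , e = algebraicallyClosed 1 (⟦ + 3 ⟧ℤ ∷ 0# ∷ 1# ∷ []) 1≉0 in s , x-y≈0⇒x≈y (trans
    -- The leading `1#` is passed as the variable `o` because `con (+ 1)` denotes `1# + 0#`; the
    -- last summand accounts for the difference.
    (solve 2 (λ s o → s :* s :- :- con (+ 3) :=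
      con (+ 3) :+ s :* (con (+ 0) :+ s :* (o :+ s :* con (+ 0))) :+ s :* s :* (con (+ 1) :- o))
      refl s 1#)
    (trans (+-cong e (trans (*-congˡ (x≈y⇒x-y≈0 (+-identityʳ 1#))) (zeroʳ _))) (+-identityʳ 0#)))

  module CriticalPoints (γ₁ γ₂ : Carrier) (γ₁≉γ₂ : ¬ γ₁ ≈ γ₂) (f′γ₁≈0 : f′ γ₁ ≈ 0#) (f′γ₂≈0 : f′ γ₂ ≈ 0#) where

    -- x₁ and x₂ are the values at γ₁ and γ₂ of one polynomial over K; modulo
    -- the quadratic f′ its degree can be taken to be at most 1.
    Affine : Carrier → Carrier → Set _
    Affine x₁ x₂ = ∃[ p ] ∃[ q ] x₁ ≈ ι p + ι q * γ₁ × x₂ ≈ ι p + ι q * γ₂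

    -- The two values differ by `ι q * (γ₁ - γ₂)`, so agreement forces `q` to be zero.
    affine-≈⇒base : ∀ {x₁ x₂} → Affine x₁ x₂ → x₁ ≈ x₂ → LiesInBase x₁
    affine-≈⇒base {x₁} {x₂} (p , q , e₁ , e₂) x₁≈x₂ =
      p , sym (trans e₁ (trans (+-congˡ (trans (*-congʳ q≈0) (zeroˡ γ₁))) (+-identityʳ _)))
      where
      q≈0 : ι q ≈ 0#
      q≈0 = x*y≈0⇒y≈0 (λ e → γ₁≉γ₂ (x-y≈0⇒x≈y e)) (begin
        (γ₁ - γ₂) * ι q
          ≈⟨ solve 4 (λ p q x y → (x :- y) :* q := (p :+ q :* x) :- (p :+ q :* y)) refl (ι p) (ι q) γ₁ γ₂ ⟩
        (ι p + ι q * γ₁) - (ι p + ι q * γ₂)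
          ≈⟨ x≈y⇒x-y≈0 (trans (sym e₁) (trans x₁≈x₂ e₂)) ⟩
        0# ∎)

    affine-base : ∀ k → Affine (ι k) (ι k)
    affine-base k = k , K.0# , ι≈ , ι≈
      where
      ι≈ : ∀ {γ} → ι k ≈ ι k + ι K.0# * γ
      ι≈ = sym (trans (+-congˡ (trans (*-congʳ ι.0#-homo) (zeroˡ _))) (+-identityʳ _))

    affine-γ : Affine γ₁ γ₂
    affine-γ = K.0# , K.1# , γ≈ , γ≈
      where
      γ≈ : ∀ {γ} → γ ≈ ι K.0# + ι K.1# * γ
      γ≈ = sym (trans (+-cong ι.0#-homo (trans (*-congʳ ι.1#-homo) (*-identityˡ _))) (+-identityˡ _))

    affine-+ : ∀ {x₁ x₂ y₁ y₂} → Affine x₁ x₂ → Affine y₁ y₂ → Affine (x₁ + y₁) (x₂ + y₂)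
    affine-+ (p , q , e₁ , e₂) (p′ , q′ , e₁′ , e₂′) = p K.+ p′ , q K.+ q′ , sum e₁ e₁′ , sum e₂ e₂′
      where
      sum : ∀ {x y γ} → x ≈ ι p + ι q * γ → y ≈ ι p′ + ι q′ * γ → x + y ≈ ι (p K.+ p′) + ι (q K.+ q′) * γ
      sum {x} {y} {γ} e e′ = begin
        x + y
          ≈⟨ +-cong e e′ ⟩
        (ι p + ι q * γ) + (ι p′ + ι q′ * γ)
          ≈⟨ solve 5 (λ p q p′ q′ γ → (p :+ q :* γ) :+ (p′ :+ q′ :* γ) := (p :+ p′) :+ (q :+ q′) :* γ) refl
               (ι p) (ι q) (ι p′) (ι q′) γ ⟩
        (ι p + ι p′) + (ι q + ι q′) * γ
          ≈⟨ +-cong (ι.+-homo p p′) (*-congʳ (ι.+-homo q q′)) ⟨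
        ι (p K.+ p′) + ι (q K.+ q′) * γ ∎

    affine-scale : ∀ k {x₁ x₂} → Affine x₁ x₂ → Affine (ι k * x₁) (ι k * x₂)
    affine-scale k (p , q , e₁ , e₂) = k K.* p , k K.* q , scaled e₁ , scaled e₂
      where
      scaled : ∀ {x γ} → x ≈ ι p + ι q * γ → ι k * x ≈ ι (k K.* p) + ι (k K.* q) * γ
      scaled {x} {γ} e = begin
        ι k * x                         ≈⟨ *-congˡ e ⟩
        ι k * (ι p + ι q * γ)           ≈⟨ solve 4 (λ k p q γ → k :* (p :+ q :* γ) := k :* p :+ k :* q :* γ) refl (ι k) (ι p) (ι q) γ ⟩
        ι k * ι p + ι k * ι q * γ       ≈⟨ +-cong (ι.*-homo k p) (*-congʳ (ι.*-homo k q)) ⟨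
        ι (k K.* p) + ι (k K.* q) * γ   ∎

    affine-resp : ∀ {x₁ x₂ y₁ y₂} → x₁ ≈ y₁ → x₂ ≈ y₂ → Affine x₁ x₂ → Affine y₁ y₂
    affine-resp x₁≈y₁ x₂≈y₂ (p , q , e₁ , e₂) = p , q , trans (sym x₁≈y₁) e₁ , trans (sym x₂≈y₂) e₂

    -- The equation `f′ γ ≈ 0#` solved for the square of `γ`. Its leading coefficient `3 k₃` is
    -- invertible because the characteristic is not 3.
    affine-γ*γ : Affine (γ₁ * γ₁) (γ₂ * γ₂)
    affine-γ*γ = affine-resp (γ² f′γ₁≈0) (γ² f′γ₂≈0)
      (affine-scale (K.- r) (affine-+ (affine-base k₁) (affine-scale (k₂ K.+ k₂) affine-γ)))
      where
      r = ι-inverse 3k₃≉0 .proj₁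
      ι3k₃ : ι (k₃ K.+ k₃ K.+ k₃) ≈ ι k₃ + ι k₃ + ι k₃
      ι3k₃ = trans (ι.+-homo _ _) (+-congʳ (ι.+-homo _ _))
      γ² : ∀ {γ} → f′ γ ≈ 0# → ι (K.- r) * (ι k₁ + ι (k₂ K.+ k₂) * γ) ≈ γ * γ
      γ² {γ} e = begin
        ι (K.- r) * (ι k₁ + ι (k₂ K.+ k₂) * γ)
          ≈⟨ *-cong (ι.-‿homo r) (+-congˡ (*-congʳ (ι.+-homo k₂ k₂))) ⟩
        - ι r * (ι k₁ + (ι k₂ + ι k₂) * γ)
          ≈⟨ solve 5 (λ r x y z γ → :- r :* (x :+ (y :+ y) :* γ) :=
               ((z :+ z :+ z) :* r) :* (γ :* γ) :- r :* (x :+ γ :* ((y :+ y) :+ γ :* (z :+ z :+ z)))) refl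
               (ι r) (ι k₁) (ι k₂) (ι k₃) γ ⟩
        ((ι k₃ + ι k₃ + ι k₃) * ι r) * (γ * γ) - ι r * f′ γ
          ≈⟨ +-cong (trans (*-congʳ (trans (*-congʳ (sym ι3k₃)) (ι-inverse 3k₃≉0 .proj₂))) (*-identityˡ _))
                    (trans (-‿cong (trans (*-congˡ e) (zeroʳ _))) (RingProperties.-0#≈0# ring)) ⟩
        γ * γ + 0#
          ≈⟨ +-identityʳ _ ⟩
        γ * γ ∎

    affine-*γ : ∀ {x₁ x₂} → Affine x₁ x₂ → Affine (γ₁ * x₁) (γ₂ * x₂)
    affine-*γ (p , q , e₁ , e₂) = affine-resp (product e₁) (product e₂)
      (affine-+ (affine-scale p affine-γ) (affine-scale q affine-γ*γ))
      where
      product : ∀ {x γ} → x ≈ ι p + ι q * γ → ι p * γ + ι q * (γ * γ) ≈ γ * x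
      product {x} {γ} e = trans (solve 3 (λ p q γ → p :* γ :+ q :* (γ :* γ) := γ :* (p :+ q :* γ)) refl (ι p) (ι q) γ)
                                (*-congˡ (sym e))

    affine-* : ∀ {x₁ x₂ y₁ y₂} → Affine x₁ x₂ → Affine y₁ y₂ → Affine (x₁ * y₁) (x₂ * y₂)
    affine-* {y₁ = y₁} {y₂} (p , q , e₁ , e₂) y = affine-resp (product e₁) (product e₂)
      (affine-+ (affine-scale p y) (affine-scale q (affine-*γ y)))
      where
      product : ∀ {x γ y} → x ≈ ι p + ι q * γ → ι p * y + ι q * (γ * y) ≈ x * y
      product {x} {γ} {y} e = trans (solve 4 (λ p q γ y → p :* y :+ q :* (γ :* y) := (p :+ q :* γ) :* y) refl (ι p) (ι q) γ y)
                                    (*-congʳ (sym e))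

    affine-f : ∀ {x₁ x₂} → Affine x₁ x₂ → Affine (f x₁) (f x₂)
    affine-f x = affine-+ (affine-base k₀) (affine-* x (affine-+ (affine-base k₁) (affine-* x
      (affine-+ (affine-base k₂) (affine-* x (affine-+ (affine-base k₃)
        (affine-resp (*-congˡ ι.0#-homo) (*-congˡ ι.0#-homo) (affine-* x (affine-base K.0#)))))))))

    affine-iterate : ∀ n {x₁ x₂} → Affine x₁ x₂ → Affine (iterate f x₁ n) (iterate f x₂ n)
    affine-iterate zero    x = x
    affine-iterate (suc n) x = affine-iterate n (affine-f x)

    collision-base : ∀ n → iterate f γ₁ n ≈ iterate f γ₂ n → LiesInBase (iterate f γ₁ n)
    collision-base n = affine-≈⇒base (affine-iterate n affine-γ)

    module Depth (√-3 : Carrier) (√-3² : √-3 * √-3 ≈ - ⟦ + 3 ⟧ℤ)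
                 (m : ℕ) (collide : iterate f γ₁ (suc m) ≈ iterate f γ₂ (suc m)) where

      V : Carrier
      V = iterate f γ₁ (suc m)

      X : Carrier
      X = wordProduct m λ _ → √-3 * √-3 * √-3

      minus3 : K.Carrier
      minus3 = K.- (3 KMult.× K.1#)

      ι-minus3 : ι minus3 ≈ - ⟦ + 3 ⟧ℤ
      ι-minus3 = trans (ι.-‿homo _) (-‿cong (ι-1 3))

      minus3≉0 : ¬ minus3 K.≈ K.0#
      minus3≉0 e = KChar.3≉0 char≢3 (K.trans (K.sym (RingProperties.-‿involutive K.ring _))
        (K.trans (K.-‿cong e) (RingProperties.-0#≈0# K.ring)))

      √-3≉0 : ¬ √-3 ≈ 0#
      √-3≉0 e = ι≉0 minus3≉0 (trans ι-minus3 (trans (sym √-3²) (trans (*-congʳ e) (zeroˡ _))))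

      BaseUnit : Carrier → Set _
      BaseUnit x = ∃[ k ] ¬ k K.≈ K.0# × ι k ≈ x

      baseUnit-* : ∀ {x y} → BaseUnit x → BaseUnit y → BaseUnit (x * y)
      baseUnit-* (k , k≉0 , ιk) (l , l≉0 , ιl) = k K.* l , KF.x*y≉0 k≉0 l≉0 , trans (ι.*-homo k l) (*-cong ιk ιl)

      baseUnit-1 : BaseUnit 1#
      baseUnit-1 = K.1# , KF.1≉0 , ι.1#-homo

      baseUnit-∏ : ∀ {n} {h : Fin n → Carrier} → (∀ i → BaseUnit (h i)) → BaseUnit (∏ h)
      baseUnit-∏ {zero}  u = baseUnit-1
      baseUnit-∏ {suc n} u = baseUnit-* (u zero) (baseUnit-∏ (λ i → u (suc i)))

      baseUnit-wordProduct : ∀ n {h : Word n → Carrier} → (∀ w → BaseUnit (h w)) → BaseUnit (wordProduct n h)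
      baseUnit-wordProduct zero    u = u []
      baseUnit-wordProduct (suc n) u = baseUnit-∏ λ s → baseUnit-wordProduct n λ w → u (s ∷ w)

      k₃-unit : BaseUnit (ι k₃)
      k₃-unit = k₃ , k₃≉0 , refl

      leading-unit : ∀ n → BaseUnit (leading n)
      leading-unit zero    = baseUnit-1
      leading-unit (suc n) = baseUnit-* k₃-unit (baseUnit-∏ {3} λ _ → leading-unit n)

      scale-unit : BaseUnit (scale m)
      scale-unit = baseUnit-* (leading-unit m) (baseUnit-wordProduct m λ _ → k₃-unit)

      -- `X` is the power of √-3 with the odd exponent 3^(m + 1), and the square of √-3 lies in K.
      X-factor : ∃[ u ] BaseUnit u × X ≈ √-3 * u
      X-factor = go m
        where
        square-unit : BaseUnit (√-3 * √-3)
        square-unit = minus3 , minus3≉0 , trans ι-minus3 (sym √-3²)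
        go : ∀ n → ∃[ u ] BaseUnit u × wordProduct n (λ _ → √-3 * √-3 * √-3) ≈ √-3 * u
        go zero    = √-3 * √-3 , square-unit , *-comm _ _
        go (suc n) = let u , u-unit , e = go n in
          (√-3 * √-3) * (u * (u * u)) , baseUnit-* square-unit (baseUnit-* u-unit (baseUnit-* u-unit u-unit)) ,
          trans (*-cong e (*-cong e (*-congʳ e)))
            (trans (*-congˡ (*-congˡ (*-identityʳ _)))
              (solve 2 (λ x u → (x :* u) :* ((x :* u) :* (x :* u)) := x :* ((x :* x) :* (u :* (u :* u)))) refl √-3 u))

      u : Carrier
      u = X-factor .proj₁

      v : K.Carrier
      v = collision-base (suc m) collide .proj₁

      ιv≈V : ι v ≈ V
      ιv≈V = collision-base (suc m) collide .proj₂

      -- The normalisation of the overview: since `X ≈ √-3 * u`, it makes `e` equal to √-3 (V - t)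
      -- times `u / scale m`, a constant of K that is the same at every node.
      Normal : Carrier → Carrier → Set _
      Normal t e = scale m * e ≈ X * (V - t)

      Normal-resp : ∀ {t t′ e e′} → t ≈ t′ → e ≈ e′ → Normal t e → Normal t′ e′
      Normal-resp t≈t′ e≈e′ normal = trans (*-congˡ (sym e≈e′)) (trans normal (*-congˡ (+-congˡ (-‿cong t≈t′))))

      Normal-± : ∀ {T} → IsTree T → Normal (T 0 []) (δʷ m T) ⊎ Normal (T 0 []) (- δʷ m T)
      Normal-± {T} tree = [ inj₁ , (λ e → inj₂ (begin
        scale m * - δʷ m T            ≈⟨ RingProperties.-‿distribʳ-* ring _ _ ⟨
        - (scale m * δʷ m T)          ≈⟨ -‿cong e ⟩
        - - (X * (V - T 0 []))        ≈⟨ RingProperties.-‿involutive ring _ ⟩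
        X * (V - T 0 [])              ∎)) ]′ (scaled-δʷ √-3² γ₁≉γ₂ f′γ₁≈0 f′γ₂≈0 m collide tree)

      -- Characteristic different from 2 separates `x` from `- x`.
      •-injective : ∀ s t {x} → ¬ x ≈ 0# → s • x ≈ t • x → s ≡ t
      •-injective Sign.+ Sign.+ x≉0 e = ≡.refl
      •-injective Sign.- Sign.- x≉0 e = ≡.refl
      •-injective Sign.+ Sign.- x≉0 e = contradiction e (x≉-x x≉0)
        where
        x≉-x : ∀ {x} → ¬ x ≈ 0# → ¬ x ≈ - x
        x≉-x {x} x≉0 e = KChar.2≉0 char≢2 (ι≈0 algebraic (trans (ι-1 2) (x*y≈0⇒y≈0 x≉0 (begin
          x * ⟦ + 2 ⟧ℤ   ≈⟨ solve 1 (λ x → x :* con (+ 2) := x :- :- x) refl x ⟩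
          x - - x       ≈⟨ x≈y⇒x-y≈0 e ⟩
          0#            ∎))))
      •-injective Sign.- Sign.+ x≉0 e = ≡.sym (•-injective Sign.+ Sign.- x≉0 (sym e))

      module Conjugate {r} (C : Conjugation r) where
        open Conjugation C

        baseUnit-∼ : ∀ {x} → BaseUnit x → x ∼ x
        baseUnit-∼ (k , _ , ιk≈x) = ∼-resp ιk≈x ιk≈x (∼-base k)

        V-∼ : V ∼ V
        V-∼ = ∼-resp ιv≈V ιv≈V (∼-base v)

        X-∼ : ∀ ε → √-3 ∼ (ε • √-3) → X ∼ (ε • X)
        X-∼ ε √-3∼ = ∼-resp (sym X≈) (trans (sym (•-assoc-* ε √-3 u)) (•-congˡ ε (sym X≈)))
                       (∼-* √-3∼ (baseUnit-∼ (X-factor .proj₂ .proj₁)))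
          where
          X≈ : X ≈ √-3 * u
          X≈ = X-factor .proj₂ .proj₂

        -- The conjugate of the equation `Normal t e` is computed on both sides. The left gives
        -- `s • X (V - t′)` by `normal′`, the right gives `ε • X (V - t′)`, and this product is
        -- nonzero.
        normal-sign : ∀ s ε {t t′ e e′} → √-3 ∼ (ε • √-3) → t ∼ t′ → e ∼ (s • e′) →
                      Normal t e → Normal t′ e′ → ¬ V - t′ ≈ 0# → s ≡ ε
        normal-sign s ε {t} {t′} {e} {e′} √-3∼ t∼t′ e∼ normal normal′ V≉t′ = •-injective s ε (x*y≉0 X≉0 V≉t′)
          (∼-unique (∼-resp refl scale-s (∼-* (baseUnit-∼ scale-unit) e∼))
                    (∼-resp refl (sym (•-assoc-* ε X (V - t′))) (∼-* (X-∼ ε √-3∼) (∼-- V-∼ t∼t′)))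
                    normal)
          where
          X≉0 : ¬ X ≈ 0#
          X≉0 = wordProduct≉0 m λ _ → x*y≉0 (x*y≉0 √-3≉0 √-3≉0) √-3≉0
          scale-s : scale m * (s • e′) ≈ s • (X * (V - t′))
          scale-s = begin
            scale m * (s • e′)    ≈⟨ *-comm _ _ ⟩
            (s • e′) * scale m    ≈⟨ •-assoc-* s e′ (scale m) ⟨
            s • (e′ * scale m)    ≈⟨ •-congˡ s (*-comm _ _) ⟩
            s • (scale m * e′)    ≈⟨ •-congˡ s normal′ ⟩
            s • (X * (V - t′))    ∎

        ±√-3 : ∀ {y} → √-3 ∼ y → ∃[ ε ] √-3 ∼ (ε • √-3)
        ±√-3 {y} √-3∼y = [ (λ y≈ → Sign.+ , ∼-resp refl y≈ √-3∼y) , (λ y≈ → Sign.- , ∼-resp refl y≈ √-3∼y) ]′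
          (x²≈y²⇒x≈±y (sym (∼-unique (baseUnit-∼ (minus3 , minus3≉0 , trans ι-minus3 (sym √-3²)))
                                     (∼-* √-3∼y √-3∼y) refl)))

      √-3-multiple : ∀ {t k} → ι k ≈ t → ¬ V - t ≈ 0# → ∀ {e} → Normal t e → ∃[ l ] √-3 ≈ e * ι l
      √-3-multiple {t} {k} ιk≈t V≉t {e} normal =
        let l , ul≈1 = ι-inverse a≉0 in scale-unit .proj₁ K.* l , (begin
          √-3
            ≈⟨ *-identityʳ √-3 ⟨
          √-3 * 1#
            ≈⟨ *-congˡ ul≈1 ⟨
          √-3 * (ι a * ι l)
            ≈⟨ *-assoc _ _ _ ⟨
          (√-3 * ι a) * ι l
            ≈⟨ *-congʳ √-3a ⟩
          (scale m * e) * ι l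
            ≈⟨ solve 3 (λ s e l → (s :* e) :* l := e :* (s :* l)) refl (scale m) e (ι l) ⟩
          e * (scale m * ι l)
            ≈⟨ *-congˡ (trans (ι.*-homo _ _) (*-congʳ (scale-unit .proj₂ .proj₂))) ⟨
          e * ι (scale-unit .proj₁ K.* l) ∎)
        where
        u-unit = X-factor .proj₂ .proj₁
        V-t : ι (v K.- k) ≈ V - t
        V-t = trans (ι.+-homo _ _) (+-cong ιv≈V (trans (ι.-‿homo k) (-‿cong ιk≈t)))
        a : K.Carrier
        a = u-unit .proj₁ K.* (v K.- k)
        a≉0 : ¬ a K.≈ K.0#
        a≉0 = KF.x*y≉0 (u-unit .proj₂ .proj₁) λ e → V≉t (trans (sym V-t) (trans (ι.⟦⟧-cong e) ι.0#-homo))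
        √-3a : √-3 * ι a ≈ scale m * e
        √-3a = begin
          √-3 * ι a             ≈⟨ *-congˡ (trans (ι.*-homo _ _) (*-cong (u-unit .proj₂ .proj₂) V-t)) ⟩
          √-3 * (u * (V - t))   ≈⟨ *-assoc _ _ _ ⟨
          √-3 * u * (V - t)     ≈⟨ *-congʳ (X-factor .proj₂ .proj₂) ⟨
          X * (V - t)           ≈⟨ normal ⟨
          scale m * e           ∎

      module QuadraticConjugation (√-3∉K : ∀ k → ¬ ι k ≈ √-3) where

        infix 4 _∼_
        -- The nontrivial automorphism of K(√-3) as a graph. Naming `z` lets the laws be checked as
        -- identities in `p` and `z`, with √-3 appearing only in the coefficient bookkeeping.
        _∼_ : Carrier → Carrier → Set (c ⊔ c′ ⊔ ℓ₁′)
        x ∼ y = ∃[ p ] ∃[ q ] ∃[ z ] z ≈ ι q * √-3 × x ≈ ι p + z × y ≈ ι p - z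

        quadraticConjugation : Conjugation (c ⊔ c′ ⊔ ℓ₁′)
        quadraticConjugation = record
          { _∼_ = _∼_
          ; isConjugation = record
            { ∼-base = λ k → k , K.0# , 0# , sym (trans (*-congʳ ι.0#-homo) (zeroˡ _)) ,
                             sym (+-identityʳ _) , sym (trans (+-congˡ (RingProperties.-0#≈0# ring)) (+-identityʳ _))
            ; ∼-+    = λ { (p , q , z , z≈ , x≈ , y≈) (p′ , q′ , z′ , z′≈ , x′≈ , y′≈) →
                           p K.+ p′ , q K.+ q′ , z + z′ ,
                           trans (+-cong z≈ z′≈) (trans (sym (distribʳ _ _ _)) (*-congʳ (sym (ι.+-homo q q′)))) ,
                           trans (+-cong x≈ x′≈) (trans (rearrange₊ (ι p) z (ι p′) z′) (+-congʳ (sym (ι.+-homo p p′)))) ,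
                           trans (+-cong y≈ y′≈) (trans (rearrange₋ (ι p) z (ι p′) z′) (+-congʳ (sym (ι.+-homo p p′)))) }
            ; ∼-*    = λ { (p , q , z , z≈ , x≈ , y≈) (p′ , q′ , z′ , z′≈ , x′≈ , y′≈) →
                           p K.* p′ K.+ q K.* q′ K.* minus3 , p K.* q′ K.+ p′ K.* q , ι p * z′ + ι p′ * z ,
                           trans (+-cong (*-congˡ z′≈) (*-congˡ z≈)) (trans (collect (ι p) (ι q) (ι p′) (ι q′) √-3)
                             (*-congʳ (sym (trans (ι.+-homo _ _) (+-cong (ι.*-homo _ _) (ι.*-homo _ _)))))) ,
                           trans (*-cong x≈ x′≈) (trans (product₊ (ι p) z (ι p′) z′) (+-congʳ (sym (norm p q p′ q′ z≈ z′≈)))) ,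
                           trans (*-cong y≈ y′≈) (trans (product₋ (ι p) z (ι p′) z′) (+-congʳ (sym (norm p q p′ q′ z≈ z′≈)))) }
            ; ∼-neg  = λ { (p , q , z , z≈ , x≈ , y≈) → K.- p , K.- q , - z ,
                           trans (-‿cong z≈) (trans (RingProperties.-‿distribˡ-* ring _ _) (*-congʳ (sym (ι.-‿homo q)))) ,
                           trans (-‿cong x≈) (trans (sym (RingProperties.-‿+-comm ring _ _)) (+-congʳ (sym (ι.-‿homo p)))) ,
                           trans (-‿cong y≈) (trans (sym (RingProperties.-‿+-comm ring _ _)) (+-congʳ (sym (ι.-‿homo p)))) }
            ; ∼-resp = λ { e e′ (p , q , z , z≈ , x≈ , y≈) → p , q , z , z≈ , trans (sym e) x≈ , trans (sym e′) y≈ }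
            ; ∼-zero = λ { (p , q , z , z≈ , x≈ , y≈) x≈0 → vanishes p q z≈ (trans (sym x≈) x≈0) y≈ } } }
          where
          rearrange₊ : ∀ p z p′ z′ → (p + z) + (p′ + z′) ≈ (p + p′) + (z + z′)
          rearrange₊ = solve 4 (λ p z p′ z′ → (p :+ z) :+ (p′ :+ z′) := (p :+ p′) :+ (z :+ z′)) refl
          rearrange₋ : ∀ p z p′ z′ → (p - z) + (p′ - z′) ≈ (p + p′) - (z + z′)
          rearrange₋ = solve 4 (λ p z p′ z′ → (p :- z) :+ (p′ :- z′) := (p :+ p′) :- (z :+ z′)) refl
          collect : ∀ p q p′ q′ s → p * (q′ * s) + p′ * (q * s) ≈ (p * q′ + p′ * q) * s
          collect = solve 5 (λ p q p′ q′ s → p :* (q′ :* s) :+ p′ :* (q :* s) := (p :* q′ :+ p′ :* q) :* s) refl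
          product₊ : ∀ p z p′ z′ → (p + z) * (p′ + z′) ≈ (p * p′ + z * z′) + (p * z′ + p′ * z)
          product₊ = solve 4 (λ p z p′ z′ → (p :+ z) :* (p′ :+ z′) := (p :* p′ :+ z :* z′) :+ (p :* z′ :+ p′ :* z)) refl
          product₋ : ∀ p z p′ z′ → (p - z) * (p′ - z′) ≈ (p * p′ + z * z′) - (p * z′ + p′ * z)
          product₋ = solve 4 (λ p z p′ z′ → (p :- z) :* (p′ :- z′) := (p :* p′ :+ z :* z′) :- (p :* z′ :+ p′ :* z)) refl
          norm : ∀ p q p′ q′ {z z′} → z ≈ ι q * √-3 → z′ ≈ ι q′ * √-3 →
                 ι (p K.* p′ K.+ q K.* q′ K.* minus3) ≈ ι p * ι p′ + z * z′
          norm p q p′ q′ {z} {z′} z≈ z′≈ = begin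
            ι (p K.* p′ K.+ q K.* q′ K.* minus3)
              ≈⟨ trans (ι.+-homo _ _) (+-cong (ι.*-homo p p′) (trans (ι.*-homo _ _) (*-cong (ι.*-homo q q′) ι-minus3))) ⟩
            ι p * ι p′ + (ι q * ι q′) * - ⟦ + 3 ⟧ℤ
              ≈⟨ +-congˡ (*-congˡ √-3²) ⟨
            ι p * ι p′ + (ι q * ι q′) * (√-3 * √-3)
              ≈⟨ +-congˡ (solve 3 (λ q q′ s → (q :* q′) :* (s :* s) := (q :* s) :* (q′ :* s)) refl (ι q) (ι q′) √-3) ⟩
            ι p * ι p′ + (ι q * √-3) * (ι q′ * √-3)
              ≈⟨ +-congˡ (*-cong z≈ z′≈) ⟨
            ι p * ι p′ + z * z′ ∎
          vanishes : ∀ p q {y z} → z ≈ ι q * √-3 → ι p + z ≈ 0# → y ≈ ι p - z → y ≈ 0#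
          vanishes p q {y} {z} z≈ p+z≈0 y≈ = trans y≈ (trans (+-cong p≈0 (-‿cong z≈0)) (-‿inverseʳ 0#))
            where
            q≈0 : q K.≈ K.0#
            -- Otherwise √-3 would be `- p / q`, an element of K.
            q≈0 = decidable-stable (q KF.≟ K.0#) λ q≉0 → let q⁻¹ , qq⁻¹≈1 = ι-inverse q≉0 in
              √-3∉K (K.- (p K.* q⁻¹)) (begin
                ι (K.- (p K.* q⁻¹))             ≈⟨ trans (ι.-‿homo _) (-‿cong (ι.*-homo p q⁻¹)) ⟩
                - (ι p * ι q⁻¹)
                  ≈⟨ solve 4 (λ p q q⁻¹ s → :- (p :* q⁻¹) := (q :* q⁻¹) :* s :- (p :+ q :* s) :* q⁻¹) refl
                       (ι p) (ι q) (ι q⁻¹) √-3 ⟩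
                (ι q * ι q⁻¹) * √-3 - (ι p + ι q * √-3) * ι q⁻¹
                  ≈⟨ +-cong (trans (*-congʳ qq⁻¹≈1) (*-identityˡ _))
                       (-‿cong (trans (*-congʳ (trans (+-congˡ (sym z≈)) p+z≈0)) (zeroˡ _))) ⟩
                √-3 - 0#                        ≈⟨ trans (+-congˡ (RingProperties.-0#≈0# ring)) (+-identityʳ _) ⟩
                √-3                             ∎)
            z≈0 : z ≈ 0#
            z≈0 = trans z≈ (trans (*-congʳ (trans (ι.⟦⟧-cong q≈0) ι.0#-homo)) (zeroˡ _))
            p≈0 : ι p ≈ 0#
            p≈0 = trans (sym (+-identityʳ _)) (trans (+-congˡ (sym z≈0)) p+z≈0)

        √-3∼-√-3 : √-3 ∼ (- √-3)
        √-3∼-√-3 = K.0# , K.1# , √-3 , sym (trans (*-congʳ ι.1#-homo) (*-identityˡ _)) ,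
          sym (trans (+-congʳ ι.0#-homo) (+-identityˡ _)) , sym (trans (+-congʳ ι.0#-homo) (+-identityˡ _))

      -- The Galois action on the backward orbit

      module Rooted (x₀ : K.Carrier)
        (noncritical : ∀ γ → IsCritical K̄ (cubic k₀ k₁ k₂ k₃ k₃≉0) γ →
                       ¬ InBackwardOrbit K̄ (cubic k₀ k₁ k₂ k₃ k₃≉0) x₀ γ) where

        open Dynamics K̄ (cubic k₀ k₁ k₂ k₃ k₃≉0)
          using (base; gen; add; mul; neg; recip; resp; K[_]_; InK∞; fL-surjective)
        open Dynamics.Arboreal K̄ (cubic k₀ k₁ k₂ k₃ k₃≉0) x₀ hiding (GalIsomorphicToSubgroupOf)

        ∈⇒f′≉0 : ∀ n {z} → iterate f z n ≈ ι x₀ → ¬ f′ z ≈ 0#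
        ∈⇒f′≉0 n z∈ e = noncritical _ (f′≈0⇒critical e) (n , z∈)

        -- A node equal to `V` would make the critical point `γ₁` a preimage of `x₀` of level
        -- `suc m +ℕ n`.
        V≉ : ∀ n {t} → iterate f t n ≈ ι x₀ → ¬ V - t ≈ 0#
        V≉ n {t} t∈ e = ∈⇒f′≉0 (suc m +ℕ n) (begin
          iterate f γ₁ (suc m +ℕ n)   ≡⟨ iterate-+ (suc m) γ₁ ⟩
          iterate f V n               ≈⟨ iterate-cong n (x-y≈0⇒x≈y e) ⟩
          iterate f t n               ≈⟨ t∈ ⟩
          ι x₀                        ∎) f′γ₁≈0
          where
          iterate-+ : ∀ k x → iterate f x (k +ℕ n) ≡ iterate f (iterate f x k) n
          iterate-+ zero    x = ≡.refl
          iterate-+ (suc k) x = iterate-+ k (f x)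

        module LabelledTree (lab : Labelling) where
          open Labelling lab

          nodes : Tree
          nodes n w = proj₁ (Inverse.from (label n) w)

          nodes∈ : ∀ n w → iterate f (nodes n w) n ≈ ι x₀
          nodes∈ n w = proj₂ (Inverse.from (label n) w)

          nodes-injective : ∀ n {u w} → nodes n u ≈ nodes n w → u ≡ w
          nodes-injective n {u} {w} e = ≡.trans (≡.sym (Inverse.strictlyInverseˡ (label n) u))
            (≡.trans (Inverse.to-cong (label n) {Inverse.from (label n) u} {Inverse.from (label n) w} e)
                     (Inverse.strictlyInverseˡ (label n) w))

          nodes-parent : ∀ n w s → f (nodes (suc n) (w ∷ʳ s)) ≈ nodes n w
          nodes-parent n w s = sym (Inverse.inverseʳ (label n) {parent {n} y} (≡.trans (≡.sym (≡.trans
            (≡.cong init (Inverse.strictlyInverseˡ (label (suc n)) (w ∷ʳ s))) (Vec.init-∷ʳ s w)))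
            (labelParent n y)))
            where
            y : Node (suc n)
            y = Inverse.from (label (suc n)) (w ∷ʳ s)

          -- A labelling provides three distinct preimages for each node, and `distinct⇒fibre` turns
          -- them into the full factorisation.
          nodes-isTree : IsTree nodes
          nodes-isTree n w = distinct⇒fibre
            (λ {s} {t} e → Vec.∷ʳ-injectiveʳ w w (nodes-injective (suc n) e)) (nodes-parent n w)

          module _ (g : Gal) where
            open Gal g
            private
              module σ = RingMorphisms.IsRingIsomorphism σ-isRingIsomorphism
              module K∞ = RawRing K∞-rawRing

            infix 4 _∼_
            -- The graph of the Galois element on the closure. Being related includes membership in
            -- K_∞, so that memberships are built along with the conjugates.
            _∼_ : Carrier → Carrier → Set _
            x ∼ y = Σ (InK∞ x₀ x) λ x∈ → proj₁ (σ (x , x∈)) ≈ y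

            galConjugation : Conjugation _
            galConjugation = record
              { _∼_ = _∼_
              ; isConjugation = record
                { ∼-base = λ k → proj₂ (ι∞ k) , σ-fixesK k
                ; ∼-+    = λ { {x} {_} {y} (p , e) (q , e′) →
                               proj₂ ((x , p) K∞.+ (y , q)) , trans (σ.+-homo (x , p) (y , q)) (+-cong e e′) }
                ; ∼-*    = λ { {x} {_} {y} (p , e) (q , e′) →
                               proj₂ ((x , p) K∞.* (y , q)) , trans (σ.*-homo (x , p) (y , q)) (*-cong e e′) }
                ; ∼-neg  = λ { {x} (p , e) → proj₂ (K∞.- (x , p)) , trans (σ.-‿homo (x , p)) (-‿cong e) }
                ; ∼-resp = λ { x≈y x′≈y′ ((n , p) , e) → (n , resp x≈y p) ,
                               trans (σ.⟦⟧-cong (sym x≈y)) (trans e x′≈y′) }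
                ; ∼-zero = λ { {x} (p , e) x≈0 → trans (sym e) (trans (σ.⟦⟧-cong {x , p} {K∞.0#} x≈0) σ.0#-homo) } } }

            open Conjugation galConjugation using (∼-resp; ∼-δʷ; ∼-*; ∼-base)

            treeMap : TreeMap
            treeMap = asTreeMap (action lab g)

            nodes-∼ : ∀ n w → nodes n w ∼ nodes n (TreeMap.on treeMap w)
            nodes-∼ n w = (n , gen (nodes∈ n w)) ,
              sym (Inverse.strictlyInverseʳ (label n) (Inverse.to (actOnLevel g n) (Inverse.from (label n) w)))

            δʷ-∼ : ∀ {k} (y : Word k) → δʷ m (subtree nodes y) ∼
                   (sgnProduct (suc m) (action lab g) y • δʷ m (subtree nodes (TreeMap.on treeMap y)))
            δʷ-∼ {k} y = ≡.subst (λ s → δʷ m (subtree nodes y) ∼ (s • δʷ m (subtree nodes (TreeMap.on treeMap y))))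
              (≡.sym (sgnProduct-below m (action lab g) y))
              (∼-δʷ m (below treeMap y) {subtree nodes y} {subtree nodes (TreeMap.on treeMap y)} λ n w →
                 ∼-resp refl (reflexive (≡.cong (nodes (k +ℕ n)) (on-++ treeMap y w))) (nodes-∼ (k +ℕ n) (y ++ w)))

            -- For a labelling that was not chosen, normality at the root holds only up to a sign.
            -- This suffices to write √-3 as a multiple of `δʷ` over K.
            root-sign : ∃[ s ] Normal (nodes 0 []) (s • δʷ m nodes)
            root-sign = [ Sign.+ ,_ , Sign.- ,_ ]′ (Normal-± nodes-isTree)

            √-3≈ : ∃[ s ] ∃[ l ] √-3 ≈ (s • δʷ m nodes) * ι l
            √-3≈ = proj₁ root-sign , √-3-multiple {k = x₀} (sym (nodes∈ 0 [])) (V≉ 0 (nodes∈ 0 [])) (proj₂ root-sign)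

            √-3-conjugate : ∃[ ε ] √-3 ∼ (ε • √-3)
            √-3-conjugate = let s , l , e = √-3≈ in Conjugate.±√-3 galConjugation
              (∼-resp (sym e) refl (∼-* (Conjugation.∼-• galConjugation s (δʷ-∼ [])) (∼-base l)))

            sgnProduct≡ : (∀ {k} (y : Word k) → Normal (nodes k y) (δʷ m (subtree nodes y))) →
                          ∀ ε → √-3 ∼ (ε • √-3) → ∀ {k} (y : Word k) → sgnProduct (suc m) (action lab g) y ≡ ε
            sgnProduct≡ normal ε √-3∼ {k} y = Conjugate.normal-sign galConjugation _ ε √-3∼
              (nodes-∼ k y) (δʷ-∼ y) (normal y) (normal (TreeMap.on treeMap y)) (V≉ k (nodes∈ k _))

            -- The product of signs at the root is `+`, so the Galois element fixes `δʷ m nodes`,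
            -- and √-3 is a multiple of it over K.
            Q⇒√-3-fixed : Q (suc m) (action lab g) → √-3 ∼ √-3
            Q⇒√-3-fixed (_ , sgn≡+) = let s , l , e = √-3≈ in
              ∼-resp (sym e) (sym e) (∼-* (Conjugation.∼-• galConjugation s fixed) (∼-base l))
              where
              fixed : δʷ m nodes ∼ δʷ m nodes
              fixed = ≡.subst₂ (λ s w → δʷ m nodes ∼ (s • δʷ m (subtree nodes w))) sgn≡+ ([]-unique _ []) (δʷ-∼ [])

        allFibres : ∀ t → ∃[ c ] Fibre t c
        allFibres = exists-fibre (fL-surjective) λ b₀ b₁ b₂ b₂≉0 → algebraicallyClosed 1 (b₀ ∷ b₁ ∷ b₂ ∷ []) b₂≉0

        open NormalisedTree em allFibres m Normal Normal-resp Normal-± (ι x₀)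

        tree-∈ : ∀ n w → iterate f (tree n w) n ≈ ι x₀
        tree-∈ = tree-iterate tree-isTree

        tree-parent : ∀ n w → f (tree (suc n) w) ≈ tree n (init w)
        tree-parent n = ∷ʳ-elim (λ w → f (tree (suc n) w) ≈ tree n (init w)) λ u s →
          trans (Fibre.child (tree-isTree n u) s) (reflexive (≡.cong (tree n) (≡.sym (Vec.init-∷ʳ s u))))

        wordOf : ∀ n {z} → iterate f z n ≈ ι x₀ → ∃[ w ] tree n w ≈ z
        wordOf = tree-covers tree-isTree

        tree-inj : ∀ n u w → tree n u ≈ tree n w → u ≡ w
        tree-inj = tree-injective tree-isTree λ n w → ∈⇒f′≉0 (suc n) (tree-∈ (suc n) w)

        labelling : Labelling
        labelling = record
          { label = λ n → record
            { to        = λ (z , z∈) → wordOf n z∈ .proj₁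
            ; from      = λ w → tree n w , tree-∈ n w
            ; to-cong   = λ { {z , z∈} {z′ , z′∈} e →
                            tree-inj n _ _ (trans (wordOf n z∈ .proj₂) (trans e (sym (wordOf n z′∈ .proj₂)))) }
            ; from-cong = λ e → reflexive (≡.cong (tree n) e)
            ; inverse   = (λ { {w} {z , z∈} e → tree-inj n _ _ (trans (wordOf n z∈ .proj₂) e) })
                        , (λ { {z , z∈} {w} e → trans (reflexive (≡.cong (tree n) e)) (wordOf n z∈ .proj₂) }) }
          ; labelParent = λ { n (z , z∈) → tree-inj n _ _ (begin
              tree n (init (wordOf (suc n) z∈ .proj₁))     ≈⟨ tree-parent n (wordOf (suc n) z∈ .proj₁) ⟨
              f (tree (suc n) (wordOf (suc n) z∈ .proj₁))  ≈⟨ f-cong (wordOf (suc n) z∈ .proj₂) ⟩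
              f z                                          ≈⟨ wordOf n z∈ .proj₂ ⟨
              tree n (wordOf n z∈ .proj₁)                  ∎) } }

        open LabelledTree labelling using (√-3-conjugate; sgnProduct≡; galConjugation)

        inQ̃ : GalIsomorphicToSubgroupOf K̄ (cubic k₀ k₁ k₂ k₃ k₃≉0) x₀ (Q̃ (suc m))
        inQ̃ = labelling , λ g {k} y → ≡.trans (signs g y) (≡.sym (signs g []))
          where
          signs : ∀ g {k} (y : Word k) → sgnProduct (suc m) (action labelling g) y ≡ √-3-conjugate g .proj₁
          signs g = sgnProduct≡ g tree-normal (√-3-conjugate g .proj₁) (√-3-conjugate g .proj₂)

        inQ : MinusThreeIsSquare K → GalIsomorphicToSubgroupOf K̄ (cubic k₀ k₁ k₂ k₃ k₃≉0) x₀ (Q (suc m))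
        inQ (a , a²≈-3) = labelling , λ g → proj₂ inQ̃ g , sgnProduct≡ g tree-normal Sign.+ (√-3-fixed g) []
          where
          ±ιa : ∃[ s ] √-3 ≈ s • ι a
          ±ιa = [ Sign.+ ,_ , Sign.- ,_ ]′ (x²≈y²⇒x≈±y
            (trans √-3² (trans (sym ι-minus3) (trans (ι.⟦⟧-cong (K.sym a²≈-3)) (ι.*-homo a a)))))
          √-3-fixed : ∀ g → Conjugation._∼_ (galConjugation g) √-3 √-3
          √-3-fixed g = let s , e = ±ιa in
            Conjugation.∼-resp (galConjugation g) (sym e) (sym e)
              (Conjugation.∼-• (galConjugation g) s (Conjugation.∼-base (galConjugation g) a))

        module FromConjugation {r} (C : Conjugation r)
          (conjugates : ∀ n {z} → iterate f z n ≈ ι x₀ →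
                        (∃[ y ] Conjugation._∼_ C z y) × (∃[ y ] Conjugation._∼_ C y z)) where

          open Conjugation C

          -- Conjugates of elements of K_n stay in K_n, by induction on how an element is generated.
          -- The statement is for an arbitrary `D` because surjectivity of `σ` needs it for the
          -- converse of `C`.
          image : ∀ {q} (D : Conjugation q) → (∀ n {z} → iterate f z n ≈ ι x₀ → ∃[ y ] Conjugation._∼_ D z y) →
                  ∀ n {x} → (K[ x₀ ] n) x → ∃[ y ] Conjugation._∼_ D x y × (K[ x₀ ] n) y
          image D D-nodes n = go
            where
            module D = Conjugation D
            iterate-∼ : ∀ k {x y} → x D.∼ y → iterate f x k D.∼ iterate f y k
            iterate-∼ zero    x∼y = x∼y
            iterate-∼ (suc k) x∼y = iterate-∼ k (D.∼-eval (k₀ ∷ k₁ ∷ k₂ ∷ k₃ ∷ []) x∼y)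
            go : ∀ {x} → (K[ x₀ ] n) x → ∃[ y ] x D.∼ y × (K[ x₀ ] n) y
            go (base k)  = ι k , D.∼-base k , base k
            -- Since `f` has coefficients in K, the equation saying that `z` is an `n`-th preimage
            -- of `x₀` passes to its conjugate `y`.
            go (gen z∈)  = let y , z∼y = D-nodes n z∈ in
              y , z∼y , gen (D.∼-unique (iterate-∼ n z∼y) (D.∼-base x₀) z∈)
            go (add p q) = let y , x∼y , y∈ = go p
                               y′ , x∼y′ , y′∈ = go q in y + y′ , D.∼-+ x∼y x∼y′ , add y∈ y′∈
            go (mul p q) = let y , x∼y , y∈ = go p
                               y′ , x∼y′ , y′∈ = go q in y * y′ , D.∼-* x∼y x∼y′ , mul y∈ y′∈
            go (neg p)   = let y , x∼y , y∈ = go p in - y , D.∼-neg x∼y , neg y∈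
            go (recip p e) = let y , x∼y , y∈ = go p
                                 y′ , z∼y′ = ∼-recip algebraic D x∼y e
                             in y′ , z∼y′ , recip y∈ (D.∼-unique (D.∼-* x∼y z∼y′) D.∼-1 e)
            go (resp e p) = let y , x∼y , y∈ = go p in y , D.∼-resp e refl x∼y , y∈

          σ-image : (x : K∞) → ∃[ y ] proj₁ x ∼ proj₁ {B = InK∞ x₀} y
          σ-image (x , n , x∈) = let y , x∼y , y∈ = image C (λ n z∈ → conjugates n z∈ .proj₁) n x∈ in (y , n , y∈) , x∼y

          σ : K∞ → K∞
          σ x = σ-image x .proj₁

          σ-∼ : ∀ x → proj₁ x ∼ proj₁ (σ x)
          σ-∼ x = σ-image x .proj₂

          σ-unique : ∀ x {y} → proj₁ x ∼ y → proj₁ (σ x) ≈ y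
          σ-unique x x∼y = ∼-unique (σ-∼ x) x∼y refl

          gal : Gal
          gal = record
            { σ = σ
            ; σ-isRingIsomorphism = record
              { isRingMonomorphism = record
                { isRingHomomorphism = record
                  { isSemiringHomomorphism = record
                    { isNearSemiringHomomorphism = record
                      { +-isMonoidHomomorphism = record
                        { isMagmaHomomorphism = record
                          { isRelHomomorphism = record { cong = λ {x} {y} e → ∼-unique (σ-∼ x) (σ-∼ y) e }
                          ; homo = λ x y → σ-unique (x K∞.+ y) (∼-+ (σ-∼ x) (σ-∼ y)) }
                        ; ε-homo = σ-unique K∞.0# ∼-0 }
                      ; *-homo = λ x y → σ-unique (x K∞.* y) (∼-* (σ-∼ x) (σ-∼ y)) }
                    ; 1#-homo = σ-unique K∞.1# ∼-1 }
                  ; -‿homo = λ x → σ-unique (K∞.- x) (∼-neg (σ-∼ x)) }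
                ; injective = λ {x} {y} e → Conjugation.∼-unique (converse algebraic C) (σ-∼ x) (σ-∼ y) e }
              ; surjective = λ { (y , n , y∈) →
                  let x , x∼y , x∈ = image (converse algebraic C) (λ n z∈ → conjugates n z∈ .proj₂) n y∈
                  in (x , n , x∈) , λ {z} z≈x → ∼-unique (σ-∼ z) x∼y z≈x } }
            ; σ-fixesK = λ k → σ-unique (ι∞ k) (∼-base k) }
            where module K∞ = RawRing K∞-rawRing

          moved⇒¬Q : √-3 ∼ (- √-3) → ¬ GalIsomorphicToSubgroupOf K̄ (cubic k₀ k₁ k₂ k₃ k₃≉0) x₀ (Q (suc m))
          moved⇒¬Q √-3∼-√-3 (lab , inH) = contradiction (∼-unique √-3∼-√-3 fixed refl) -√-3≉√-3
            where
            fixed : √-3 ∼ √-3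
            fixed = let p , σ≈ = LabelledTree.Q⇒√-3-fixed lab gal (inH gal) in ∼-resp refl σ≈ (σ-∼ (√-3 , p))
            -√-3≉√-3 : ¬ - √-3 ≈ √-3
            -√-3≉√-3 e = case •-injective Sign.- Sign.+ √-3≉0 e of λ ()

        √-3∉K⇒¬Q : (∀ k → ¬ ι k ≈ √-3) → ¬ GalIsomorphicToSubgroupOf K̄ (cubic k₀ k₁ k₂ k₃ k₃≉0) x₀ (Q (suc m))
        √-3∉K⇒¬Q √-3∉K =
          let D , C⊑D , nodes∈D = closure-exists algebraic algebraicallyClosed {c} em quadraticConjugation tree
          in FromConjugation.moved⇒¬Q D (conjugates D nodes∈D) (include C⊑D √-3∼-√-3)
          where
          open QuadraticConjugation √-3∉K
          conjugates : ∀ {r} (D : Conjugation r) →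
            (∀ n w → ∃[ y ] ∃[ y′ ] Conjugation._∼_ D (tree n w) y × Conjugation._∼_ D y′ (tree n w)) →
            ∀ n {z} → iterate f z n ≈ ι x₀ → (∃[ y ] Conjugation._∼_ D z y) × (∃[ y ] Conjugation._∼_ D y z)
          conjugates D nodes∈D n z∈ =
            let w , tree≈z = wordOf n z∈
                y , y′ , z∼y , y′∼z = nodes∈D n w
            in (y , Conjugation.∼-resp D tree≈z refl z∼y) , (y′ , Conjugation.∼-resp D refl tree≈z y′∼z)

        Q⇒-3-square : GalIsomorphicToSubgroupOf K̄ (cubic k₀ k₁ k₂ k₃ k₃≉0) x₀ (Q (suc m)) → MinusThreeIsSquare K
        Q⇒-3-square q = decidable-stable em λ -3≢□ → √-3∉K⇒¬Q (λ k ιk≈√-3 → -3≢□ (k , ι.injective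
          (trans (ι.*-homo k k) (trans (*-cong ιk≈√-3 ιk≈√-3) (trans √-3² (sym ι-minus3)))))) q

    conclusion : ∀ (√-3 : Carrier) → √-3 * √-3 ≈ - ⟦ + 3 ⟧ℤ →
      ∀ m → iterate f γ₁ (suc m) ≈ iterate f γ₂ (suc m) →
      ∀ x₀ → (∀ γ → IsCritical K̄ (cubic k₀ k₁ k₂ k₃ k₃≉0) γ → ¬ InBackwardOrbit K̄ (cubic k₀ k₁ k₂ k₃ k₃≉0) x₀ γ) →
      GalIsomorphicToSubgroupOf K̄ (cubic k₀ k₁ k₂ k₃ k₃≉0) x₀ (Q̃ (suc m)) ×
      (GalIsomorphicToSubgroupOf K̄ (cubic k₀ k₁ k₂ k₃ k₃≉0) x₀ (Q (suc m)) ⇔ MinusThreeIsSquare K)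
    conclusion √-3 √-3² m collide x₀ noncritical =
      Depth.Rooted.inQ̃ √-3 √-3² m collide x₀ noncritical ,
      mk⇔ (Depth.Rooted.Q⇒-3-square √-3 √-3² m collide x₀ noncritical)
          (Depth.Rooted.inQ √-3 √-3² m collide x₀ noncritical)

  collision : ∀ γ₁ γ₂ → IsCritical K̄ (cubic k₀ k₁ k₂ k₃ k₃≉0) γ₁ → IsCritical K̄ (cubic k₀ k₁ k₂ k₃ k₃≉0) γ₂ →
    ∀ m → CollideAt K̄ (cubic k₀ k₁ k₂ k₃ k₃≉0) (suc m) γ₁ γ₂ →
    LiesInBase (iterate f γ₁ (suc m)) ×
    (∀ x₀ → (∀ γ → IsCritical K̄ (cubic k₀ k₁ k₂ k₃ k₃≉0) γ → ¬ InBackwardOrbit K̄ (cubic k₀ k₁ k₂ k₃ k₃≉0) x₀ γ) →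
      GalIsomorphicToSubgroupOf K̄ (cubic k₀ k₁ k₂ k₃ k₃≉0) x₀ (Q̃ (suc m)) ×
      (GalIsomorphicToSubgroupOf K̄ (cubic k₀ k₁ k₂ k₃ k₃≉0) x₀ (Q (suc m)) ⇔ MinusThreeIsSquare K))
  collision γ₁ γ₂ crit₁ crit₂ m (collide , separate) =
    collision-base (suc m) collide , conclusion (√-3-exists .proj₁) (√-3-exists .proj₂) m collide
    where
    -- Equal critical points would have equal `m`-th iterates, contrary to the second half of the
    -- collision condition.
    open CriticalPoints γ₁ γ₂ (λ γ₁≈γ₂ → separate (iterate-cong m γ₁≈γ₂)) (critical⇒f′≈0 crit₁) (critical⇒f′≈0 crit₂)

theorem1p2 : ∀ {c ℓ₁ ℓ₂ c′ ℓ₁′ ℓ₂′ : Level} →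
    (∀ {p : Level} → ExcludedMiddle p) →
    (K : HeytingField c ℓ₁ ℓ₂) (K̄ : AlgebraicClosure K c′ ℓ₁′ ℓ₂′) →
    ¬ HasCharacteristic K 2 → ¬ HasCharacteristic K 3 →
    (f : Cubic K) (γ₁ γ₂ : AlgebraicClosure.Carrier K̄) →
    IsCritical K̄ f γ₁ → IsCritical K̄ f γ₂ →
    (ℓ : ℕ) → 2 ≤ ℓ → CollideAt K̄ f ℓ γ₁ γ₂ →
    AlgebraicClosure.LiesInBase K̄ (iterate (fL K̄ f) γ₁ ℓ)
    ×
    (∀ (x₀ : HeytingField.Carrier K) → ¬ IsPeriodic K̄ f x₀ →
    (∀ γ → IsCritical K̄ f γ → ¬ InBackwardOrbit K̄ f x₀ γ) →
    GalIsomorphicToSubgroupOf K̄ f x₀ (Q̃ ℓ)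
    ×
    (GalIsomorphicToSubgroupOf K̄ f x₀ (Q ℓ) ⇔ MinusThreeIsSquare K))
theorem1p2 em K K̄ char≢2 char≢3 (cubic k₀ k₁ k₂ k₃ k₃≉0) γ₁ γ₂
           crit₁ crit₂ (suc m) _ collide =
  let inBase , galois = Collision.collision em K K̄ char≢2 char≢3 k₀ k₁ k₂ k₃ k₃≉0 γ₁ γ₂ crit₁ crit₂ m collide
  in inBase , λ x₀ _ → galois x₀
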